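{- Let $f\in\mathbf{B}_{k,n}$, $P\in\mathcal{P}_{k,n}$ and $i\in[n]$. (A) Suppose $\ell(s_ifs_i)=\ell(f)+2$. If $s_iP=P$, or $P_i=\mathrm R$ and $P_{i+1}=\mathrm U$, then there is a bijection $$\operatorname{Deo}_{f,P}\to\operatorname{Deo}_{s_if,\,s_iP}\sqcup\operatorname{Deo}_{s_ifs_i,\,s_iP}.$$ Otherwise, if $P_i=\mathrm U$ and $P_{i+1}=\mathrm R$, there is a bijection $$\operatorname{Deo}_{f,P}\to\operatorname{Deo}_{fs_i,\,s_iP}\sqcup\operatorname{Deo}_{s_ifs_i,\,s_iP}.$$ (B) Suppose $\ell(f)=\ell(s_ifs_i)$ with $s_if>f$ and $fs_i<f$. If $s_iP=P$, or $P_i=\mathrm R$ and $P_{i+1}=\mathrm U$, then there is a bijection $$\operatorname{Deo}_{f,P}\to\operatorname{Deo}_{s_ifs_i,\,s_iP}.$$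
   Context: Let $n\ge 2$, $0\le k\le n$, $[n]=\{1,\dots,n\}$. An $n$-periodic affine permutation is a bijection $f:\mathbb{Z}\to\mathbb{Z}$ with $f(i+n)=f(i)+n$ for all $i$. Products are read from left to right: $(fg)(a)=g(f(a))$. $\mathbf{B}_{k,n}$ is the set of those with $\frac1n\sum_{i=1}^n(f(i)-i)=k$ and $i\le f(i)\le i+n$ for all $i$. The length is $\ell(f)=\#\{(a,b): a\in[n],\,b\in\mathbb{Z},\,a<b,\,f(a)>f(b)\}$. $s_i$ is the affine permutation exchanging $i+mn$ and $i+1+mn$ for all $m\in\mathbb{Z}$ and fixing all other integers. We write $s_if>f$ (resp. $fs_i<f$) if $\ell(s_if)>\ell(f)$ (resp. $\ell(fs_i)<\ell(f)$). Lattice paths: $\mathcal{P}_{k,n}$ is the set of lattice paths $P$ from $(0,0)$ to $(n-k,k)$ with unit steps $P_1,\dots,P_n\in\{\mathrm R,\mathrm U\}$ (right, up); $s_iP$ is obtained by swapping the steps $P_i$ and $P_{i+1}$, indices modulo $n$. Extend $P$ to a bi-infinite path with steps indexed by $\mathbb{Z}$ via $P_{i+n}=P_i$ (step $1$ starts at $(0,0)$); it is invariant under translation by $(n-k,k)$. The strip of $P$ is the region between the extended path $P$ (southern boundary) and its translate $P+(0,k)$ (northern boundary). On each boundary the unit edges are labeled by $\mathbb{Z}$: the southern edge labeled $i$ is step $i$ of $P$, and the northern edge labeled $i$ is its translate by $(0,k)$. Fillings: a periodic filling assigns to each unit box of the strip a crossing or an elbow, invariantly under translation by $(n-k,k)$.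 Strands enter at the northern boundary edges and travel right/down: in a crossing box a strand entering from the left exits right and one entering from the top exits at the bottom; in an elbow box a strand entering from the left exits at the bottom and one entering from the top exits right. Each strand ends at a southern boundary edge; the strand permutation sends $i$ to $j$ if the strand entering at northern edge $i$ exits at southern edge $j$. For an $n$-periodic affine permutation $f$, $\operatorname{Deo}_{f,P}$ is the (finite, possibly empty) set of $(f,P)$-affine Deograms: periodic fillings with strand permutation $f$ such that whenever two strands form an elbow in a box, they have crossed each other an even number of times in boxes traversed before it (counting from the northern boundary). -}

module Defs where

open import Data.Fin.Base as Fin using (Fin; zero; suc; toℕ; fromℕ<)
import Data.Fin.Properties as Finₚ
open import Data.Integer.Base using (ℤ; +_; -[1+_]; _+_; _-_; -_; _*_; _≤_; _<_; 0ℤ; 1ℤ; ∣_∣; +<+; +≤+; -≤+)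
open import Data.Integer.Divisibility.Signed using (_∣_; _∣?_; ∣-refl; ∣m∣n⇒∣m+n; ∣m∣n⇒∣m-n; ∣⇒∣ᵤ)
open import Data.Integer.DivMod using (_%ℕ_; _/ℕ_; n%ℕd<d; a≡a%ℕn+[a/ℕn]*n)
import Data.Integer.Properties as ℤₚ
open import Data.Integer.Tactic.RingSolver using (solve-∀)
open import Data.List.Base using (List; []; _∷_; filter; length)
import Data.List.Membership.DecPropositional as DecMembership
open import Data.Nat.Base as ℕ using (ℕ; NonTrivial; nonTrivial⇒nonZero; nonTrivial⇒≢1)
import Data.Nat.Divisibility as ℕDiv
import Data.Nat.Properties as ℕₚ
open import Data.Product.Base using (Σ; Σ-syntax; ∃; ∃₂; _×_; _,_; proj₁; proj₂; uncurry)
import Data.Product.Properties as Productₚ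
open import Data.Product.Function.Dependent.Propositional using (Σ-↔)
import Data.Rational.Base as ℚ
open import Data.Sum.Base using (_⊎_; inj₁; inj₂)
open import Data.Sum.Function.Propositional using (_⊎-↔_)
open import Data.Vec.Base using (Vec; []; _∷_; lookup; count; _[_]≔_)
import Data.Vec.Properties as Vecₚ
open import Function.Base using (_∘_)
open import Function.Bundles using (_↔_; Inverse; mk↔ₛ′)
open import Function.Construct.Composition using (_↔-∘_)
open import Function.Construct.Identity using (↔-id)
open import Function.Construct.Symmetry using (↔-sym)
open import Level using (0ℓ)
open import Relation.Binary.Bundles using (Setoid)
open import Relation.Binary.Definitions using (DecidableEquality)
open import Relation.Binary.PropositionalEquality
open import Relation.Nullary using (Dec; yes; no; ¬_; Irrelevant; contradiction)
open import Relation.Nullary.Decidable using (_×-dec_)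
open import Algebra.Properties.CommutativeMonoid.Sum ℤₚ.+-0-commutativeMonoid using (sum-syntax)

infixl 7 _·_
infix 4 _≟ˢ_ _≟ᵗ_ _≈_

------------------------------------------------------------------------
-- Affine permutations

-- Fin n stands for [n] = {1,…,n}.
label : ∀ {n} → Fin n → ℤ
label i = + ℕ.suc (toℕ i)

-- The element of [n] congruent to j modulo n.
residue : ∀ {n} → .{{NonTrivial n}} → ℤ → Fin n
residue {n} j = fromℕ< (n%ℕd<d (j - 1ℤ) n)
  where instance _ = nonTrivial⇒nonZero n

record AffinePerm (n : ℕ) : Set where
  field
    bijection : ℤ ↔ ℤ
  open Inverse bijection public using (to; from)
  field
    periodic : ∀ a → to (a + + n) ≡ to a + + n

open AffinePerm public using (to; periodic)

-- Products are read from left to right.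
_·_ : ∀ {n} → AffinePerm n → AffinePerm n → AffinePerm n
f · g = record
  { bijection = AffinePerm.bijection g ↔-∘ AffinePerm.bijection f
  ; periodic  = λ a → trans (cong (to g) (periodic f a)) (periodic g (to f a))
  }

record Bounded {n} .{{_ : NonTrivial n}} (k : ℕ) (f : AffinePerm n) : Set where
  private instance _ = nonTrivial⇒nonZero n
  field
    average : (∑[ i < n ] (to f (label i) - label i)) ℚ./ n ≡ + k ℚ./ 1
    lower   : ∀ i → i ≤ to f i
    upper   : ∀ i → to f i ≤ i + + n

Inversion : ∀ {n} → AffinePerm n → Set
Inversion {n} f = Σ[ a ∈ Fin n ] Σ[ b ∈ ℤ ] label a < b × to f b < to f (label a)

private
  to-shift-ℕ : ∀ {n} (f : AffinePerm n) a q → to f (a + + q * + n) ≡ to f a + + q * + n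
  to-shift-ℕ {n} f a ℕ.zero = begin
    to f (a + 0ℤ) ≡⟨ cong (to f) (ℤₚ.+-identityʳ a) ⟩
    to f a        ≡⟨ ℤₚ.+-identityʳ (to f a) ⟨
    to f a + 0ℤ   ∎
    where open ≡-Reasoning
  to-shift-ℕ {n} f a (ℕ.suc q) = begin
    to f (a + (1ℤ + + q) * + n)   ≡⟨ cong (to f) (regroup a (+ q) (+ n)) ⟩
    to f (a + + q * + n + + n)    ≡⟨ periodic f _ ⟩
    to f (a + + q * + n) + + n    ≡⟨ cong (_+ + n) (to-shift-ℕ f a q) ⟩
    to f a + + q * + n + + n      ≡⟨ regroup (to f a) (+ q) (+ n) ⟨
    to f a + (1ℤ + + q) * + n     ∎
    where
    open ≡-Reasoning
    regroup : ∀ a q n → a + (1ℤ + q) * n ≡ a + q * n + n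
    regroup = solve-∀

  to-shift : ∀ {n} (f : AffinePerm n) a q → to f (a + q * + n) ≡ to f a + q * + n
  to-shift f a (+ q) = to-shift-ℕ f a q
  to-shift {n} f a q@(-[1+ m ]) = begin
    to f a′                         ≡⟨ insert (to f a′) (+ ℕ.suc m) (+ n) ⟩
    to f a′ + r * + n + q * + n     ≡⟨ cong (_+ q * + n) (to-shift-ℕ f a′ (ℕ.suc m)) ⟨
    to f (a′ + r * + n) + q * + n   ≡⟨ cong (λ x → to f x + q * + n) (cancel a r (+ n)) ⟩
    to f a + q * + n                ∎
    where
    open ≡-Reasoning
    r  = + ℕ.suc m
    a′ = a + q * + n
    insert : ∀ x r n → x ≡ x + r * n + (- r) * n
    insert = solve-∀
    cancel : ∀ a r n → a + (- r) * n + r * n ≡ a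
    cancel = solve-∀

  label-residue : ∀ {n} .{{_ : NonTrivial n}} j →
                  ∃ λ q → j ≡ label (residue {n} j) + q * + n
  label-residue {n} j = q , (begin
    j                                         ≡⟨ restore j ⟩
    1ℤ + (j - 1ℤ)                             ≡⟨ cong (λ x → 1ℤ + x) (a≡a%ℕn+[a/ℕn]*n (j - 1ℤ) n) ⟩
    1ℤ + (+ ((j - 1ℤ) %ℕ n) + q * + n)        ≡⟨ ℤₚ.+-assoc 1ℤ (+ ((j - 1ℤ) %ℕ n)) (q * + n) ⟨
    + ℕ.suc ((j - 1ℤ) %ℕ n) + q * + n         ≡⟨ cong (λ r → + ℕ.suc r + q * + n)
                                                   (Finₚ.toℕ-fromℕ< (n%ℕd<d (j - 1ℤ) n)) ⟨
    label (residue {n} j) + q * + n           ∎)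
    where
    open ≡-Reasoning
    instance _ = nonTrivial⇒nonZero n
    q = (j - 1ℤ) /ℕ n
    restore : ∀ j → j ≡ 1ℤ + (j - 1ℤ)
    restore = solve-∀

  upperBound : ∀ {m} (g : Fin m → ℕ) → ∃ λ D → ∀ i → g i ℕ.≤ D
  upperBound {ℕ.zero}  g = 0 , λ ()
  upperBound {ℕ.suc m} g with upperBound (g ∘ suc)
  ... | D , g≤D = g zero ℕ.+ D , λ where
    zero    → ℕₚ.m≤m+n (g zero) D
    (suc i) → ℕₚ.≤-trans (g≤D i) (ℕₚ.m≤n+m D (g zero))

  displacement : ∀ {n} .{{_ : NonTrivial n}} (f : AffinePerm n) →
                 ∃ λ D → ∀ a → ∣ to f a - a ∣ ℕ.≤ D
  displacement {n} f with upperBound (λ i → ∣ to f (label {n} i) - label i ∣)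
  ... | D , ≤D = D , λ a → let q , a≡ = label-residue {n} a; r = residue {n} a in
    subst (ℕ._≤ D) (cong ∣_∣ (begin
      to f (label r) - label r                           ≡⟨ regroup (to f (label r)) (label r) (q * + n) ⟩
      to f (label r) + q * + n - (label r + q * + n)     ≡⟨ cong (_- (label r + q * + n)) (to-shift f (label r) q) ⟨
      to f (label r + q * + n) - (label r + q * + n)     ≡⟨ cong (λ x → to f x - x) a≡ ⟨
      to f a - a                                         ∎)) (≤D r)
    where
    open ≡-Reasoning
    regroup : ∀ x y z → x - y ≡ x + z - (y + z)
    regroup = solve-∀

  finite-Σ : ∀ m {P : Fin m → Set} → (∀ x → Dec (P x)) → (∀ x → Irrelevant (P x)) →
             ∃ λ l → Σ (Fin m) P ↔ Fin l
  finite-Σ ℕ.zero P? irr = 0 , mk↔ₛ′ (λ ()) (λ ()) (λ ()) (λ ())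
  finite-Σ (ℕ.suc m) {P} P? irr with finite-Σ m (P? ∘ suc) (λ x → irr (suc x)) | P? zero
  ... | l , tail | no ¬p = l , (tail ↔-∘ split)
    where
    split : Σ (Fin (ℕ.suc m)) P ↔ Σ (Fin m) (P ∘ suc)
    split = mk↔ₛ′ (λ { (zero , p) → contradiction p ¬p ; (suc x , p) → x , p })
                  (λ (x , p) → suc x , p) (λ _ → refl)
                  (λ { (zero , p) → contradiction p ¬p ; (suc x , p) → refl })
  ... | l , tail | yes p₀ = ℕ.suc l , (↔-sym Finₚ.+↔⊎ ↔-∘ ((↔-id _ ⊎-↔ tail) ↔-∘ split))
    where
    split : Σ (Fin (ℕ.suc m)) P ↔ (Fin 1 ⊎ Σ (Fin m) (P ∘ suc))
    split = mk↔ₛ′ (λ { (zero , p) → inj₁ zero ; (suc x , p) → inj₂ (x , p) })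
                  (λ { (inj₁ _) → zero , p₀ ; (inj₂ (x , p)) → suc x , p })
                  (λ { (inj₁ zero) → refl ; (inj₂ _) → refl })
                  (λ { (zero , p) → cong (zero ,_) (irr zero p₀ p) ; (suc x , p) → refl })

  finite-inversions : ∀ {n} (f : AffinePerm n) D → (∀ a → ∣ to f a - a ∣ ℕ.≤ D) →
                      ∃ λ l → Inversion f ↔ Fin l
  finite-inversions {n} f D ≤D =
    let l , β = finite-Σ (n ℕ.* B) (λ x → P? (Fin.remQuot {n} B x)) (λ x → ℤₚ.<-irrelevant)
    in l , (β ↔-∘ (Σ-↔ (↔-sym (Finₚ.*↔× {n} {B})) (λ {x} → reindex x) ↔-∘ toCandidate))
    where
    B : ℕ
    B = D ℕ.+ D

    P : Fin n × Fin B → Set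
    P (a , c) = to f (label a + + ℕ.suc (toℕ c)) < to f (label a)

    P? : ∀ x → Dec (P x)
    P? _ = _ ℤₚ.<? _

    ≡⇒↔ : ∀ {x y} → x ≡ y → P x ↔ P y
    ≡⇒↔ refl = ↔-id _

    reindex : ∀ x → P x ↔ P (Fin.remQuot {n} B (Fin.combine (proj₁ x) (proj₂ x)))
    reindex (a , c) = ≡⇒↔ (sym (Finₚ.remQuot-combine {n} {B} a c))

    inversion-≡ : ∀ {a b c} {p : label {n} a < b × to f b < to f (label a)}
                  {q : label {n} a < c × to f c < to f (label a)} → b ≡ c →
                  _≡_ {A = Inversion f} (a , b , p) (a , c , q)
    inversion-≡ {p = p₁ , p₂} {q₁ , q₂} refl
      rewrite ℤₚ.<-irrelevant p₁ q₁ | ℤₚ.<-irrelevant p₂ q₂ = refl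

    positive : ∀ {i} → 0ℤ < i → ∃ λ c → i ≡ + ℕ.suc c
    positive {+ ℕ.suc c} _ = c , refl
    positive {+ ℕ.zero} (+<+ ())

    i≤∣i∣ : ∀ i → i ≤ + ∣ i ∣
    i≤∣i∣ (+ _)    = ℤₚ.≤-refl
    i≤∣i∣ -[1+ _ ] = -≤+

    width : ∀ a b → to f b < to f a → b - a < + B
    width a b fb<fa = begin-strict
      b - a                                           ≡⟨ regroup a b (to f b) ⟩
      to f b + ((b - a) - to f b)                     <⟨ ℤₚ.+-monoˡ-< ((b - a) - to f b) fb<fa ⟩
      to f a + ((b - a) - to f b)                     ≡⟨ regroup′ a b (to f a) (to f b) ⟩
      (to f a - a) - (to f b - b)                     ≤⟨ i≤∣i∣ _ ⟩
      + ∣ (to f a - a) - (to f b - b) ∣               ≤⟨ +≤+ (ℤₚ.∣i-j∣≤∣i∣+∣j∣ (to f a - a) (to f b - b)) ⟩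
      + (∣ to f a - a ∣ ℕ.+ ∣ to f b - b ∣)           ≤⟨ +≤+ (ℕₚ.+-mono-≤ (≤D a)
                                                                          (≤D b)) ⟩
      + B                                             ∎
      where
      open ℤₚ.≤-Reasoning
      regroup : ∀ a b y → b - a ≡ y + ((b - a) - y)
      regroup = solve-∀
      regroup′ : ∀ a b x y → x + ((b - a) - y) ≡ (x - a) - (y - b)
      regroup′ = solve-∀

    offset : ∀ a b → a < b → to f b < to f a → Σ[ c ∈ Fin B ] b ≡ a + + ℕ.suc (toℕ c)
    offset a b a<b fb<fa with positive (subst (_< b - a) (ℤₚ.+-inverseʳ a) (ℤₚ.+-monoˡ-< (- a) a<b))
    ... | c , b-a≡ = fromℕ< c<B , (begin
      b                                     ≡⟨ restore a b ⟩
      a + (b - a)                           ≡⟨ cong (λ x → a + x) b-a≡ ⟩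
      a + + ℕ.suc c                         ≡⟨ cong (λ x → a + + ℕ.suc x) (Finₚ.toℕ-fromℕ< c<B) ⟨
      a + + ℕ.suc (toℕ (fromℕ< c<B))        ∎)
      where
      open ≡-Reasoning
      restore : ∀ a b → b ≡ a + (b - a)
      restore = solve-∀
      c<B : c ℕ.< B
      c<B = ℕₚ.<-trans (ℕₚ.n<1+n c) (ℤₚ.drop‿+<+ (subst (_< + B) b-a≡ (width a b fb<fa)))

    toInversion : Σ (Fin n × Fin B) P → Inversion f
    toInversion ((a , c) , p) = a , label a + + ℕ.suc (toℕ c)
                              , +<+ (ℕₚ.m<m+n _ ℕ.z<s) , p

    fromInversion : Inversion f → Σ (Fin n × Fin B) P
    fromInversion (a , b , a<b , p) =
      let c , b≡ = offset (label a) b a<b p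
      in (a , c) , subst (λ x → to f x < to f (label a)) b≡ p

    to∘from : ∀ x → toInversion (fromInversion x) ≡ x
    to∘from (a , b , a<b , p) = inversion-≡ (sym (proj₂ (offset (label a) b a<b p)))

    toInversion-injective : ∀ x y → toInversion x ≡ toInversion y → x ≡ y
    toInversion-injective ((a , c) , p) ((a′ , c′) , p′) eq =
      candidate-≡ (cong (λ (z : Inversion f) → proj₁ z) eq)
                  (cong (λ (z : Inversion f) → proj₁ (proj₂ z)) eq)
      where
      candidate-≡ : a ≡ a′ → label a + + ℕ.suc (toℕ c) ≡ label a′ + + ℕ.suc (toℕ c′) →
                    _≡_ {A = Σ (Fin n × Fin B) P} ((a , c) , p) ((a′ , c′) , p′)
      candidate-≡ refl eq′
        with Finₚ.toℕ-injective {i = c} {c′}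
               (ℕₚ.suc-injective (ℕₚ.+-cancelˡ-≡ (ℕ.suc (toℕ a)) _ _ (ℤₚ.+-injective eq′)))
      ... | refl = cong ((a , c) ,_) (ℤₚ.<-irrelevant p p′)

    toCandidate : Inversion f ↔ Σ (Fin n × Fin B) P
    toCandidate = mk↔ₛ′ fromInversion toInversion
      (λ x → toInversion-injective _ _ (to∘from (toInversion x))) to∘from

abstract
  inversions-finite : ∀ {n} .{{_ : NonTrivial n}} (f : AffinePerm n) →
                      ∃ λ l → Inversion f ↔ Fin l
  inversions-finite f = uncurry (finite-inversions f) (displacement f)

ℓ : ∀ {n} → .{{NonTrivial n}} → AffinePerm n → ℕ
ℓ f = proj₁ (inversions-finite f)

module _ {n : ℕ} .{{_ : NonTrivial n}} (i : Fin n) where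

  s-to : ℤ → ℤ
  s-to a with + n ∣? a - label i | + n ∣? a - (label i + 1ℤ)
  ... | yes _ | _     = a + 1ℤ
  ... | no  _ | yes _ = a - 1ℤ
  ... | no  _ | no  _ = a

  private
    disjoint : ∀ a → + n ∣ a - label i → ¬ (+ n ∣ a - (label i + 1ℤ))
    disjoint a p q = nonTrivial⇒≢1 (ℕDiv.∣1⇒≡1 (∣⇒∣ᵤ (subst (+ n ∣_) (diff a (label i)) (∣m∣n⇒∣m-n p q))))
      where
      diff : ∀ a x → (a - x) - (a - (x + 1ℤ)) ≡ 1ℤ
      diff = solve-∀

    s-to-i : ∀ a → + n ∣ a - label i → s-to a ≡ a + 1ℤ
    s-to-i a p with + n ∣? a - label i | + n ∣? a - (label i + 1ℤ)
    ... | yes _ | _ = refl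
    ... | no ¬p | _ = contradiction p ¬p

    s-to-i+1 : ∀ a → + n ∣ a - (label i + 1ℤ) → s-to a ≡ a - 1ℤ
    s-to-i+1 a q with + n ∣? a - label i | + n ∣? a - (label i + 1ℤ)
    ... | yes p | _     = contradiction q (disjoint a p)
    ... | no  _ | yes _ = refl
    ... | no  _ | no ¬q = contradiction q ¬q

    s-to-fixed : ∀ a → ¬ (+ n ∣ a - label i) → ¬ (+ n ∣ a - (label i + 1ℤ)) → s-to a ≡ a
    s-to-fixed a ¬p ¬q with + n ∣? a - label i | + n ∣? a - (label i + 1ℤ)
    ... | yes p | _     = contradiction p ¬p
    ... | no  _ | yes q = contradiction q ¬q
    ... | no  _ | no  _ = refl

    s-to-involutive : ∀ a → s-to (s-to a) ≡ a
    s-to-involutive a with + n ∣? a - label i | + n ∣? a - (label i + 1ℤ)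
    ... | yes p | _     = trans (s-to-i+1 (a + 1ℤ) (subst (+ n ∣_) (shift a (label i)) p)) (back a)
      where
      shift : ∀ a x → a - x ≡ (a + 1ℤ) - (x + 1ℤ)
      shift = solve-∀
      back : ∀ a → (a + 1ℤ) - 1ℤ ≡ a
      back = solve-∀
    ... | no  _ | yes q = trans (s-to-i (a - 1ℤ) (subst (+ n ∣_) (shift a (label i)) q)) (back a)
      where
      shift : ∀ a x → a - (x + 1ℤ) ≡ (a - 1ℤ) - x
      shift = solve-∀
      back : ∀ a → (a - 1ℤ) + 1ℤ ≡ a
      back = solve-∀
    ... | no ¬p | no ¬q = s-to-fixed a ¬p ¬q

    ∣-shift : ∀ a x → + n ∣ a - x → + n ∣ (a + + n) - x
    ∣-shift a x p = subst (+ n ∣_) (eq a x (+ n)) (∣m∣n⇒∣m+n p ∣-refl)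
      where
      eq : ∀ a x m → (a - x) + m ≡ (a + m) - x
      eq = solve-∀

    ∣-unshift : ∀ a x → + n ∣ (a + + n) - x → + n ∣ a - x
    ∣-unshift a x p = subst (+ n ∣_) (eq a x (+ n)) (∣m∣n⇒∣m-n p ∣-refl)
      where
      eq : ∀ a x m → ((a + m) - x) - m ≡ a - x
      eq = solve-∀

    s-to-periodic : ∀ a → s-to (a + + n) ≡ s-to a + + n
    s-to-periodic a with + n ∣? a - label i | + n ∣? a - (label i + 1ℤ)
    ... | yes p | _     = trans (s-to-i _ (∣-shift a _ p)) (eq a (+ n))
      where
      eq : ∀ a m → (a + m) + 1ℤ ≡ (a + 1ℤ) + m
      eq = solve-∀
    ... | no  _ | yes q = trans (s-to-i+1 _ (∣-shift a _ q)) (eq a (+ n))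
      where
      eq : ∀ a m → (a + m) - 1ℤ ≡ (a - 1ℤ) + m
      eq = solve-∀
    ... | no ¬p | no ¬q = s-to-fixed _ (¬p ∘ ∣-unshift a _) (¬q ∘ ∣-unshift a _)

  s : AffinePerm n
  s = record
    { bijection = mk↔ₛ′ s-to s-to s-to-involutive s-to-involutive
    ; periodic  = s-to-periodic
    }

------------------------------------------------------------------------
-- Lattice paths

data Step : Set where
  R U : Step

_≟ˢ_ : DecidableEquality Step
R ≟ˢ R = yes refl
R ≟ˢ U = no λ ()
U ≟ˢ R = no λ ()
U ≟ˢ U = yes refl

-- The two counts say that the path ends at (n - k , k).
record LatticePath (k n : ℕ) : Set where
  field
    steps  : Vec Step n
    rights : count (R ≟ˢ_) steps ≡ n ℕ.∸ k
    ups    : count (U ≟ˢ_) steps ≡ k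

open LatticePath public using (steps)

private
  weight : Step → Step → ℕ
  weight x y = count (x ≟ˢ_) (y ∷ [])

  count-∷ : ∀ {m} x y (v : Vec Step m) → count (x ≟ˢ_) (y ∷ v) ≡ weight x y ℕ.+ count (x ≟ˢ_) v
  count-∷ x y v with x ≟ˢ y
  ... | yes _ = refl
  ... | no  _ = refl

  count-≔ : ∀ {m} x y (v : Vec Step m) i →
            weight x (lookup v i) ℕ.+ count (x ≟ˢ_) (v [ i ]≔ y) ≡ weight x y ℕ.+ count (x ≟ˢ_) v
  count-≔ x y (z ∷ v) zero = begin
    weight x z ℕ.+ count (x ≟ˢ_) (y ∷ v)        ≡⟨ cong (weight x z ℕ.+_) (count-∷ x y v) ⟩
    weight x z ℕ.+ (weight x y ℕ.+ c)           ≡⟨ ℕₚ.+-assoc (weight x z) (weight x y) c ⟨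
    weight x z ℕ.+ weight x y ℕ.+ c             ≡⟨ cong (ℕ._+ c) (ℕₚ.+-comm (weight x z) (weight x y)) ⟩
    weight x y ℕ.+ weight x z ℕ.+ c             ≡⟨ ℕₚ.+-assoc (weight x y) (weight x z) c ⟩
    weight x y ℕ.+ (weight x z ℕ.+ c)           ≡⟨ cong (weight x y ℕ.+_) (count-∷ x z v) ⟨
    weight x y ℕ.+ count (x ≟ˢ_) (z ∷ v)        ∎
    where
    open ≡-Reasoning
    c = count (x ≟ˢ_) v
  count-≔ x y (z ∷ v) (suc i) = begin
    w ℕ.+ count (x ≟ˢ_) (z ∷ v [ i ]≔ y)                 ≡⟨ cong (w ℕ.+_) (count-∷ x z (v [ i ]≔ y)) ⟩
    w ℕ.+ (weight x z ℕ.+ count (x ≟ˢ_) (v [ i ]≔ y))    ≡⟨ swap w (weight x z) _ ⟩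
    weight x z ℕ.+ (w ℕ.+ count (x ≟ˢ_) (v [ i ]≔ y))    ≡⟨ cong (weight x z ℕ.+_) (count-≔ x y v i) ⟩
    weight x z ℕ.+ (weight x y ℕ.+ count (x ≟ˢ_) v)      ≡⟨ swap (weight x z) (weight x y) _ ⟩
    weight x y ℕ.+ (weight x z ℕ.+ count (x ≟ˢ_) v)      ≡⟨ cong (weight x y ℕ.+_) (count-∷ x z v) ⟨
    weight x y ℕ.+ count (x ≟ˢ_) (z ∷ v)                 ∎
    where
    open ≡-Reasoning
    w = weight x (lookup v i)
    swap : ∀ a b c → a ℕ.+ (b ℕ.+ c) ≡ b ℕ.+ (a ℕ.+ c)
    swap a b c = trans (sym (ℕₚ.+-assoc a b c)) (trans (cong (ℕ._+ c) (ℕₚ.+-comm a b)) (ℕₚ.+-assoc b a c))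

  count-swap : ∀ {m} x (v : Vec Step m) i j →
               count (x ≟ˢ_) (v [ i ]≔ lookup v j [ j ]≔ lookup v i) ≡ count (x ≟ˢ_) v
  count-swap x v i j = ℕₚ.+-cancelˡ-≡ (weight x (lookup v j)) _ _ (begin
    weight x (lookup v j) ℕ.+ count (x ≟ˢ_) (v′ [ j ]≔ lookup v i)    ≡⟨ cong (λ y → weight x y ℕ.+ count (x ≟ˢ_) (v′ [ j ]≔ lookup v i)) v′ⱼ ⟨
    weight x (lookup v′ j) ℕ.+ count (x ≟ˢ_) (v′ [ j ]≔ lookup v i)   ≡⟨ count-≔ x (lookup v i) v′ j ⟩
    weight x (lookup v i) ℕ.+ count (x ≟ˢ_) v′                        ≡⟨ count-≔ x (lookup v j) v i ⟩
    weight x (lookup v j) ℕ.+ count (x ≟ˢ_) v                         ∎)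
    where
    open ≡-Reasoning
    v′ = v [ i ]≔ lookup v j
    v′ⱼ : lookup v′ j ≡ lookup v j
    v′ⱼ with j Finₚ.≟ i
    ... | yes refl = Vecₚ.lookup∘update j v (lookup v j)
    ... | no  j≢i  = Vecₚ.lookup∘update′ j≢i v (lookup v j)

module _ {k n : ℕ} .{{_ : NonTrivial n}} where

  step : LatticePath k n → ℤ → Step
  step P j = lookup (steps P) (residue j)

  swapSteps : Fin n → LatticePath k n → LatticePath k n
  swapSteps i P = record
    { steps  = steps P [ i ]≔ lookup (steps P) i+1 [ i+1 ]≔ lookup (steps P) i
    ; rights = trans (count-swap R (steps P) i i+1) (LatticePath.rights P)
    ; ups    = trans (count-swap U (steps P) i i+1) (LatticePath.ups P)
    }
    where
    i+1 : Fin n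
    i+1 = residue (label i + 1ℤ)

------------------------------------------------------------------------
-- The strip of a path

Point : Set
Point = ℤ × ℤ

infixl 6 _⊕_
_⊕_ : Point → Point → Point
(x , y) ⊕ (x′ , y′) = (x + x′ , y + y′)

forward backward : Step → Point → Point
forward  R (x , y) = (x + 1ℤ , y)
forward  U (x , y) = (x , y + 1ℤ)
backward R (x , y) = (x - 1ℤ , y)
backward U (x , y) = (x , y - 1ℤ)

-- Unit edges, given by their left, respectively lower, endpoint.
data Edge : Set where
  horizontal vertical : Point → Edge

edge : Step → Point → Edge
edge R = horizontal
edge U = vertical

-- Unit boxes, given by their lower left corner.
Box : Set
Box = Point

left right bottom top : Box → Edge
left   b       = vertical b
right  (x , y) = vertical (x + 1ℤ , y)
bottom b       = horizontal b
top    (x , y) = horizontal (x , y + 1ℤ)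

module _ {k n : ℕ} .{{_ : NonTrivial n}} (P : LatticePath k n) where

  -- Step j of the extended path leads from vertex (j - 1) to vertex j.
  vertex : ℤ → Point
  vertex (+ ℕ.zero)      = (0ℤ , 0ℤ)
  vertex (+ ℕ.suc m)     = forward  (step P (+ ℕ.suc m)) (vertex (+ m))
  vertex -[1+ ℕ.zero ]   = backward (step P 0ℤ) (0ℤ , 0ℤ)
  vertex -[1+ ℕ.suc m ]  = backward (step P -[1+ m ]) (vertex -[1+ m ])

  southEdge northEdge : ℤ → Edge
  southEdge j = edge (step P j) (vertex (j - 1ℤ))
  northEdge j = edge (step P j) (vertex (j - 1ℤ) ⊕ (0ℤ , + k))

  -- In its column, the box lies above the southern and below the northern boundary.
  record InStrip (b : Box) : Set where
    field
      south : ∃₂ λ j h → southEdge j ≡ horizontal (proj₁ b , h) × h ≤ proj₂ b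
      north : ∃₂ λ j h → northEdge j ≡ horizontal (proj₁ b , h) × proj₂ b + 1ℤ ≤ h

  period : Point
  period = (+ n - + k , + k)

------------------------------------------------------------------------
-- Fillings and strands

data Tile : Set where
  crossing elbow : Tile

_≟ᵗ_ : DecidableEquality Tile
crossing ≟ᵗ crossing = yes refl
crossing ≟ᵗ elbow    = no λ ()
elbow    ≟ᵗ crossing = no λ ()
elbow    ≟ᵗ elbow    = yes refl

-- Only the tiles in the strip are meaningful: fillings are compared by _≈_ below,
-- and strands never leave the strip.
record Filling {k n} .{{_ : NonTrivial n}} (P : LatticePath k n) : Set where
  field
    tile     : Box → Tile
    periodic : ∀ b → InStrip P b → tile (b ⊕ period P) ≡ tile b

open Filling public using (tile)

_≈_ : ∀ {k n} .{{_ : NonTrivial n}} {P : LatticePath k n} → Filling P → Filling P → Set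
_≈_ {P = P} F G = ∀ b → InStrip P b → tile F b ≡ tile G b

-- The box entered by a strand moving right or down through an edge.
ahead : Edge → Box
ahead (vertical (x , y))   = (x , y)
ahead (horizontal (x , y)) = (x , y - 1ℤ)

-- The edge through which a strand that came in through e leaves the box ahead of e.
exit : Tile → Edge → Edge
exit crossing e@(vertical _)   = right  (ahead e)
exit crossing e@(horizontal _) = bottom (ahead e)
exit elbow    e@(vertical _)   = bottom (ahead e)
exit elbow    e@(horizontal _) = right  (ahead e)

module _ {k n : ℕ} .{{_ : NonTrivial n}} {P : LatticePath k n} (F : Filling P) where

  infixl 5 _▹_

  -- Strand i e: initial segments, ending at the edge e, of the strand that enters
  -- at the northern edge i.
  data Strand (i : ℤ) : Edge → Set where
    enter : Strand i (northEdge P i)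
    _▹_   : ∀ {e} → Strand i e → InStrip P (ahead e) → Strand i (exit (tile F (ahead e)) e)

  traversed : ∀ {i e} → Strand i e → List Box
  traversed enter           = []
  traversed (_▹_ {e} σ _)   = ahead e ∷ traversed σ

  open DecMembership (Productₚ.≡-dec ℤₚ._≟_ ℤₚ._≟_) using (_∈?_)

  -- The number of crossing boxes traversed by both σ and τ.
  crossings : ∀ {i j d e} → Strand i d → Strand j e → ℕ
  crossings σ τ = length (filter (λ b → tile F b ≟ᵗ crossing ×-dec b ∈? traversed τ) (traversed σ))

  IsStrandPermutation : AffinePerm n → Set
  IsStrandPermutation f = ∀ i → Strand i (southEdge P (to f i))

  ElbowsEven : Set
  ElbowsEven = ∀ {i j} b → InStrip P b → tile F b ≡ elbow →
               (σ : Strand i (left b)) (τ : Strand j (top b)) → 2 ℕDiv.∣ crossings σ τ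

------------------------------------------------------------------------
-- Affine Deograms

record Deogram {k n} .{{_ : NonTrivial n}} (f : AffinePerm n) (P : LatticePath k n) : Set where
  field
    filling           : Filling P
    strandPermutation : IsStrandPermutation filling f
    elbowsEven        : ElbowsEven filling

Deo : ∀ {k n} → .{{NonTrivial n}} → AffinePerm n → LatticePath k n → Setoid 0ℓ 0ℓ
Deo f P = record
  { Carrier       = Deogram f P
  ; _≈_           = λ D E → Deogram.filling D ≈ Deogram.filling E
  ; isEquivalence = record
    { refl  = λ _ _ → refl
    ; sym   = λ D≈E b b∈ → sym (D≈E b b∈)
    ; trans = λ D≈E E≈F b b∈ → trans (D≈E b b∈) (E≈F b b∈)
    }
  }

{-# OPTIONS --safe #-}

-- Cut the strip of P into boxes by flipping corners UR of the northern boundary to RU, one periodic family at a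
-- time, until the southern boundary is reached. Two strands have crossed an even number of times exactly when
-- they are in their original order, so the affine Deograms are the distinguished subexpressions for f of the word
-- of flipped positions, and their number satisfies N(v, w d) = N(v s_d, w) + [v s_d > v] N(v, w). These operators
-- on functions of v satisfy the braid relations and commute with their left-handed analogues, and on the function
-- belonging to the empty word the left operator at c agrees with the right one at c + k. Hence a box added at the
-- north acts by a left operator. If s_i P ≠ P, then the words of P and s_i P differ by moving one letter from the
-- south end to the north end. If s_i P = P, then the letter i can be pushed through the word by braid moves,
-- because the two columns or rows of the steps i and i + 1 run in parallel; so the left and right operators at i
-- agree on N(–, w). In each case the bijection results from comparing the two recurrences.

module Submission where

open import Defs
open import Algebra.Bundles using (module AbelianGroup)
import Algebra.Properties.Group as GroupProperties
open import Data.Bool.Base using (Bool; true; false; not; _xor_)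
import Data.Bool.Properties as Boolₚ
open import Data.Fin.Base as Fin using (Fin; toℕ; fromℕ<; _↑ˡ_; _↑ʳ_; splitAt)
import Data.Fin.Permutation as Permutation
import Data.Fin.Properties as Finₚ
open import Data.Integer.Base using (ℤ; +_; -[1+_]; _+_; _-_; -_; _*_; _≤_; _<_; 0ℤ; 1ℤ; -1ℤ; +<+; +≤+; ∣_∣)
open import Data.Integer.DivMod using (_%ℕ_; _/ℕ_; n%ℕd<d; a≡a%ℕn+[a/ℕn]*n)
open import Data.Integer.Divisibility.Signed using (_∣_; _∣?_; divides)
import Data.Integer.Properties as ℤₚ
open import Data.Integer.Tactic.RingSolver using (solve-∀)
open import Data.List.Base using (List; []; _∷_; _++_; _∷ʳ_; map; filter; length)
import Data.List.Membership.DecPropositional as DecMembership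
open import Data.List.Membership.Propositional using (_∈_; _∉_)
import Data.List.Properties as Listₚ
open import Data.List.Relation.Unary.All as All using (All; []; _∷_)
open import Data.List.Relation.Unary.Any using (here; there)
open import Data.Maybe.Base using (Maybe; just; nothing; maybe′)
open import Data.Nat.Base as ℕ using (ℕ; zero; suc; NonTrivial; nonTrivial⇒nonZero; nonTrivial⇒n>1)
import Data.Nat.Divisibility as ℕDiv
import Data.Nat.Properties as ℕₚ
import Data.Nat.Tactic.RingSolver as ℕ-Solver
open import Data.Product.Base using (∃; ∃₂; _×_; _,_; proj₁; proj₂)
import Data.Product.Properties as Productₚ
open import Data.Sum.Base using (_⊎_; inj₁; inj₂; [_,_]′)
open import Data.Sum.Function.Propositional using (_⊎-↔_)
open import Data.Sum.Function.Setoid using (_⊎-inverse_)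
open import Data.Sum.Relation.Binary.Pointwise using (_⊎ₛ_; Pointwise-≡↔≡)
open import Data.Unit.Base using (⊤; tt)
open import Data.Vec.Base using (Vec; []; _∷_; lookup; count; _[_]≔_)
import Data.Vec.Properties as Vecₚ
open import Function.Base using (_∘_)
open import Function.Bundles using (Bijection; Inverse; _↔_; mk↔ₛ′; mk⇔)
import Function.Construct.Composition as Composition
open import Function.Construct.Composition using (_↔-∘_)
import Function.Construct.Symmetry as Symmetry
open import Function.Construct.Symmetry using (↔-sym)
open import Function.Properties.Bijection using (Bijection⇒Inverse)
open import Function.Properties.Inverse using (Inverse⇒Bijection)
open import Relation.Binary.Definitions using (tri<; tri≈; tri>)
open import Relation.Binary.PropositionalEquality
open import Relation.Nullary using (Dec; yes; no; ¬_; contradiction; does)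
open import Relation.Nullary.Decidable using (map′; _×-dec_; does-⇔; dec-true; dec-false)

open ≡-Reasoning

-- No bijection of fillings is constructed box by box. `enumeration` identifies the Deograms of f
-- with `Fin (N f w)` for any word w of the strip, so every claim becomes an identity between values
-- of `N` and may use a word adapted to it. Edges are indexed along antidiagonals: on each
-- intermediate path, edge j joins the vertices with x + y equal to j - 1 and j. A flip then affects
-- only the positions d and d + 1 (and their translates), and a strand is tracked by its position.
-- The translation by (0,k) adds k to x + y, which is where the shifts by k come from. The delicate
-- case is s_i P = P. The word of P can be kept, so all information lies in an identity of words i w
-- = w (i + k). Equality in the affine symmetric group would not suffice, because `N` is not
-- invariant under the quadratic relation; only braid and commutation moves are admissible. Moreover
-- the two parallel steps need not stay adjacent on the intermediate paths: other steps intervene,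
-- and the letter has to be replaced by a run of letters there.

≤-resp-difference : ∀ {a b c d} → c ≤ d → d - c ≡ b - a → a ≤ b
≤-resp-difference c≤d eq = ℤₚ.0≤i-j⇒j≤i (subst (0ℤ ≤_) eq (ℤₚ.i≤j⇒0≤j-i c≤d))

<⇒+1≤ : ∀ {a b} → a < b → a + 1ℤ ≤ b
<⇒+1≤ {a} {b} a<b = subst (_≤ b) (ℤₚ.+-comm 1ℤ a) (ℤₚ.i<j⇒suc[i]≤j a<b)

+1≤⇒< : ∀ {a b} → a + 1ℤ ≤ b → a < b
+1≤⇒< {a} {b} a<b = ℤₚ.suc[i]≤j⇒i<j (subst (_≤ b) (ℤₚ.+-comm a 1ℤ) a<b)

<-resp-difference : ∀ {a b c d} → c < d → d - c ≡ b - a → a < b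
<-resp-difference {a} {b} {c} {d} c<d eq = +1≤⇒< (≤-resp-difference (<⇒+1≤ c<d)
  (trans (shift d c) (trans (cong (_- 1ℤ) eq) (sym (shift b a)))))
  where
  shift : ∀ x y → x - (y + 1ℤ) ≡ (x - y) - 1ℤ
  shift = solve-∀

a<a+1 : ∀ a → a < a + 1ℤ
a<a+1 a = +1≤⇒< ℤₚ.≤-refl

a-1<a : ∀ a → a - 1ℤ < a
a-1<a a = <-resp-difference (a<a+1 a) (eq a)
  where
  eq : ∀ a → a + 1ℤ - a ≡ a - (a - 1ℤ)
  eq = solve-∀

+1-1 : ∀ a → a + 1ℤ - 1ℤ ≡ a
+1-1 = solve-∀

-1+1 : ∀ a → a - 1ℤ + 1ℤ ≡ a
-1+1 = solve-∀

+-swap : ∀ a b c → a + b + c ≡ a + c + b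
+-swap = solve-∀

-+-cancel : ∀ a b → a - b + b ≡ a
-+-cancel = solve-∀

+--cancel : ∀ a b → a + b - b ≡ a
+--cancel = solve-∀

≮⇒≢⇒> : ∀ {a b} → ¬ a < b → a ≢ b → b < a
≮⇒≢⇒> {a} {b} a≮b a≢b with ℤₚ.<-cmp a b
... | tri< a<b _ _ = contradiction a<b a≮b
... | tri≈ _ a≡b _ = contradiction a≡b a≢b
... | tri> _ _ b<a = b<a

constant : ∀ {a} {A : Set a} (G : ℤ → A) → (∀ q → G (q + 1ℤ) ≡ G q) → ∀ q → G q ≡ G 0ℤ
constant G inv (+ zero)       = refl
constant G inv (+ suc m)      =
  trans (cong (λ x → G (+ x)) (ℕₚ.+-comm 1 m)) (trans (inv (+ m)) (constant G inv (+ m)))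
constant G inv -[1+ zero ]    = sym (inv -[1+ 0 ])
constant G inv -[1+ suc m ]   = trans (sym (inv -[1+ suc m ])) (constant G inv -[1+ m ])

-- The difference `F (a + q * m) - q * c` does not change when `q` grows by one.
progression : (F : ℤ → ℤ) {m c : ℤ} → (∀ a → F (a + m) ≡ F a + c) →
              ∀ a q → F (a + q * m) ≡ F a + q * c
progression F {m} {c} F-step a q = begin
  F (a + q * m)                          ≡⟨ insert (F (a + q * m)) (q * c) ⟩
  G q + q * c                            ≡⟨ cong (_+ q * c) (constant G G-step q) ⟩
  F (a + 0ℤ * m) - 0ℤ * c + q * c        ≡⟨ cong (λ x → F x - 0ℤ * c + q * c) (drop a m) ⟩
  F a - 0ℤ * c + q * c                   ≡⟨ drop′ (F a) c (q * c) ⟩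
  F a + q * c                            ∎
  where
  G : ℤ → ℤ
  G q = F (a + q * m) - q * c
  insert : ∀ x y → x ≡ x - y + y
  insert = solve-∀
  drop : ∀ a m → a + 0ℤ * m ≡ a
  drop = solve-∀
  drop′ : ∀ x c y → x - 0ℤ * c + y ≡ x + y
  drop′ = solve-∀
  next : ∀ a q m → a + (q + 1ℤ) * m ≡ a + q * m + m
  next = solve-∀
  cancel : ∀ x q c → x + c - (q + 1ℤ) * c ≡ x - q * c
  cancel = solve-∀
  G-step : ∀ q → G (q + 1ℤ) ≡ G q
  G-step q = begin
    F (a + (q + 1ℤ) * m) - (q + 1ℤ) * c   ≡⟨ cong (λ x → F x - (q + 1ℤ) * c) (next a q m) ⟩
    F (a + q * m + m) - (q + 1ℤ) * c      ≡⟨ cong (_- (q + 1ℤ) * c) (F-step (a + q * m)) ⟩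
    F (a + q * m) + c - (q + 1ℤ) * c      ≡⟨ cancel (F (a + q * m)) q c ⟩
    G q                                   ∎

module ℤ-Group = GroupProperties (AbelianGroup.group ℤₚ.+-0-abelianGroup)

-- Boolean comparison and finite sums

infix 4 _<ᵇ_
_<ᵇ_ : ℤ → ℤ → Bool
a <ᵇ b = does (a ℤₚ.<? b)

<⇒<ᵇ : ∀ {a b} → a < b → (a <ᵇ b) ≡ true
<⇒<ᵇ {a} {b} = dec-true (a ℤₚ.<? b)

≮⇒<ᵇ : ∀ {a b} → ¬ a < b → (a <ᵇ b) ≡ false
≮⇒<ᵇ {a} {b} = dec-false (a ℤₚ.<? b)

<ᵇ-flip : ∀ {a b} → a ≢ b → (b <ᵇ a) ≡ not (a <ᵇ b)
<ᵇ-flip {a} {b} a≢b with ℤₚ.<-cmp a b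
... | tri< a<b _ b≮a = trans (≮⇒<ᵇ b≮a) (cong not (sym (<⇒<ᵇ a<b)))
... | tri≈ _ a≡b _   = contradiction a≡b a≢b
... | tri> a≮b _ b<a = trans (<⇒<ᵇ b<a) (cong not (sym (≮⇒<ᵇ a≮b)))

<ᵇ-cong-⇔ : ∀ {a b c d} → (a < b → c < d) → (c < d → a < b) → (a <ᵇ b) ≡ (c <ᵇ d)
<ᵇ-cong-⇔ {a} {b} {c} {d} f g with a ℤₚ.<? b
... | yes p = sym (<⇒<ᵇ (f p))
... | no ¬p = sym (≮⇒<ᵇ (¬p ∘ g))

-- An Iverson bracket as a factor: the summand of the recurrence that is present only at an ascent.
when : Bool → ℕ → ℕ
when true  m = m
when false m = 0

total : ∀ {m} → (Fin m → ℕ) → ℕ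
total {zero}  f = 0
total {suc m} f = f Fin.zero ℕ.+ total (f ∘ Fin.suc)

total-mono-≤ : ∀ {m} {f g : Fin m → ℕ} → (∀ i → f i ℕ.≤ g i) → total f ℕ.≤ total g
total-mono-≤ {zero}  f≤g = ℕ.z≤n
total-mono-≤ {suc m} f≤g = ℕₚ.+-mono-≤ (f≤g Fin.zero) (total-mono-≤ (f≤g ∘ Fin.suc))

total-mono-< : ∀ {m} {f g : Fin m → ℕ} → (∀ i → f i ℕ.≤ g i) → ∀ i → f i ℕ.< g i → total f ℕ.< total g
total-mono-< f≤g Fin.zero    fi<gi = ℕₚ.+-mono-<-≤ fi<gi (total-mono-≤ (f≤g ∘ Fin.suc))
total-mono-< f≤g (Fin.suc i) fi<gi = ℕₚ.+-mono-≤-< (f≤g Fin.zero) (total-mono-< (f≤g ∘ Fin.suc) i fi<gi)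

+-cancelʳ : ∀ {a b} c → a + c ≡ b + c → a ≡ b
+-cancelʳ {a} {b} c eq = trans (back a c) (trans (cong (_- c) eq) (sym (back b c)))
  where
  back : ∀ a c → a ≡ a + c - c
  back = solve-∀

a≢a+1 : ∀ {a} → a ≢ a + 1ℤ
a≢a+1 {a} eq = ℤₚ.<-irrefl eq (a<a+1 a)

-- Runs of letters, and paths given by heights

ups : ℤ → ℕ → List ℤ
ups c zero    = []
ups c (suc m) = c ∷ ups (c + 1ℤ) m

+-suc-assoc : ∀ c m → c + 1ℤ + + m ≡ c + + suc m
+-suc-assoc c m = ℤₚ.+-assoc c 1ℤ (+ m)

+-suc : ∀ c m → c + + m + 1ℤ ≡ c + + suc m
+-suc c m = eq c (+ m)
  where
  eq : ∀ c m → c + m + 1ℤ ≡ c + (1ℤ + m)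
  eq = solve-∀

ups-snoc : ∀ c m → ups c (suc m) ≡ ups c m ∷ʳ (c + + m)
ups-snoc c zero    = cong (_∷ []) (sym (ℤₚ.+-identityʳ c))
ups-snoc c (suc m) = cong (c ∷_) (trans (ups-snoc (c + 1ℤ) m) (cong (ups (c + 1ℤ) m ∷ʳ_) (+-suc-assoc c m)))

ups-∷ : ∀ c m {e} (w : List ℤ) → c + + m ≡ e → ups c (suc m) ++ w ≡ ups c m ++ e ∷ w
ups-∷ c m w refl = trans (cong (_++ w) (ups-snoc c m)) (Listₚ.∷ʳ-++ (ups c m) _ w)

rise : Step → ℕ
rise R = 0
rise U = 1

risesBefore : ∀ {m} → ℕ → Vec Step m → ℕ
risesBefore zero    v       = 0
risesBefore (suc j) []      = 0
risesBefore (suc j) (x ∷ v) = rise x ℕ.+ risesBefore j v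

risesBefore-suc : ∀ {m} (v : Vec Step m) i → risesBefore (suc (toℕ i)) v ≡ risesBefore (toℕ i) v ℕ.+ rise (lookup v i)
risesBefore-suc (x ∷ v) Fin.zero    = ℕₚ.+-identityʳ (rise x)
risesBefore-suc (x ∷ v) (Fin.suc i) = trans (cong (rise x ℕ.+_) (risesBefore-suc v i)) (sym (ℕₚ.+-assoc (rise x) _ _))

risesBefore-all : ∀ {m} (v : Vec Step m) → risesBefore m v ≡ count (U ≟ˢ_) v
risesBefore-all []      = refl
risesBefore-all (R ∷ v) = risesBefore-all v
risesBefore-all (U ∷ v) = cong suc (risesBefore-all v)

forward-backward : ∀ x p → forward x (backward x p) ≡ p
forward-backward R (x , y) = cong (_, y) (-1+1 x)
forward-backward U (x , y) = cong (x ,_) (-1+1 y)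

-- A discrete intermediate value theorem: the window is shortened from the right until its last step
-- leaves the level x.
level-crossing : (X : ℤ → ℤ) → (∀ j → X (j + 1ℤ) ≡ X j ⊎ X (j + 1ℤ) ≡ X j + 1ℤ) → ∀ x m a → X a ≤ x → x < X (a + + m) →
                 ∃ λ j → X j ≡ x × X (j + 1ℤ) ≡ x + 1ℤ × a ≤ j × j + 1ℤ ≤ a + + m
level-crossing X X-step x zero a Xa≤x x<Xa =
  contradiction x<Xa (ℤₚ.≤⇒≯ (subst (λ z → X z ≤ x) (sym (ℤₚ.+-identityʳ a)) Xa≤x))
level-crossing X X-step x (suc m) a Xa≤x x<X with X (a + + m) ℤₚ.≤? x
... | no ≰x with level-crossing X X-step x m a Xa≤x (ℤₚ.≰⇒> ≰x)
... | j , Xj , Xj+1 , a≤j , j≤ = j , Xj , Xj+1 , a≤j , ℤₚ.≤-trans j≤ (ℤₚ.+-monoʳ-≤ a (+≤+ (ℕₚ.n≤1+n m)))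
level-crossing X X-step x (suc m) a Xa≤x x<X | yes ≤x = a + + m , Xj , trans Xj+1 (cong (_+ 1ℤ) Xj)
    , subst (_≤ a + + m) (ℤₚ.+-identityʳ a) (ℤₚ.+-monoʳ-≤ a (+≤+ ℕ.z≤n)) , ℤₚ.≤-reflexive (sym next)
  where
  next : a + + suc m ≡ a + + m + 1ℤ
  next = eq a (+ m)
    where
    eq : ∀ a m → a + (1ℤ + m) ≡ a + m + 1ℤ
    eq = solve-∀
  x<X′ : x < X (a + + m + 1ℤ)
  x<X′ = subst (λ z → x < X z) next x<X
  Xj+1 : X (a + + m + 1ℤ) ≡ X (a + + m) + 1ℤ
  Xj+1 with X-step (a + + m)
  ... | inj₁ eq = contradiction (subst (x <_) eq x<X′) (ℤₚ.≤⇒≯ ≤x)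
  ... | inj₂ eq = eq
  Xj : X (a + + m) ≡ x
  Xj = ℤₚ.≤-antisym ≤x (≤-resp-difference (<⇒+1≤ (subst (x <_) Xj+1 x<X′)) (eq x (X (a + + m))))
    where
    eq : ∀ x y → y + 1ℤ - (x + 1ℤ) ≡ y - x
    eq = solve-∀

-- Vertices are indexed by x + y, so the height function alone determines a path.
place : (ℤ → ℤ) → ℤ → Point
place h j = j - h j , h j

-- The step is recovered from the heights, since the intermediate paths of the flip process are
-- known only by their height functions.
edgeAt : (ℤ → ℤ) → ℤ → Edge
edgeAt h j with h j ℤₚ.≟ h (j - 1ℤ)
... | yes _ = horizontal (place h (j - 1ℤ))
... | no  _ = vertical (place h (j - 1ℤ))

edgeAt-R : ∀ h j → h j ≡ h (j - 1ℤ) → edgeAt h j ≡ horizontal (place h (j - 1ℤ))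
edgeAt-R h j eq with h j ℤₚ.≟ h (j - 1ℤ)
... | yes _ = refl
... | no ¬p = contradiction eq ¬p

edgeAt-U : ∀ h j → h j ≡ h (j - 1ℤ) + 1ℤ → edgeAt h j ≡ vertical (place h (j - 1ℤ))
edgeAt-U h j eq with h j ℤₚ.≟ h (j - 1ℤ)
... | yes p = contradiction (trans (sym p) eq) a≢a+1
... | no _  = refl

horizontal-injective : ∀ {p q} → horizontal p ≡ horizontal q → p ≡ q
horizontal-injective refl = refl

-- The vertex of a path lying on the main antidiagonal of a box strictly inside the strip of the path.
middle : Box → ℤ
middle (x , y) = x + y + 1ℤ

-- Parity of common crossings

parity : ℕ → Bool
parity zero    = false
parity (suc m) = not (parity m)

parity-∣ : ∀ m → 2 ℕDiv.∣ m → parity m ≡ false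
parity-∣ _ (ℕDiv.divides q refl) = even q
  where
  even : ∀ q → parity (q ℕ.* 2) ≡ false
  even zero    = refl
  even (suc q) = cong (not ∘ not) (even q)

∣-parity : ∀ m → parity m ≡ false → 2 ℕDiv.∣ m
∣-parity zero          _  = ℕDiv._∣0 2
∣-parity (suc (suc m)) eq = ℕDiv.∣m∣n⇒∣m+n (ℕDiv.∣-refl {2}) (∣-parity m (trans (sym (Boolₚ.not-involutive (parity m))) eq))

open DecMembership (Productₚ.≡-dec ℤₚ._≟_ ℤₚ._≟_) using (_∈?_)

-- `shared` agrees with `crossings` by computation, but takes plain lists of boxes, so it can be
-- evaluated without strands at hand.
module Shared (T : Box → Tile) where
  shared : List Box → List Box → ℕ
  shared xs ys = length (filter (λ b → T b ≟ᵗ crossing ×-dec b ∈? ys) xs)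

  accept : ∀ {b} xs ys → T b ≡ crossing × b ∈ ys → shared (b ∷ xs) ys ≡ suc (shared xs ys)
  accept xs ys p = cong length (Listₚ.filter-accept (λ b → T b ≟ᵗ crossing ×-dec b ∈? ys) {xs = xs} p)

  reject : ∀ {b} xs ys → ¬ (T b ≡ crossing × b ∈ ys) → shared (b ∷ xs) ys ≡ shared xs ys
  reject xs ys ¬p = cong length (Listₚ.filter-reject (λ b → T b ≟ᵗ crossing ×-dec b ∈? ys) {xs = xs} ¬p)

  shared-∉ʳ : ∀ {b} xs ys → b ∉ xs → shared xs (b ∷ ys) ≡ shared xs ys
  shared-∉ʳ []       ys b∉ = refl
  shared-∉ʳ {b} (x ∷ xs) ys b∉ with T x ≟ᵗ crossing ×-dec x ∈? ys
  ... | yes (p , q) = trans (accept xs (b ∷ ys) (p , there q))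
                        (trans (cong suc (shared-∉ʳ xs ys (b∉ ∘ there))) (sym (accept xs ys (p , q))))
  ... | no ¬p = trans (reject xs (b ∷ ys) (λ { (p , here refl) → b∉ (here refl) ; (p , there q) → ¬p (p , q) }))
                  (trans (shared-∉ʳ xs ys (b∉ ∘ there)) (sym (reject xs ys ¬p)))

  shared-∉ˡ : ∀ {b} xs ys → b ∉ ys → shared (b ∷ xs) ys ≡ shared xs ys
  shared-∉ˡ xs ys b∉ = reject xs ys (λ p → b∉ (proj₂ p))

  shared-crossing : ∀ {b} xs ys → T b ≡ crossing → b ∉ xs → shared (b ∷ xs) (b ∷ ys) ≡ suc (shared xs ys)
  shared-crossing {b} xs ys p b∉ = trans (accept xs (b ∷ ys) (p , here refl)) (cong suc (shared-∉ʳ xs ys b∉))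

  shared-elbow : ∀ {b} xs ys → T b ≡ elbow → b ∉ xs → shared (b ∷ xs) (b ∷ ys) ≡ shared xs ys
  shared-elbow {b} xs ys p b∉ = trans (reject xs (b ∷ ys) not-crossing) (shared-∉ʳ xs ys b∉)
    where
    not-crossing : ¬ (T b ≡ crossing × b ∈ b ∷ ys)
    not-crossing (q , _) with trans (sym p) q
    ... | ()

-- The second summand exists only if the Boolean is true. The proof of this is irrelevant, so ranks
-- do not depend on it.
embedʳ : ∀ a b m → .(b ≡ true) → Fin m → Fin (a ℕ.+ when b m)
embedʳ a true m _ x = a ↑ʳ x

embedʳ-injective : ∀ a b m .(p : b ≡ true) {x y} → embedʳ a b m p x ≡ embedʳ a b m p y → x ≡ y
embedʳ-injective a true m _ = Finₚ.↑ʳ-injective a _ _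

embed-disjoint : ∀ a b m .(p : b ≡ true) {x y} → x ↑ˡ when b m ≢ embedʳ a b m p y
embed-disjoint a true m _ {x} {y} eq
  with trans (sym (Finₚ.splitAt-↑ˡ a x m)) (trans (cong (splitAt a) eq) (Finₚ.splitAt-↑ʳ a m y))
... | ()

embed-cover : ∀ a b m (x : Fin (a ℕ.+ when b m)) →
              (∃ λ y → y ↑ˡ when b m ≡ x) ⊎ (∃ λ (p : b ≡ true) → ∃ λ y → embedʳ a b m p y ≡ x)
embed-cover a b m x with splitAt a x in eq
... | inj₁ y = inj₁ (y , Finₚ.splitAt⁻¹-↑ˡ eq)
embed-cover a true  m x | inj₂ y = inj₂ (refl , y , Finₚ.splitAt⁻¹-↑ʳ eq)

when-unique : ∀ b (x y : Fin (when b 1)) → x ≡ y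
when-unique true Fin.zero Fin.zero = refl

module Periodic (n : ℕ) .{{_ : NonTrivial n}} where

  -- Congruence modulo n and affine permutations

  infix 4 _≋_ _≋?_
  -- The quotient is data: matching on it replaces `a` by an explicit translate of `b`, to which
  -- periodicity applies.
  record _≋_ (a b : ℤ) : Set where
    constructor _,_
    field
      quotient   : ℤ
      difference : a ≡ b + quotient * + n

  ≋-reflexive : ∀ {a b} → a ≡ b → a ≋ b
  ≋-reflexive {a} refl = 0ℤ , eq a (+ n)
    where
    eq : ∀ a m → a ≡ a + 0ℤ * m
    eq = solve-∀

  ≋-refl : ∀ {a} → a ≋ a
  ≋-refl = ≋-reflexive refl

  ≋-sym : ∀ {a b} → a ≋ b → b ≋ a
  ≋-sym {b = b} (q , refl) = - q , eq b q (+ n)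
    where
    eq : ∀ b q m → b ≡ b + q * m + (- q) * m
    eq = solve-∀

  ≋-trans : ∀ {a b c} → a ≋ b → b ≋ c → a ≋ c
  ≋-trans {c = c} (q , refl) (r , refl) = q + r , eq c q r (+ n)
    where
    eq : ∀ c q r m → c + r * m + q * m ≡ c + (q + r) * m
    eq = solve-∀

  ≋-+ : ∀ {a b} c → a ≋ b → a + c ≋ b + c
  ≋-+ {b = b} c (q , refl) = q , +-swap b (q * + n) c

  ≋-neg : ∀ {a b} → a ≋ b → - a ≋ - b
  ≋-neg {b = b} (q , refl) = - q , eq b q (+ n)
    where
    eq : ∀ b q m → - (b + q * m) ≡ - b + (- q) * m
    eq = solve-∀

  ≋-period : ∀ a → a + + n ≋ a
  ≋-period a = 1ℤ , eq a (+ n)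
    where
    eq : ∀ a m → a + m ≡ a + 1ℤ * m
    eq = solve-∀

  ≋-cancel : ∀ {a b} c → a + c ≋ b + c → a ≋ b
  ≋-cancel {a} {b} c p = subst₂ _≋_ (eq a c) (eq b c) (≋-+ (- c) p)
    where
    eq : ∀ a c → a + c + (- c) ≡ a
    eq = solve-∀

  ∣⇒≋ : ∀ {a b} → + n ∣ a - b → a ≋ b
  ∣⇒≋ {a} {b} (divides q eq) = q , trans (split a b) (cong (λ x → b + x) eq)
    where
    split : ∀ a b → a ≡ b + (a - b)
    split = solve-∀

  ≋⇒∣ : ∀ {a b} → a ≋ b → + n ∣ a - b
  ≋⇒∣ {b = b} (q , refl) = divides q (eq b (q * + n))
    where
    eq : ∀ b x → b + x - b ≡ x
    eq = solve-∀

  abstract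
    _≋?_ : ∀ a b → Dec (a ≋ b)
    a ≋? b = map′ ∣⇒≋ ≋⇒∣ (+ n ∣? a - b)

  multiple≥0 : ∀ q → 0ℤ ≤ + q * + n
  multiple≥0 q = subst (0ℤ ≤_) (ℤₚ.pos-* q n) (+≤+ ℕ.z≤n)

  -- A nonzero quotient would put the two numbers at distance at least n.
  ≋-close : ∀ {a b} → a ≋ b → a < b + + n → b < a + + n → a ≡ b
  ≋-close {b = b} (+ zero , refl) _ _ = eq b (+ n)
    where
    eq : ∀ b m → b + 0ℤ * m ≡ b
    eq = solve-∀
  ≋-close {b = b} (+ suc q , refl) a<b+n _ =
    contradiction (≤-resp-difference (multiple≥0 q) (eq b (+ q) (+ n))) (ℤₚ.<⇒≱ a<b+n)
    where
    eq : ∀ b q m → q * m - 0ℤ ≡ b + (1ℤ + q) * m - (b + m)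
    eq = solve-∀
  ≋-close {b = b} (-[1+ q ] , refl) _ b<a+n =
    contradiction (≤-resp-difference (multiple≥0 q) (eq b (+ q) (+ n))) (ℤₚ.<⇒≱ b<a+n)
    where
    eq : ∀ b q m → q * m - 0ℤ ≡ b - (b + (- (1ℤ + q)) * m + m)
    eq = solve-∀

  1<n : 1ℤ < + n
  1<n = +<+ (nonTrivial⇒n>1 n)

  ≋-below : ∀ {a b} → a < b → b < a + + n → ¬ a ≋ b
  ≋-below {a} {b} a<b b<a+n a≋b = ℤₚ.<-irrefl (≋-close a≋b (ℤₚ.<-trans a<b (<-resp-difference 0<n (eq b (+ n)))) b<a+n) a<b
    where
    0<n : 0ℤ < + n
    0<n = ℤₚ.<-trans (+<+ ℕ.z<s) 1<n
    eq : ∀ b m → m - 0ℤ ≡ b + m - b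
    eq = solve-∀

  ≋-suc : ∀ a → ¬ a ≋ a + 1ℤ
  ≋-suc a = ≋-below (a<a+1 a) (ℤₚ.+-monoʳ-< a 1<n)

  label-residue : ∀ j → j ≋ label (residue {n} j)
  label-residue j = q , (begin
    j                                         ≡⟨ restore j ⟩
    1ℤ + (j - 1ℤ)                             ≡⟨ cong (λ x → 1ℤ + x) (a≡a%ℕn+[a/ℕn]*n (j - 1ℤ) n) ⟩
    1ℤ + (+ ((j - 1ℤ) %ℕ n) + q * + n)        ≡⟨ ℤₚ.+-assoc 1ℤ (+ ((j - 1ℤ) %ℕ n)) (q * + n) ⟨
    + suc ((j - 1ℤ) %ℕ n) + q * + n           ≡⟨ cong (λ r → + suc r + q * + n)
                                                   (Finₚ.toℕ-fromℕ< (n%ℕd<d (j - 1ℤ) n)) ⟨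
    label (residue {n} j) + q * + n           ∎)
    where
    instance _ = nonTrivial⇒nonZero n
    q = (j - 1ℤ) /ℕ n
    restore : ∀ j → j ≡ 1ℤ + (j - 1ℤ)
    restore = solve-∀

  label-injective : ∀ {a b : Fin n} → label a ≋ label b → a ≡ b
  label-injective {a} {b} a≋b =
    Finₚ.toℕ-injective (ℕₚ.suc-injective (ℤₚ.+-injective (≋-close a≋b (bound a b) (bound b a))))
    where
    bound : ∀ a b → label a < label b + + n
    bound a b = +<+ (ℕ.s≤s (ℕₚ.≤-trans (Finₚ.toℕ<n a) (ℕₚ.m≤n+m n (toℕ b))))

  residue-cong : ∀ {a b} → a ≋ b → residue {n} a ≡ residue b
  residue-cong {a} {b} a≋b =
    label-injective (≋-trans (≋-sym (label-residue a)) (≋-trans a≋b (label-residue b)))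

  residue-label : ∀ (i : Fin n) → residue (label i) ≡ i
  residue-label i = label-injective (≋-sym (label-residue (label i)))

  from : AffinePerm n → ℤ → ℤ
  from = AffinePerm.from

  to-from : ∀ (v : AffinePerm n) a → to v (from v a) ≡ a
  to-from v = Inverse.strictlyInverseˡ (AffinePerm.bijection v)

  from-to : ∀ (v : AffinePerm n) a → from v (to v a) ≡ a
  from-to v = Inverse.strictlyInverseʳ (AffinePerm.bijection v)

  to-injective : ∀ (v : AffinePerm n) {a b} → to v a ≡ to v b → a ≡ b
  to-injective v {a} {b} eq = trans (sym (from-to v a)) (trans (cong (from v) eq) (from-to v b))

  infix 8 _⁻¹
  _⁻¹ : AffinePerm n → AffinePerm n
  v ⁻¹ = record
    { bijection = Symmetry.↔-sym (AffinePerm.bijection v)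
    ; periodic  = λ a → to-injective v (begin
        to v (from v (a + + n))     ≡⟨ to-from v (a + + n) ⟩
        a + + n                     ≡⟨ cong (_+ + n) (to-from v a) ⟨
        to v (from v a) + + n       ≡⟨ periodic v (from v a) ⟨
        to v (from v a + + n)       ∎)
    }

  to-shift : ∀ (v : AffinePerm n) a q → to v (a + q * + n) ≡ to v a + q * + n
  to-shift v = progression (to v) (periodic v)

  to-≋ : ∀ (v : AffinePerm n) {a b} → a ≋ b → to v a ≋ to v b
  to-≋ v {b = b} (q , refl) = q , to-shift v b q

  -- Reduces the comparison of two affine permutations to one representative of each class modulo n.
  agree-≋ : ∀ (v u : AffinePerm n) {a b} → a ≋ b → to v b ≡ to u b → to v a ≡ to u a
  agree-≋ v u {b = b} (q , refl) eq = trans (to-shift v b q) (trans (cong (_+ q * + n) eq) (sym (to-shift u b q)))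

  infix 4 _≐_
  _≐_ : AffinePerm n → AffinePerm n → Set
  v ≐ u = ∀ a → to v a ≡ to u a

  from-cong : ∀ {v u} → v ≐ u → ∀ a → from v a ≡ from u a
  from-cong {v} {u} v≐u a = to-injective v (begin
    to v (from v a)     ≡⟨ to-from v a ⟩
    a                   ≡⟨ to-from u a ⟨
    to u (from u a)     ≡⟨ v≐u (from u a) ⟨
    to v (from u a)     ∎)

  abstract
    -- Letters range over ℤ instead of [n], so shifts by k and translations by n need no reduction.
    σ : ℤ → AffinePerm n
    σ d = s (residue d)

    σ-label : ∀ i → σ (label i) ≡ s i
    σ-label i = cong s (residue-label i)

    σ-cong : ∀ {d e} → d ≋ e → σ d ≡ σ e
    σ-cong d≋e = cong s (residue-cong d≋e)

    from-σ : ∀ d a → from (σ d) a ≡ to (σ d) a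
    from-σ d a = refl

    σσ : ∀ d a → to (σ d) (to (σ d) a) ≡ a
    σσ d a = to-from (σ d) a

    σ-cases : ∀ d a → (a ≋ d × to (σ d) a ≡ a + 1ℤ) ⊎ (a ≋ d + 1ℤ × to (σ d) a ≡ a - 1ℤ) ⊎
              (¬ a ≋ d × ¬ a ≋ d + 1ℤ × to (σ d) a ≡ a)
    σ-cases d a with + n ∣? a - label (residue {n} d) | + n ∣? a - (label (residue {n} d) + 1ℤ)
    ... | yes p | _     = inj₁ (≋-trans (∣⇒≋ p) (≋-sym (label-residue d)) , refl)
    ... | no ¬p | yes q = inj₂ (inj₁ (≋-trans (∣⇒≋ q) (≋-+ 1ℤ (≋-sym (label-residue d))) , refl))
    ... | no ¬p | no ¬q = inj₂ (inj₂
      ( (λ p → ¬p (≋⇒∣ (≋-trans p (label-residue d))))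
      , (λ q → ¬q (≋⇒∣ (≋-trans q (≋-+ 1ℤ (label-residue d))))) , refl))

  not-both : ∀ {a d} → a ≋ d → ¬ a ≋ d + 1ℤ
  not-both {d = d} p q = ≋-suc d (≋-trans (≋-sym p) q)

  σ-at : ∀ {d a} → a ≋ d → to (σ d) a ≡ a + 1ℤ
  σ-at {d} {a} p with σ-cases d a
  ... | inj₁ (_ , eq)                = eq
  ... | inj₂ (inj₁ (q , _))          = contradiction q (not-both p)
  ... | inj₂ (inj₂ (¬p , _ , _))     = contradiction p ¬p

  σ-next : ∀ {d a} → a ≋ d + 1ℤ → to (σ d) a ≡ a - 1ℤ
  σ-next {d} {a} q with σ-cases d a
  ... | inj₁ (p , _)                 = contradiction q (not-both p)
  ... | inj₂ (inj₁ (_ , eq))         = eq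
  ... | inj₂ (inj₂ (_ , ¬q , _))     = contradiction q ¬q

  σ-fixed : ∀ {d a} → ¬ a ≋ d → ¬ a ≋ d + 1ℤ → to (σ d) a ≡ a
  σ-fixed {d} {a} ¬p ¬q with σ-cases d a
  ... | inj₁ (p , _)                 = contradiction p ¬p
  ... | inj₂ (inj₁ (q , _))          = contradiction q ¬q
  ... | inj₂ (inj₂ (_ , _ , eq))     = eq

  σ-≤+1 : ∀ d a → to (σ d) a ≤ a + 1ℤ
  σ-≤+1 d a with σ-cases d a
  ... | inj₁ (_ , eq)             = ℤₚ.≤-reflexive eq
  ... | inj₂ (inj₁ (_ , eq))      = ℤₚ.<⇒≤ (subst (_< a + 1ℤ) (sym eq) (ℤₚ.<-trans (a-1<a a) (a<a+1 a)))
  ... | inj₂ (inj₂ (_ , _ , eq))  = ℤₚ.<⇒≤ (subst (_< a + 1ℤ) (sym eq) (a<a+1 a))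

  σ-≥-1 : ∀ d a → a - 1ℤ ≤ to (σ d) a
  σ-≥-1 d a with σ-cases d a
  ... | inj₁ (_ , eq)             = ℤₚ.<⇒≤ (subst (a - 1ℤ <_) (sym eq) (ℤₚ.<-trans (a-1<a a) (a<a+1 a)))
  ... | inj₂ (inj₁ (_ , eq))      = ℤₚ.≤-reflexive (sym eq)
  ... | inj₂ (inj₂ (_ , _ , eq))  = ℤₚ.<⇒≤ (subst (a - 1ℤ <_) (sym eq) (a-1<a a))

  σ-≤ : ∀ {d a} → ¬ a ≋ d → to (σ d) a ≤ a
  σ-≤ {d} {a} ¬p with σ-cases d a
  ... | inj₁ (p , _)              = contradiction p ¬p
  ... | inj₂ (inj₁ (_ , eq))      = ℤₚ.<⇒≤ (subst (_< a) (sym eq) (a-1<a a))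
  ... | inj₂ (inj₂ (_ , _ , eq))  = ℤₚ.≤-reflexive eq

  σ-≥ : ∀ {d a} → ¬ a ≋ d + 1ℤ → a ≤ to (σ d) a
  σ-≥ {d} {a} ¬q with σ-cases d a
  ... | inj₁ (_ , eq)             = ℤₚ.<⇒≤ (subst (a <_) (sym eq) (a<a+1 a))
  ... | inj₂ (inj₁ (q , _))       = contradiction q ¬q
  ... | inj₂ (inj₂ (_ , _ , eq))  = ℤₚ.≤-reflexive (sym eq)

  -- Integers move by at most one, so only neighbours a, a + 1 could lose their order. If a is not
  -- congruent to d, then a does not go up and a + 1 does not go down.
  σ-monotone : ∀ d {a b} → a < b → ¬ (a ≋ d × b ≡ a + 1ℤ) → to (σ d) a < to (σ d) b
  σ-monotone d {a} {b} a<b ¬swapped = ℤₚ.≤∧≢⇒< σa≤σb (λ eq → ℤₚ.<-irrefl (to-injective (σ d) eq) a<b)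
    where
    far : a + 1ℤ < b → to (σ d) a ≤ to (σ d) b
    far a+1<b = ℤₚ.≤-trans (σ-≤+1 d a)
      (ℤₚ.≤-trans (≤-resp-difference (<⇒+1≤ a+1<b) (eq a b)) (σ-≥-1 d b))
      where
      eq : ∀ a b → b - (a + 1ℤ + 1ℤ) ≡ b - 1ℤ - (a + 1ℤ)
      eq = solve-∀
    near : b ≡ a + 1ℤ → to (σ d) a ≤ to (σ d) b
    near refl = ℤₚ.≤-trans (σ-≤ ¬p) (ℤₚ.≤-trans (ℤₚ.<⇒≤ (a<a+1 a)) (σ-≥ {d} (¬p ∘ ≋-cancel 1ℤ)))
      where
      ¬p : ¬ a ≋ d
      ¬p p = ¬swapped (p , refl)
    σa≤σb : to (σ d) a ≤ to (σ d) b
    σa≤σb with a + 1ℤ ℤₚ.<? b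
    ... | yes a+1<b = far a+1<b
    ... | no  a+1≮b = near (ℤₚ.≤-antisym (ℤₚ.≮⇒≥ a+1≮b) (<⇒+1≤ a<b))

  σ-swaps : ∀ {d a} → a ≋ d → to (σ d) (a + 1ℤ) < to (σ d) a
  σ-swaps {d} {a} p = subst₂ _<_ (sym (trans (σ-next {d} (≋-+ 1ℤ p)) (+1-1 a))) (sym (σ-at p)) (a<a+1 a)

  -- Length

  -- An `Inversion` has its first entry in [n]. Maps on inversions leave that range, so they are
  -- described by arbitrary translates of the pair.
  Represents : (f : AffinePerm n) → ℤ → ℤ → Inversion f → Set
  Represents f x y (a , b , _) = ∃ λ q → x ≡ label a + q * + n × y ≡ b + q * + n

  represents-self : ∀ f (I : Inversion f) → Represents f (label (proj₁ I)) (proj₁ (proj₂ I)) I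
  represents-self f (a , b , _) = 0ℤ , eq (label a) (+ n) , eq b (+ n)
    where
    eq : ∀ a m → a ≡ a + 0ℤ * m
    eq = solve-∀

  represents-shift : ∀ f {x y} (I : Inversion f) q →
                     Represents f x y I → Represents f (x + q * + n) (y + q * + n) I
  represents-shift f (a , b , _) q (r , refl , refl) = r + q , eq (label a) r q (+ n) , eq b r q (+ n)
    where
    eq : ∀ a r q m → a + r * m + q * m ≡ a + (r + q) * m
    eq = solve-∀

  represents-unique : ∀ f {x y} (I J : Inversion f) → Represents f x y I → Represents f x y J → I ≡ J
  represents-unique f (a , b , p , p′) (a′ , b′ , q , q′) (r , x≡ , y≡) (r′ , x≡′ , y≡′)
    with label-injective {a} {a′} (≋-trans (≋-sym (r , x≡)) (r′ , x≡′))
  ... | refl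
    with ℤ-Group.∙-cancelʳ (r * + n) b b′ (trans (sym y≡) (trans y≡′ (cong (λ z → b′ + z)
           (sym (ℤ-Group.∙-cancelˡ (label a) (r * + n) (r′ * + n) (trans (sym x≡) x≡′))))))
  ... | refl rewrite ℤₚ.<-irrelevant p q | ℤₚ.<-irrelevant p′ q′ = refl

  abstract
    normalise : ∀ f {x y} → x < y → to f y < to f x → ∃ (Represents f x y)
    normalise f {x} {y} x<y fy<fx with label-residue x
    ... | q , x≡ = (residue x , y + (- q) * + n
        , <-resp-difference x<y (trans (cong (λ z → y - z) x≡) (eq₁ y (label (residue {n} x)) q (+ n)))
        , <-resp-difference fy<fx (begin
            to f x - to f y                                       ≡⟨ cong (λ z → to f z - to f y) x≡ ⟩
            to f (label r + q * + n) - to f y                     ≡⟨ cong (_- to f y) (to-shift f (label r) q) ⟩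
            to f (label r) + q * + n - to f y                     ≡⟨ eq₂ (to f (label r)) (to f y) q (+ n) ⟩
            to f (label r) - (to f y + (- q) * + n)               ≡⟨ cong (λ z → to f (label r) - z) (to-shift f y (- q)) ⟨
            to f (label r) - to f (y + (- q) * + n)               ∎))
        , q , x≡ , eq₃ y q (+ n)
      where
      r : Fin n
      r = residue {n} x
      eq₁ : ∀ y a q m → y - (a + q * m) ≡ y + (- q) * m - a
      eq₁ = solve-∀
      eq₂ : ∀ x y q m → x + q * m - y ≡ x - (y + (- q) * m)
      eq₂ = solve-∀
      eq₃ : ∀ y q m → y ≡ y + (- q) * m + q * m
      eq₃ = solve-∀

  unshift : ∀ {x a} q → x ≡ a + q * + n → a ≡ x + (- q) * + n
  unshift {a = a} q refl = eq a q (+ n)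
    where
    eq : ∀ a q m → a ≡ a + q * m + (- q) * m
    eq = solve-∀

  shift-back : ∀ x q → x + (- q) * + n + q * + n ≡ x
  shift-back x q = eq x q (+ n)
    where
    eq : ∀ x q m → x + (- q) * m + q * m ≡ x
    eq = solve-∀

  represents-unshift : ∀ f {x y x′ y′} (I : Inversion f) q →
    x′ ≡ x + (- q) * + n → y′ ≡ y + (- q) * + n → Represents f x′ y′ I → Represents f x y I
  represents-unshift f {x} {y} I q refl refl rep =
    subst₂ (λ u v → Represents f u v I) (shift-back x q) (shift-back y q) (represents-shift f I q rep)

  ℓ-↔ : ∀ {f g : AffinePerm n} → Inversion g ↔ (⊤ ⊎ Inversion f) → ℓ g ≡ suc (ℓ f)
  ℓ-↔ {f} {g} β = Permutation.↔⇒≡ (↔-sym (Finₚ.+↔⊎ {1} {ℓ f}) ↔-∘ ((one ⊎-↔ proj₂ (inversions-finite f)) ↔-∘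
                    (β ↔-∘ ↔-sym (proj₂ (inversions-finite g)))))
    where
    one : ⊤ ↔ Fin 1
    one = ↔-sym Finₚ.1↔⊤

  module _ (f : AffinePerm n) where
    private
      invert : ∀ (f g : AffinePerm n) → (∀ a → to g (to f a) ≡ a) → (I : Inversion f) →
               ∃ (Represents g (to f (proj₁ (proj₂ I))) (to f (label (proj₁ I))))
      invert f g gf (a , b , a<b , fb<fa) =
        normalise g fb<fa (subst₂ _<_ (sym (gf (label a))) (sym (gf b)) a<b)

      invert-invert : ∀ f g (gf : ∀ a → to g (to f a) ≡ a) (fg : ∀ a → to f (to g a) ≡ a) I →
                      proj₁ (invert g f fg (proj₁ (invert f g gf I))) ≡ I
      invert-invert f g gf fg I@(a , b , _) with invert f g gf I
      ... | J@(a′ , b′ , _) , q , fb≡ , fa≡ with invert g f fg J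
      ... | K , rep = represents-unique f K I
        (represents-unshift f K q (back fa≡) (back fb≡) rep)
        (represents-self f I)
        where
        back : ∀ {x y} → to f x ≡ y + q * + n → to g y ≡ x + (- q) * + n
        back {x} {y} eq = begin
          to g y                           ≡⟨ cong (to g) (unshift q eq) ⟩
          to g (to f x + (- q) * + n)      ≡⟨ to-shift g (to f x) (- q) ⟩
          to g (to f x) + (- q) * + n      ≡⟨ cong (_+ (- q) * + n) (gf x) ⟩
          x + (- q) * + n                  ∎

    -- The inversion (a , b) of f corresponds, up to translation, to the inversion (f b , f a) of
    -- the inverse.
    ℓ-⁻¹ : ℓ (f ⁻¹) ≡ ℓ f
    ℓ-⁻¹ = Permutation.↔⇒≡ (proj₂ (inversions-finite f) ↔-∘ (β ↔-∘ ↔-sym (proj₂ (inversions-finite (f ⁻¹)))))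
      where
      β : Inversion (f ⁻¹) ↔ Inversion f
      β = mk↔ₛ′ (proj₁ ∘ invert (f ⁻¹) f (to-from f)) (proj₁ ∘ invert f (f ⁻¹) (from-to f))
                (invert-invert f (f ⁻¹) (from-to f) (to-from f))
                (invert-invert (f ⁻¹) f (to-from f) (from-to f))

  module _ {d : ℤ} where
    private
      Special : ℤ → ℤ → Set
      Special x y = x ≋ d × y ≡ x + 1ℤ

      swap : ∀ (f g : AffinePerm n) → (∀ a → to f a ≡ to g (to (σ d) a)) → (I : Inversion f) →
             ¬ Special (label (proj₁ I)) (proj₁ (proj₂ I)) →
             ∃ (Represents g (to (σ d) (label (proj₁ I))) (to (σ d) (proj₁ (proj₂ I))))
      swap f g f≡gσ (a , b , a<b , fb<fa) ¬special =
        normalise g (σ-monotone d a<b ¬special) (subst₂ _<_ (f≡gσ b) (f≡gσ (label a)) fb<fa)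

      swap-swap : ∀ f g I J K {x y} → Represents g (to (σ d) (label (proj₁ I))) (to (σ d) (proj₁ (proj₂ I))) J →
                  x ≡ label (proj₁ J) → y ≡ proj₁ (proj₂ J) →
                  Represents f (to (σ d) x) (to (σ d) y) K → K ≡ I
      swap-swap f g I@(a , b , _) J@(a′ , b′ , _) K (q , σa≡ , σb≡) refl refl rep = represents-unique f K I
        (represents-unshift f K q (back σa≡) (back σb≡) rep) (represents-self f I)
        where
        back : ∀ {x y} → to (σ d) x ≡ y + q * + n → to (σ d) y ≡ x + (- q) * + n
        back {x} {y} eq = begin
          to (σ d) y                              ≡⟨ cong (to (σ d)) (unshift q eq) ⟩
          to (σ d) (to (σ d) x + (- q) * + n)     ≡⟨ to-shift (σ d) (to (σ d) x) (- q) ⟩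
          to (σ d) (to (σ d) x) + (- q) * + n     ≡⟨ cong (_+ (- q) * + n) (σσ d x) ⟩
          x + (- q) * + n                         ∎

    ascent-≋ : ∀ (f : AffinePerm n) {c e} → c ≋ e → to f e < to f (e + 1ℤ) → to f c < to f (c + 1ℤ)
    ascent-≋ f {e = e} (q , refl) asc = subst₂ _<_ (sym (to-shift f e q))
      (sym (trans (cong (to f) (+-swap e (q * + n) 1ℤ)) (to-shift f (e + 1ℤ) q)))
      (ℤₚ.+-monoˡ-< (q * + n) asc)

    -- Applying `σ d` to both entries matches the inversions of the two permutations, except for the
    -- class of (d , d + 1), which is an inversion of `σ d · f` without counterpart.
    ℓ-ascent : ∀ (f : AffinePerm n) → to f d < to f (d + 1ℤ) → ℓ (σ d · f) ≡ suc (ℓ f)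
    ℓ-ascent f asc = ℓ-↔ {f} {g} (mk↔ₛ′ Θ Θ⁻¹ ΘΘ⁻¹ Θ⁻¹Θ)
      where
      g = σ d · f

      gσ≡f : ∀ a → to f a ≡ to g (to (σ d) a)
      gσ≡f a = cong (to f) (sym (σσ d a))

      special? : ∀ x y → Dec (Special x y)
      special? x y = (x ≋? d) ×-dec (y ℤₚ.≟ x + 1ℤ)

      I-plain : ∀ (I : Inversion f) → ¬ Special (label (proj₁ I)) (proj₁ (proj₂ I))
      I-plain (a , b , _ , fb<fa) (a≋d , refl) = ℤₚ.<-asym (ascent-≋ f a≋d asc) fb<fa

      J₀-rep : ∃ (Represents g d (d + 1ℤ))
      J₀-rep = normalise g (a<a+1 d) (subst₂ _<_
        (cong (to f) (sym (trans (σ-next {d} ≋-refl) (+1-1 d)))) (cong (to f) (sym (σ-at {d} ≋-refl))) asc)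

      J₀ : Inversion g
      J₀ = proj₁ J₀-rep

      special⇒J₀ : ∀ (J : Inversion g) → Special (label (proj₁ J)) (proj₁ (proj₂ J)) → J₀ ≡ J
      special⇒J₀ J@(a , _) ((q , a≡) , refl) = represents-unique g J₀ J
        (subst₂ (λ x y → Represents g x y J₀) (sym a≡) (trans (+-swap d 1ℤ (q * + n)) (cong (_+ 1ℤ) (sym a≡)))
          (represents-shift g J₀ q (proj₂ J₀-rep)))
        (represents-self g J)

      image-plain : ∀ (I : Inversion f) (J : Inversion g) →
        Represents g (to (σ d) (label (proj₁ I))) (to (σ d) (proj₁ (proj₂ I))) J →
        ¬ Special (label (proj₁ J)) (proj₁ (proj₂ J))
      image-plain (a , b , a<b , _) (a′ , .(label a′ + 1ℤ) , _) (q , σa≡ , σb≡) (a′≋d , refl) =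
        ℤₚ.<-asym a<b (subst₂ _<_ (σσ d b) (σσ d (label a))
          (subst₂ (λ x y → to (σ d) y < to (σ d) x) (sym σa≡)
            (trans (+-swap (label a′) (q * + n) 1ℤ) (sym σb≡)) (σ-swaps {d} (≋-trans (q , refl) a′≋d))))

      J₀-special : Special (label (proj₁ J₀)) (proj₁ (proj₂ J₀))
      J₀-special with J₀-rep
      ... | (a , b , _) , q , d≡ , d+1≡ = ≋-sym {d} {label a} (q , d≡) , (begin
        b                                 ≡⟨ unshift q d+1≡ ⟩
        d + 1ℤ + (- q) * + n              ≡⟨ +-swap d 1ℤ ((- q) * + n) ⟩
        d + (- q) * + n + 1ℤ              ≡⟨ cong (_+ 1ℤ) (unshift {d} {label a} q d≡) ⟨
        label a + 1ℤ                      ∎)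

      Θ : Inversion g → ⊤ ⊎ Inversion f
      Θ J@(a , b , _) with special? (label a) b
      ... | yes _  = inj₁ tt
      ... | no  ¬p = inj₂ (proj₁ (swap g f (λ _ → refl) J ¬p))

      Θ⁻¹ : ⊤ ⊎ Inversion f → Inversion g
      Θ⁻¹ (inj₁ _) = J₀
      Θ⁻¹ (inj₂ I) = proj₁ (swap f g gσ≡f I (I-plain I))

      ΘΘ⁻¹ : ∀ x → Θ (Θ⁻¹ x) ≡ x
      ΘΘ⁻¹ (inj₁ tt) with special? (label (proj₁ J₀)) (proj₁ (proj₂ J₀))
      ... | yes _ = refl
      ... | no ¬p = contradiction J₀-special ¬p
      ΘΘ⁻¹ (inj₂ I) with swap f g gσ≡f I (I-plain I)
      ... | J@(a , b , _) , rep with special? (label a) b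
      ... | yes p = contradiction p (image-plain I J rep)
      ... | no ¬p with swap g f (λ _ → refl) J ¬p
      ... | K , rep′ = cong inj₂ (swap-swap f g I J K rep refl refl rep′)

      Θ⁻¹Θ : ∀ J → Θ⁻¹ (Θ J) ≡ J
      Θ⁻¹Θ J@(a , b , _) with special? (label a) b
      ... | yes p = special⇒J₀ J p
      ... | no ¬p with swap g f (λ _ → refl) J ¬p
      ... | I , rep with swap f g gσ≡f I (I-plain I)
      ... | K , rep′ = swap-swap g f J I K rep refl refl rep′

  ℓ-cong : ∀ {f g : AffinePerm n} → f ≐ g → ℓ f ≡ ℓ g
  ℓ-cong {f} {g} f≐g = Permutation.↔⇒≡ (proj₂ (inversions-finite g) ↔-∘ (β ↔-∘ ↔-sym (proj₂ (inversions-finite f))))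
    where
    convert : ∀ {f g : AffinePerm n} → f ≐ g → Inversion f → Inversion g
    convert f≐g (a , b , a<b , fb<fa) = a , b , a<b , subst₂ _<_ (f≐g b) (f≐g (label a)) fb<fa
    convert-convert : ∀ {f g : AffinePerm n} (p : f ≐ g) (q : g ≐ f) I → convert {g} {f} q (convert {f} {g} p I) ≡ I
    convert-convert p q (a , b , a<b , fb<fa) = cong (λ r → a , b , a<b , r) (ℤₚ.<-irrelevant _ _)
    β : Inversion f ↔ Inversion g
    β = mk↔ₛ′ (convert {f} {g} f≐g) (convert {g} {f} (sym ∘ f≐g))
              (convert-convert {g} {f} (sym ∘ f≐g) f≐g) (convert-convert {f} {g} f≐g (sym ∘ f≐g))

  ℓ-descent : ∀ d (f : AffinePerm n) → to f (d + 1ℤ) < to f d → ℓ f ≡ suc (ℓ (σ d · f))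
  ℓ-descent d f desc = trans (ℓ-cong {f} {σ d · (σ d · f)} (λ a → cong (to f) (sym (σσ d a))))
    (ℓ-ascent {d} (σ d · f) (subst₂ _<_ (cong (to f) (sym (σ-at {d} ≋-refl)))
      (cong (to f) (sym (trans (σ-next {d} ≋-refl) (+1-1 d)))) desc))

  ℓ-·σ : ∀ d (f : AffinePerm n) → ℓ (f · σ d) ≡ ℓ (σ d · f ⁻¹)
  ℓ-·σ d f = trans (sym (ℓ-⁻¹ (f · σ d))) (ℓ-cong {(f · σ d) ⁻¹} {σ d · f ⁻¹} (λ a → cong (from f) (from-σ d a)))

  -- Lattice paths as height functions

  pred≋̸ : ∀ {d} → ¬ d - 1ℤ ≋ d
  pred≋̸ {d} p = ≋-suc (d - 1ℤ) (subst (d - 1ℤ ≋_) (sym (-1+1 d)) p)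

  suc≋̸ : ∀ {d} → ¬ d + 1ℤ ≋ d
  suc≋̸ {d} = ≋-suc d ∘ ≋-sym

  -- The height of a lattice path as a function of x + y, or likewise the abscissa.
  record Profile (κ : ℤ) (h : ℤ → ℤ) : Set where
    field
      step-cases : ∀ j → h j ≡ h (j - 1ℤ) ⊎ h j ≡ h (j - 1ℤ) + 1ℤ
      slope      : ∀ j → h (j + + n) ≡ h j + κ

    next-cases : ∀ j → h (j + 1ℤ) ≡ h j ⊎ h (j + 1ℤ) ≡ h j + 1ℤ
    next-cases j = subst (λ x → h (j + 1ℤ) ≡ h x ⊎ h (j + 1ℤ) ≡ h x + 1ℤ) (+1-1 j) (step-cases (j + 1ℤ))

    slopes : ∀ j q → h (j + q * + n) ≡ h j + q * κ
    slopes = progression h slope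

    step-≤ : ∀ j → h j ≤ h (j + 1ℤ)
    step-≤ j with next-cases j
    ... | inj₁ eq = ℤₚ.≤-reflexive (sym eq)
    ... | inj₂ eq = subst (h j ≤_) (sym eq) (ℤₚ.<⇒≤ (a<a+1 (h j)))

    monotone : ∀ {a b} → a ≤ b → h a ≤ h b
    monotone {a} {b} a≤b = subst (λ x → h a ≤ h x) b≡ (climb ∣ b - a ∣)
      where
      b≡ : a + + ∣ b - a ∣ ≡ b
      b≡ = trans (cong (λ x → a + x) (ℤₚ.0≤i⇒+∣i∣≡i (ℤₚ.i≤j⇒0≤j-i a≤b))) (eq a b)
        where
        eq : ∀ a b → a + (b - a) ≡ b
        eq = solve-∀
      climb : ∀ m → h a ≤ h (a + + m)
      climb zero    = ℤₚ.≤-reflexive (cong h (sym (ℤₚ.+-identityʳ a)))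
      climb (suc m) = ℤₚ.≤-trans (climb m) (subst (λ x → h (a + + m) ≤ h x) (eq a (+ m)) (step-≤ (a + + m)))
        where
        eq : ∀ a m → a + m + 1ℤ ≡ a + (1ℤ + m)
        eq = solve-∀

    reflects-< : ∀ {a b} → h a < h b → a < b
    reflects-< ha<hb = ℤₚ.≰⇒> (λ b≤a → ℤₚ.<⇒≱ ha<hb (monotone b≤a))

  open Profile public

  -- Reflection in the diagonal: the abscissa of the same path, whose rises are the R steps.
  complement : ∀ {κ h} → Profile κ h → Profile (+ n - κ) (λ j → j - h j)
  complement {κ} {h} H = record
    { step-cases = λ j → [ (λ eq → inj₂ (trans (cong (λ x → j - x) eq) (up j (h (j - 1ℤ)))))
                         , (λ eq → inj₁ (trans (cong (λ x → j - x) eq) (flat j (h (j - 1ℤ))))) ]′ (step-cases H j)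
    ; slope      = λ j → trans (cong (λ x → j + + n - x) (slope H j)) (eq j (+ n) (h j) κ)
    }
    where
    up : ∀ j x → j - x ≡ j - 1ℤ - x + 1ℤ
    up = solve-∀
    flat : ∀ j x → j - (x + 1ℤ) ≡ j - 1ℤ - x
    flat = solve-∀
    eq : ∀ j n x κ → j + n - (x + κ) ≡ j - x + (n - κ)
    eq = solve-∀

  -- A half turn about the origin: rises stay rises, while lowering a path becomes raising it.
  reverse : ∀ {κ h} → Profile κ h → Profile κ (λ j → - h (- j))
  reverse {κ} {h} H = record
    { step-cases = λ j → subst (λ x → - h (- j) ≡ - h x ⊎ - h (- j) ≡ - h x + 1ℤ) (sym (eq₁ j))
        ([ (λ eq → inj₁ (cong -_ (sym eq)))
         , (λ eq → inj₂ (trans (eq₂ (h (- j))) (cong (λ x → - x + 1ℤ) (sym eq)))) ]′ (next-cases H (- j)))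
    ; slope      = λ j → trans (eq₃ (h (- (j + + n))) κ)
        (trans (cong (λ x → - x + κ) (sym (slope H (- (j + + n))))) (cong (λ x → - h x + κ) (eq₄ j (+ n))))
    }
    where
    eq₁ : ∀ j → - (j - 1ℤ) ≡ - j + 1ℤ
    eq₁ = solve-∀
    eq₂ : ∀ x → - x ≡ - (x + 1ℤ) + 1ℤ
    eq₂ = solve-∀
    eq₃ : ∀ x κ → - x ≡ - (x + κ) + κ
    eq₃ = solve-∀
    eq₄ : ∀ j n → - (j + n) + n ≡ - j
    eq₄ = solve-∀

  -- A relation and not an operation on height functions, so that a descent can end in a prescribed
  -- function, such as the height of P, to which it is only pointwise equal.
  record Lowered (d : ℤ) (g h : ℤ → ℤ) : Set where
    field
      at  : ∀ {j} → j ≋ d → h j ≡ g j - 1ℤ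
      off : ∀ {j} → ¬ j ≋ d → h j ≡ g j

  open Lowered public

  -- Each letter d of the word flips the corners UR at the vertices congruent to d to RU.
  data Descent (top : ℤ → ℤ) : List ℤ → (ℤ → ℤ) → Set where
    stop : ∀ {h} → (∀ j → h j ≡ top j) → Descent top [] h
    flip : ∀ {w g h} d → Descent top w g → g d ≡ g (d - 1ℤ) + 1ℤ → g (d + 1ℤ) ≡ g d →
           Lowered d g h → Descent top (d ∷ w) h

  profile-≗ : ∀ {κ g h} → (∀ j → h j ≡ g j) → Profile κ g → Profile κ h
  profile-≗ {κ} h≗g G = record
    { step-cases = λ j → subst₂ (λ x y → x ≡ y ⊎ x ≡ y + 1ℤ) (sym (h≗g j)) (sym (h≗g (j - 1ℤ))) (step-cases G j)
    ; slope      = λ j → trans (h≗g _) (trans (slope G j) (cong (_+ κ) (sym (h≗g j))))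
    }

  transfer : ∀ {κ h} → Profile κ h → ∀ {d e} → d ≋ e → ∀ {x y c} →
             h (d + x) ≡ h (d + y) + c → h (e + x) ≡ h (e + y) + c
  transfer {κ} {h} H {e = e} (q , refl) {x} {y} {c} eq = +-cancelʳ (q * κ) (begin
    h (e + x) + q * κ            ≡⟨ slopes H (e + x) q ⟨
    h (e + x + q * + n)          ≡⟨ cong h (+-swap e x (q * + n)) ⟩
    h (e + q * + n + x)          ≡⟨ eq ⟩
    h (e + q * + n + y) + c      ≡⟨ cong (λ z → h z + c) (+-swap e (q * + n) y) ⟩
    h (e + y + q * + n) + c      ≡⟨ cong (_+ c) (slopes H (e + y) q) ⟩
    h (e + y) + q * κ + c        ≡⟨ +-swap (h (e + y)) (q * κ) c ⟩
    h (e + y) + c + q * κ        ∎)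

  module _ {κ h} (H : Profile κ h) where
    up-≋ : ∀ {d e} → d ≋ e → h d ≡ h (d - 1ℤ) + 1ℤ → h e ≡ h (e - 1ℤ) + 1ℤ
    up-≋ {d} {e} d≋e eq = subst (λ x → h x ≡ h (e - 1ℤ) + 1ℤ) (ℤₚ.+-identityʳ e)
      (transfer H d≋e {0ℤ} { -1ℤ} {1ℤ} (trans (cong h (ℤₚ.+-identityʳ d)) eq))

    flat-≋ : ∀ {d e} → d ≋ e → h d ≡ h (d - 1ℤ) → h e ≡ h (e - 1ℤ)
    flat-≋ {d} {e} d≋e eq = trans (cong h (sym (ℤₚ.+-identityʳ e))) (trans
      (transfer H d≋e {0ℤ} { -1ℤ} {0ℤ}
        (trans (cong h (ℤₚ.+-identityʳ d)) (trans eq (sym (ℤₚ.+-identityʳ _))))) (ℤₚ.+-identityʳ _))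

    next-up-≋ : ∀ {d e} → d ≋ e → h (d + 1ℤ) ≡ h d + 1ℤ → h (e + 1ℤ) ≡ h e + 1ℤ
    next-up-≋ {d} {e} d≋e eq = subst (λ x → h (e + 1ℤ) ≡ h x + 1ℤ) (ℤₚ.+-identityʳ e)
      (transfer H d≋e {1ℤ} {0ℤ} {1ℤ} (trans eq (cong (λ x → h x + 1ℤ) (sym (ℤₚ.+-identityʳ d)))))

    next-flat-≋ : ∀ {d e} → d ≋ e → h (d + 1ℤ) ≡ h d → h (e + 1ℤ) ≡ h e
    next-flat-≋ {d} {e} d≋e eq = trans (transfer H d≋e {1ℤ} {0ℤ} {0ℤ}
      (trans eq (trans (cong h (sym (ℤₚ.+-identityʳ d))) (sym (ℤₚ.+-identityʳ _)))))
      (trans (ℤₚ.+-identityʳ _) (cong h (ℤₚ.+-identityʳ e)))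

    lowered-profile : ∀ {d g} → Lowered d h g → h d ≡ h (d - 1ℤ) + 1ℤ → h (d + 1ℤ) ≡ h d → Profile κ g
    lowered-profile {d} {g} L up flat = record { step-cases = cases ; slope = slope′ }
      where
      cases : ∀ j → g j ≡ g (j - 1ℤ) ⊎ g j ≡ g (j - 1ℤ) + 1ℤ
      cases j with j ≋? d | j - 1ℤ ≋? d
      ... | yes p | yes q = contradiction (≋-trans q (≋-sym p)) pred≋̸
      ... | yes p | no ¬q = inj₁ (begin
        g j                     ≡⟨ at L p ⟩
        h j - 1ℤ                ≡⟨ cong (_- 1ℤ) (up-≋ (≋-sym p) up) ⟩
        h (j - 1ℤ) + 1ℤ - 1ℤ    ≡⟨ +1-1 _ ⟩
        h (j - 1ℤ)              ≡⟨ off L ¬q ⟨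
        g (j - 1ℤ)              ∎)
      ... | no ¬p | yes q = inj₂ (begin
        g j                     ≡⟨ off L ¬p ⟩
        h j                     ≡⟨ cong h (-1+1 j) ⟨
        h (j - 1ℤ + 1ℤ)         ≡⟨ next-flat-≋ (≋-sym q) flat ⟩
        h (j - 1ℤ)              ≡⟨ -1+1 _ ⟨
        h (j - 1ℤ) - 1ℤ + 1ℤ    ≡⟨ cong (_+ 1ℤ) (at L q) ⟨
        g (j - 1ℤ) + 1ℤ         ∎)
      ... | no ¬p | no ¬q = subst₂ (λ x y → x ≡ y ⊎ x ≡ y + 1ℤ) (sym (off L ¬p)) (sym (off L ¬q)) (step-cases H j)
      slope′ : ∀ j → g (j + + n) ≡ g j + κ
      slope′ j with j ≋? d
      ... | yes p = trans (at L (≋-trans (≋-period j) p)) (trans (cong (_- 1ℤ) (slope H j))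
                      (trans (+-swap (h j) κ -1ℤ) (cong (_+ κ) (sym (at L p)))))
      ... | no ¬p = trans (off L (¬p ∘ ≋-trans (≋-sym (≋-period j)))) (trans (slope H j) (cong (_+ κ) (sym (off L ¬p))))

  descent-profile : ∀ {κ top w h} → Profile κ top → Descent top w h → Profile κ h
  descent-profile T (stop h≗top)         = profile-≗ h≗top T
  descent-profile T (flip d D up flat L) = lowered-profile (descent-profile T D) L up flat

  lowered-≤ : ∀ {d g h} → Lowered d g h → ∀ j → h j ≤ g j
  lowered-≤ {d} {g} {h} L j with j ≋? d
  ... | yes p = subst (_≤ g j) (sym (at L p)) (ℤₚ.<⇒≤ (a-1<a (g j)))
  ... | no ¬p = ℤₚ.≤-reflexive (off L ¬p)

  descent-≤ : ∀ {top w h} → Descent top w h → ∀ j → h j ≤ top j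
  descent-≤ (stop h≗top)      j = ℤₚ.≤-reflexive (h≗top j)
  descent-≤ (flip d D _ _ L)  j = ℤₚ.≤-trans (lowered-≤ L j) (descent-≤ D j)

  -- A box added at the north is the first one to be flipped, and the first flip is the last entry
  -- of the list.
  descent-∷ʳ : ∀ {top′ top w h} a → top′ a ≡ top′ (a - 1ℤ) + 1ℤ → top′ (a + 1ℤ) ≡ top′ a →
               Lowered a top′ top → Descent top w h → Descent top′ (w ∷ʳ a) h
  descent-∷ʳ a up flat L (stop h≗top) = flip a (stop (λ _ → refl)) up flat
    (record { at = λ p → trans (h≗top _) (at L p) ; off = λ ¬p → trans (h≗top _) (off L ¬p) })
  descent-∷ʳ a up flat L (flip d D up′ flat′ L′) = flip d (descent-∷ʳ a up flat L D) up′ flat′ L′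

  -- Adding a constant to the heights slides the paths along the antidiagonals, which preserves
  -- steps and positions.
  descent-translate : ∀ {top top′ w h h′} c → (∀ j → top′ j ≡ top j + c) → (∀ j → h′ j ≡ h j + c) →
                      Descent top w h → Descent top′ w h′
  descent-translate c top≡ h≡ (stop h≗top) =
    stop (λ j → trans (h≡ j) (trans (cong (_+ c) (h≗top j)) (sym (top≡ j))))
  descent-translate c top≡ h≡ (flip {g = g} d D up flat L) =
    flip {g = λ j → g j + c} d (descent-translate c top≡ (λ _ → refl) D)
      (trans (cong (_+ c) up) (+-swap (g (d - 1ℤ)) 1ℤ c)) (cong (_+ c) flat)
      (record { at  = λ {j} p → trans (h≡ j) (trans (cong (_+ c) (at L p)) (+-swap (g j) -1ℤ c))
              ; off = λ ¬p → trans (h≡ _) (cong (_+ c) (off L ¬p)) })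

  -- Existence of a word between two paths

  module _ {κ} (0<κ : 0ℤ < κ) (κ<n : κ < + n) {top : ℤ → ℤ} (T : Profile κ top) where
    -- Starting below top, walk left through U steps and then right through R steps to reach a corner RU.
    left-end : ∀ {bot} → Profile κ bot → ∀ m {j} → bot j < top j →
               (∃ λ i → bot i < top i × bot i ≡ bot (i - 1ℤ)) ⊎ bot j ≡ bot (j - + m) + + m
    left-end {bot} B zero {j} _ = inj₂ (trans (cong bot (sym (ℤₚ.+-identityʳ j))) (sym (ℤₚ.+-identityʳ _)))
    left-end {bot} B (suc m) {j} bot<top with step-cases B j
    ... | inj₁ flat = inj₁ (j , bot<top , flat)
    ... | inj₂ up with left-end B m {j - 1ℤ} (below (step-cases T j))
      where
      below : top j ≡ top (j - 1ℤ) ⊎ top j ≡ top (j - 1ℤ) + 1ℤ → bot (j - 1ℤ) < top (j - 1ℤ)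
      below (inj₁ eq) = ℤₚ.≤-<-trans (monotone B (ℤₚ.<⇒≤ (a-1<a j))) (subst (bot j <_) eq bot<top)
      below (inj₂ eq) = <-resp-difference (subst₂ _<_ up eq bot<top) (eq′ (bot (j - 1ℤ)) (top (j - 1ℤ)))
        where
        eq′ : ∀ x y → y + 1ℤ - (x + 1ℤ) ≡ y - x
        eq′ = solve-∀
    ... | inj₁ found = inj₁ found
    ... | inj₂ eq    = inj₂ (trans up (trans (cong (_+ 1ℤ) eq) (trans (eq₁ (bot (j - 1ℤ - + m)) (+ m))
                         (cong (λ x → bot x + + suc m) (eq₂ j (+ m))))))
      where
      eq₁ : ∀ x m → x + m + 1ℤ ≡ x + (1ℤ + m)
      eq₁ = solve-∀
      eq₂ : ∀ j m → j - 1ℤ - m ≡ j - (1ℤ + m)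
      eq₂ = solve-∀

    right-end : ∀ {bot} → Profile κ bot → ∀ m {j} → bot j < top j → bot j ≡ bot (j - 1ℤ) →
                (∃ λ i → bot i < top i × bot i ≡ bot (i - 1ℤ) × bot (i + 1ℤ) ≡ bot i + 1ℤ) ⊎ bot (j + + m) ≡ bot j
    right-end {bot} B zero {j} _ _ = inj₂ (cong bot (ℤₚ.+-identityʳ j))
    right-end {bot} B (suc m) {j} bot<top flat with next-cases B j
    ... | inj₂ up = inj₁ (j , bot<top , flat , up)
    ... | inj₁ flat′ with right-end B m {j + 1ℤ}
            (subst (_< top (j + 1ℤ)) (sym flat′) (ℤₚ.<-≤-trans bot<top (step-≤ T j)))
            (trans flat′ (cong bot (sym (+1-1 j))))
    ... | inj₁ found = inj₁ found
    ... | inj₂ eq    = inj₂ (trans (cong bot (eq₁ j (+ m))) (trans eq flat′))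
      where
      eq₁ : ∀ j m → j + (1ℤ + m) ≡ j + 1ℤ + m
      eq₁ = solve-∀

    -- If one of the walks found no end, a whole period would consist of U steps only or of R steps
    -- only, against 0 < κ < n.
    corner : ∀ {bot} → Profile κ bot → ∀ {j} → bot j < top j →
             ∃ λ i → bot i < top i × bot i ≡ bot (i - 1ℤ) × bot (i + 1ℤ) ≡ bot i + 1ℤ
    corner {bot} B {j} bot<top with left-end B n bot<top
    ... | inj₂ eq = contradiction κ<n (ℤₚ.<-irrefl (begin
      κ                                        ≡⟨ eq₁ (bot (j - + n)) κ ⟩
      bot (j - + n) + κ - bot (j - + n)        ≡⟨ cong (_- bot (j - + n)) (slope B (j - + n)) ⟨
      bot (j - + n + + n) - bot (j - + n)      ≡⟨ cong (λ x → bot x - bot (j - + n)) (-+-cancel j (+ n)) ⟩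
      bot j - bot (j - + n)                    ≡⟨ cong (_- bot (j - + n)) eq ⟩
      bot (j - + n) + + n - bot (j - + n)      ≡⟨ eq₁ (bot (j - + n)) (+ n) ⟨
      + n                                      ∎))
      where
      eq₁ : ∀ x y → y ≡ x + y - x
      eq₁ = solve-∀
    ... | inj₁ (i , bot<top′ , flat) with right-end B n bot<top′ flat
    ... | inj₁ found = found
    ... | inj₂ eq = contradiction 0<κ (ℤₚ.<-irrefl (begin
      0ℤ                     ≡⟨ ℤₚ.+-inverseʳ (bot i) ⟨
      bot i - bot i          ≡⟨ cong (_- bot i) eq ⟨
      bot (i + + n) - bot i  ≡⟨ cong (_- bot i) (slope B i) ⟩
      bot i + κ - bot i      ≡⟨ eq₁ (bot i) κ ⟩
      κ                      ∎))
      where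
      eq₁ : ∀ x y → x + y - x ≡ y
      eq₁ = solve-∀

  raise : ℤ → (ℤ → ℤ) → ℤ → ℤ
  raise d h j with j ≋? d
  ... | yes _ = h j + 1ℤ
  ... | no  _ = h j

  raise-at : ∀ {d j} h → j ≋ d → raise d h j ≡ h j + 1ℤ
  raise-at {d} {j} h p with j ≋? d
  ... | yes _ = refl
  ... | no ¬p = contradiction p ¬p

  raise-off : ∀ {d j} h → ¬ j ≋ d → raise d h j ≡ h j
  raise-off {d} {j} h ¬p with j ≋? d
  ... | yes p = contradiction p ¬p
  ... | no _  = refl

  raise-lowered : ∀ d h → Lowered d (raise d h) h
  raise-lowered d h = record
    { at  = λ {j} p → trans (sym (+1-1 (h j))) (cong (_- 1ℤ) (sym (raise-at h p)))
    ; off = λ ¬p → sym (raise-off h ¬p)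
    }

  raise-up : ∀ {d h} → h d ≡ h (d - 1ℤ) → raise d h d ≡ raise d h (d - 1ℤ) + 1ℤ
  raise-up {d} {h} flat = trans (raise-at h ≋-refl)
    (cong (_+ 1ℤ) (trans flat (sym (raise-off h pred≋̸))))

  raise-flat : ∀ {d h} → h (d + 1ℤ) ≡ h d + 1ℤ → raise d h (d + 1ℤ) ≡ raise d h d
  raise-flat {d} {h} up = trans (raise-off h suc≋̸) (trans up (sym (raise-at h ≋-refl)))

  raise-profile : ∀ {κ h d} → Profile κ h → h d ≡ h (d - 1ℤ) → h (d + 1ℤ) ≡ h d + 1ℤ → Profile κ (raise d h)
  raise-profile {κ} {h} {d} H flat up = record { step-cases = cases ; slope = slope′ }
    where
    cases : ∀ j → raise d h j ≡ raise d h (j - 1ℤ) ⊎ raise d h j ≡ raise d h (j - 1ℤ) + 1ℤ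
    cases j with j ≋? d | j - 1ℤ ≋? d
    ... | yes p | yes q = contradiction (≋-trans q (≋-sym p)) pred≋̸
    ... | yes p | no ¬q = inj₂ (cong (_+ 1ℤ) (flat-≋ H (≋-sym p) flat))
    ... | no ¬p | yes q = inj₁ (trans (cong h (sym (-1+1 j))) (next-up-≋ H (≋-sym q) up))
    ... | no ¬p | no ¬q = step-cases H j
    slope′ : ∀ j → raise d h (j + + n) ≡ raise d h j + κ
    slope′ j with j ≋? d
    ... | yes p = trans (raise-at h (≋-trans (≋-period j) p)) (trans (cong (_+ 1ℤ) (slope H j)) (+-swap (h j) κ 1ℤ))
    ... | no ¬p = trans (raise-off h (¬p ∘ ≋-trans (≋-sym (≋-period j)))) (slope H j)

  raise-≤ : ∀ {κ top h d} → Profile κ top → Profile κ h → (∀ j → h j ≤ top j) → h d < top d →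
            ∀ j → raise d h j ≤ top j
  raise-≤ {κ} {top} {h} {d} T H h≤top h<top j with j ≋? d
  ... | no _ = h≤top j
  ... | yes (q , refl) = <⇒+1≤ (subst₂ _<_ (sym (slopes H d q)) (sym (slopes T d q)) (ℤₚ.+-monoˡ-< (q * κ) h<top))

  ∣∣-mono-≤ : ∀ {x y} → 0ℤ ≤ x → x ≤ y → ∣ x ∣ ℕ.≤ ∣ y ∣
  ∣∣-mono-≤ 0≤x x≤y = ℤₚ.drop‿+≤+ (subst₂ _≤_ (sym (ℤₚ.0≤i⇒+∣i∣≡i 0≤x))
    (sym (ℤₚ.0≤i⇒+∣i∣≡i (ℤₚ.≤-trans 0≤x x≤y))) x≤y)

  ∣∣-mono-< : ∀ {x y} → 0ℤ ≤ x → x < y → ∣ x ∣ ℕ.< ∣ y ∣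
  ∣∣-mono-< 0≤x x<y = ℤₚ.drop‿+<+ (subst₂ _<_ (sym (ℤₚ.0≤i⇒+∣i∣≡i 0≤x))
    (sym (ℤₚ.0≤i⇒+∣i∣≡i (ℤₚ.<⇒≤ (ℤₚ.≤-<-trans 0≤x x<y)))) x<y)

  module _ {κ} (0<κ : 0ℤ < κ) (κ<n : κ < + n) {top : ℤ → ℤ} (T : Profile κ top) where
    private
      -- The number of boxes per period between the two paths, counted by antidiagonals; it bounds
      -- the recursion in `descend`.
      area : (ℤ → ℤ) → ℕ
      area bot = total (λ (i : Fin n) → ∣ top (label i) - bot (label i) ∣)

      area-raise : ∀ {bot d} → Profile κ bot → (∀ j → bot j ≤ top j) → bot d < top d →
                   area (raise d bot) ℕ.< area bot
      area-raise {bot} {d} B bot≤top bot<top = total-mono-< (λ i → ∣∣-mono-≤ (raise≤ (label i)) (shrink (label i)))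
        (residue d) (∣∣-mono-< (raise≤ _) (subst (λ x → top r - x < top r - bot r)
          (sym (raise-at bot (≋-sym (label-residue d)))) (<-resp-difference (a<a+1 (bot r)) (eq (top r) (bot r)))))
        where
        r : ℤ
        r = label (residue {n} d)
        raise≤ : ∀ j → 0ℤ ≤ top j - raise d bot j
        raise≤ j = ℤₚ.i≤j⇒0≤j-i (raise-≤ T B bot≤top bot<top j)
        eq : ∀ t b → b + 1ℤ - b ≡ t - b - (t - (b + 1ℤ))
        eq = solve-∀
        eq′ : ∀ t x y → x - y ≡ t - y - (t - x)
        eq′ = solve-∀
        shrink : ∀ j → top j - raise d bot j ≤ top j - bot j
        shrink j = ≤-resp-difference (lowered-≤ (raise-lowered d bot) j) (eq′ (top j) (raise d bot j) (bot j))

      equal : ∀ {bot} → Profile κ bot → (∀ j → bot j ≤ top j) →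
              ¬ (∃ λ (i : Fin n) → bot (label i) < top (label i)) → ∀ j → bot j ≡ top j
      equal {bot} B bot≤top ∄ j = shifted (label-residue j)
        where
        r : ℤ
        r = label (residue {n} j)
        shifted : j ≋ r → bot j ≡ top j
        shifted (q , j≡) = begin
          bot j                          ≡⟨ cong bot j≡ ⟩
          bot (r + q * + n)              ≡⟨ slopes B r q ⟩
          bot r + q * κ                  ≡⟨ cong (_+ q * κ) (ℤₚ.≤-antisym (bot≤top r) (ℤₚ.≮⇒≥ (λ lt → ∄ (residue j , lt)))) ⟩
          top r + q * κ                  ≡⟨ slopes T r q ⟨
          top (r + q * + n)              ≡⟨ cong top j≡ ⟨
          top j                          ∎

      -- The word is found from its southern end: raising `bot` at a corner RU undoes the last flip,
      -- and the recursion treats the raised path.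
      descend : ∀ m {bot} → area bot ℕ.< m → Profile κ bot → (∀ j → bot j ≤ top j) → ∃ λ w → Descent top w bot
      descend (suc m) {bot} (ℕ.s≤s area≤m) B bot≤top =
        by-cases (Finₚ.any? (λ (i : Fin n) → bot (label i) ℤₚ.<? top (label i)))
        where
        by-corner : (∃ λ d → bot d < top d × bot d ≡ bot (d - 1ℤ) × bot (d + 1ℤ) ≡ bot d + 1ℤ) → ∃ λ w → Descent top w bot
        by-corner (d , lt , flat , up) = extend (descend m {raise d bot}
            (ℕₚ.<-≤-trans (area-raise B bot≤top lt) area≤m) (raise-profile B flat up) (raise-≤ T B bot≤top lt))
          where
          extend : (∃ λ w → Descent top w (raise d bot)) → ∃ λ w → Descent top w bot
          extend (w , D) = d ∷ w , flip d D (raise-up flat) (raise-flat up) (raise-lowered d bot)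
        by-cases : Dec (∃ λ (i : Fin n) → bot (label i) < top (label i)) → ∃ λ w → Descent top w bot
        by-cases (no ∄)               = [] , stop (equal B bot≤top ∄)
        by-cases (yes (i , bot<top)) = by-corner (corner 0<κ κ<n T B bot<top)

    descent-exists : ∀ {bot} → Profile κ bot → (∀ j → bot j ≤ top j) → ∃ λ w → Descent top w bot
    descent-exists {bot} = descend (suc (area bot)) (ℕₚ.n<1+n (area bot))

module Rank (n k : ℕ) .{{_ : NonTrivial n}} where
  open Periodic n

  -- The recurrence

  shift : AffinePerm n
  shift = record
    { bijection = mk↔ₛ′ (_+ + k) (_- + k) (λ a → -+-cancel a (+ k)) (λ a → +--cancel a (+ k))
    ; periodic  = λ a → +-swap a (+ n) (+ k)
    }

  abstract
    infix 4 _≐?_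
    _≐?_ : ∀ v u → Dec (v ≐ u)
    v ≐? u = map′ extend (λ v≐u i → v≐u (label i)) (Finₚ.all? (λ i → to v (label i) ℤₚ.≟ to u (label i)))
      where
      extend : (∀ i → to v (label {n} i) ≡ to u (label i)) → v ≐ u
      extend eq a = agree-≋ v u (label-residue a) (eq (residue a))

  -- The right and left actions of the generators of the Hecke algebra with T² = T + 1 on functions of v.
  ρ λ′ : ℤ → (AffinePerm n → ℕ) → AffinePerm n → ℕ
  ρ  d φ v = φ (v · σ d) ℕ.+ when (from v d <ᵇ from v (d + 1ℤ)) (φ v)
  λ′ c φ v = φ (σ c · v) ℕ.+ when (to v c <ᵇ to v (c + 1ℤ)) (φ v)

  -- The number of distinguished subexpressions for v of a word, whose last letter comes first in the list;
  -- the empty word corresponds to shift rather than to the identity, since northern label i is at position i + k.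
  N : AffinePerm n → List ℤ → ℕ
  N v []      = when (does (v ≐? shift)) 1
  N v (d ∷ w) = ρ d (λ u → N u w) v

  Respectful : (AffinePerm n → ℕ) → Set
  Respectful φ = ∀ v u → v ≐ u → φ v ≡ φ u

  ρ-respectful : ∀ d φ → Respectful φ → Respectful (ρ d φ)
  ρ-respectful d φ φ-resp v u v≐u = cong₂ ℕ._+_
    (φ-resp (v · σ d) (u · σ d) (cong (to (σ d)) ∘ v≐u))
    (cong₂ when (cong₂ _<ᵇ_ (from-cong {v} {u} v≐u d) (from-cong {v} {u} v≐u (d + 1ℤ))) (φ-resp v u v≐u))

  N-respectful : ∀ w → Respectful (λ u → N u w)
  N-respectful [] v u v≐u = cong (λ b → when b 1)
    (does-⇔ (mk⇔ (λ p a → trans (sym (v≐u a)) (p a)) (λ p a → trans (v≐u a) (p a))) (v ≐? shift) (u ≐? shift))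
  N-respectful (d ∷ w) = ρ-respectful d (λ u → N u w) (N-respectful w)

  ρ-cong : ∀ d {φ ψ} → (∀ u → φ u ≡ ψ u) → ∀ v → ρ d φ v ≡ ρ d ψ v
  ρ-cong d φ≡ψ v = cong₂ ℕ._+_ (φ≡ψ (v · σ d)) (cong (when _) (φ≡ψ v))

  from-·σ : ∀ v d a → from (v · σ d) a ≡ from v (to (σ d) a)
  from-·σ v d a = cong (from v) (from-σ d a)

  from-σ· : ∀ v c a → from (σ c · v) a ≡ to (σ c) (from v a)
  from-σ· v c a = from-σ c (from v a)

  from-shift : ∀ v a q → from v (a + q * + n) ≡ from v a + q * + n
  from-shift v = to-shift (v ⁻¹)

  from-≋ : ∀ v {a b} → a ≋ b → from v a ≋ from v b
  from-≋ v = to-≋ (v ⁻¹)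

  from-via : ∀ v c {a} (p : to v c ≋ a) → from v a ≡ c + (- _≋_.quotient p) * + n
  from-via v c {a} (m , vc≡) = begin
    from v a                                         ≡⟨ cong (from v) (eq a m (+ n)) ⟩
    from v (a + m * + n + (- m) * + n)               ≡⟨ cong (λ z → from v (z + (- m) * + n)) vc≡ ⟨
    from v (to v c + (- m) * + n)                    ≡⟨ from-shift v (to v c) (- m) ⟩
    from v (to v c) + (- m) * + n                    ≡⟨ cong (_+ (- m) * + n) (from-to v c) ⟩
    c + (- m) * + n                                  ∎
    where
    eq : ∀ a m n → a ≡ a + m * n + (- m) * n
    eq = solve-∀

  -- Conjugation by v turns the transposition of p and p + 1 into that of their images, whichever
  -- image is the larger.
  conjugate : ∀ v c d {p} → p ≋ c → (to v p ≡ d × to v (p + 1ℤ) ≡ d + 1ℤ) ⊎ (to v p ≡ d + 1ℤ × to v (p + 1ℤ) ≡ d) →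
              σ c · v ≐ v · σ d
  conjugate v c d {p} p≋c vp a with σ-cases c a
  ... | inj₁ (a≋c , _) = agree-≋ (σ c · v) (v · σ d) (≋-trans a≋c (≋-sym p≋c))
    (trans (cong (to v) (σ-at p≋c)) (image vp))
    where
    image : (to v p ≡ d × to v (p + 1ℤ) ≡ d + 1ℤ) ⊎ (to v p ≡ d + 1ℤ × to v (p + 1ℤ) ≡ d) →
            to v (p + 1ℤ) ≡ to (σ d) (to v p)
    image (inj₁ (e , e′)) = trans e′ (sym (trans (cong (to (σ d)) e) (σ-at ≋-refl)))
    image (inj₂ (e , e′)) = trans e′ (sym (trans (cong (to (σ d)) e) (trans (σ-next ≋-refl) (+1-1 d))))
  ... | inj₂ (inj₁ (a≋c+1 , _)) = agree-≋ (σ c · v) (v · σ d) (≋-trans a≋c+1 (≋-+ 1ℤ (≋-sym p≋c)))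
    (trans (cong (to v) (trans (σ-next (≋-+ 1ℤ p≋c)) (+1-1 p))) (image vp))
    where
    image : (to v p ≡ d × to v (p + 1ℤ) ≡ d + 1ℤ) ⊎ (to v p ≡ d + 1ℤ × to v (p + 1ℤ) ≡ d) →
            to v p ≡ to (σ d) (to v (p + 1ℤ))
    image (inj₁ (e , e′)) = trans e (sym (trans (cong (to (σ d)) e′) (trans (σ-next ≋-refl) (+1-1 d))))
    image (inj₂ (e , e′)) = trans e (sym (trans (cong (to (σ d)) e′) (σ-at ≋-refl)))
  ... | inj₂ (inj₂ (a≋̸c , a≋̸c+1 , σa≡)) = trans (cong (to v) σa≡) (sym (σ-fixed (fix₁ vp) (fix₂ vp)))
    where
    reflect : ∀ {x} → to v a ≋ to v x → a ≋ x
    reflect {x} e = subst₂ _≋_ (from-to v a) (from-to v x) (from-≋ v e)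
    p+1 : p + 1ℤ ≋ c + 1ℤ
    p+1 = ≋-+ 1ℤ p≋c
    fix₁ : (to v p ≡ d × to v (p + 1ℤ) ≡ d + 1ℤ) ⊎ (to v p ≡ d + 1ℤ × to v (p + 1ℤ) ≡ d) → ¬ to v a ≋ d
    fix₁ (inj₁ (refl , _)) e = a≋̸c (≋-trans (reflect e) p≋c)
    fix₁ (inj₂ (_ , refl)) e = a≋̸c+1 (≋-trans (reflect e) p+1)
    fix₂ : (to v p ≡ d × to v (p + 1ℤ) ≡ d + 1ℤ) ⊎ (to v p ≡ d + 1ℤ × to v (p + 1ℤ) ≡ d) → ¬ to v a ≋ d + 1ℤ
    fix₂ (inj₁ (_ , eq)) e = a≋̸c+1 (≋-trans (reflect (subst (to v a ≋_) (sym eq) e)) p+1)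
    fix₂ (inj₂ (eq , _)) e = a≋̸c (≋-trans (reflect (subst (to v a ≋_) (sym eq) e)) p≋c)

  -- `a` and `b` are the right and the left ascent at v, `a′` and `b′` the same after the move on
  -- the other side. Either both are unaffected, or the two moves lead to the same element and
  -- reverse both ascents.
  +-when-swap : ∀ x a a′ b b′ (y z w : ℕ) →
    (a ≡ a′ × b ≡ b′) ⊎ (y ≡ z × (a ≡ true × a′ ≡ false × b ≡ true × b′ ≡ false ⊎
                                  a ≡ false × a′ ≡ true × b ≡ false × b′ ≡ true)) →
    x ℕ.+ when a′ y ℕ.+ when b (z ℕ.+ when a w) ≡ x ℕ.+ when b′ z ℕ.+ when a (y ℕ.+ when b w)
  +-when-swap x true  _ true  _ y z w (inj₁ (refl , refl)) = eq x y z w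
    where
    eq : ∀ x y z w → x ℕ.+ y ℕ.+ (z ℕ.+ w) ≡ x ℕ.+ z ℕ.+ (y ℕ.+ w)
    eq = ℕ-Solver.solve-∀
  +-when-swap x true  _ false _ y z w (inj₁ (refl , refl)) = eq x y
    where
    eq : ∀ x y → x ℕ.+ y ℕ.+ 0 ≡ x ℕ.+ 0 ℕ.+ (y ℕ.+ 0)
    eq = ℕ-Solver.solve-∀
  +-when-swap x false _ true  _ y z w (inj₁ (refl , refl)) = eq x z
    where
    eq : ∀ x z → x ℕ.+ 0 ℕ.+ (z ℕ.+ 0) ≡ x ℕ.+ z ℕ.+ 0
    eq = ℕ-Solver.solve-∀
  +-when-swap x false _ false _ y z w (inj₁ (refl , refl)) = refl
  +-when-swap x _ _ _ _ y _ w (inj₂ (refl , inj₁ (refl , refl , refl , refl))) = refl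
  +-when-swap x _ _ _ _ y _ w (inj₂ (refl , inj₂ (refl , refl , refl , refl))) = refl

  -- The two sides interfere only if v carries neighbours at a translate of c onto d, d + 1 in some
  -- order. Then `σ c · v` and `v · σ d` coincide, and the left and the right ascent at v hold or
  -- fail together.
  λρ-commute : ∀ c d φ → Respectful φ → ∀ v → λ′ c (ρ d φ) v ≡ ρ d (λ′ c φ) v
  λρ-commute c d φ φ-resp v = trans
    (cong (λ b → φ (σ c · v · σ d) ℕ.+ when b (φ (σ c · v)) ℕ.+
                 when (to v c <ᵇ to v (c + 1ℤ)) (φ (v · σ d) ℕ.+ when (p <ᵇ q) (φ v)))
          (cong₂ _<ᵇ_ (from-σ· v c d) (from-σ· v c (d + 1ℤ))))
    (trans (+-when-swap (φ (σ c · v · σ d)) (p <ᵇ q) (to (σ c) p <ᵇ to (σ c) q)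
      (to v c <ᵇ to v (c + 1ℤ)) (to (v · σ d) c <ᵇ to (v · σ d) (c + 1ℤ))
      (φ (σ c · v)) (φ (v · σ d)) (φ v) cases)
      (cong (λ x → x ℕ.+ when (to (v · σ d) c <ᵇ to (v · σ d) (c + 1ℤ)) (φ (v · σ d)) ℕ.+
                   when (p <ᵇ q) (λ′ c φ v))
            (φ-resp (σ c · v · σ d) (σ c · (v · σ d)) (λ _ → refl))))
    where
    p = from v d
    q = from v (d + 1ℤ)
    vp≡ : to v p ≡ d
    vp≡ = to-from v d
    vq≡ : to v q ≡ d + 1ℤ
    vq≡ = to-from v (d + 1ℤ)
    p≢q : p ≢ q
    p≢q p≡q = ℤₚ.<-irrefl (trans (sym vp≡) (trans (cong (to v) p≡q) vq≡)) (a<a+1 d)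
    vc≢ : to v c ≢ to v (c + 1ℤ)
    vc≢ eq = ℤₚ.<-irrefl (to-injective v eq) (a<a+1 c)
    along : ∀ {x} m → x ≡ c + m * + n → to v c ≡ to v x + (- m) * + n × to v (c + 1ℤ) ≡ to v (x + 1ℤ) + (- m) * + n
    along {x} m refl =
      trans (cong (to v) (eq₁ c m (+ n))) (to-shift v x (- m)) ,
      trans (cong (to v) (eq₂ c m (+ n))) (to-shift v (x + 1ℤ) (- m))
      where
      eq₁ : ∀ c m n → c ≡ c + m * n + (- m) * n
      eq₁ = solve-∀
      eq₂ : ∀ c m n → c + 1ℤ ≡ c + m * n + 1ℤ + (- m) * n
      eq₂ = solve-∀
    d+1 : ∀ m → d + 1ℤ + m * + n ≡ d + m * + n + 1ℤ
    d+1 m = +-swap d 1ℤ (m * + n)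
    same : ¬ (p ≋ c × q ≡ p + 1ℤ) → ¬ (q ≋ c × p ≡ q + 1ℤ) →
           (p <ᵇ q) ≡ (to (σ c) p <ᵇ to (σ c) q) ×
           (to v c <ᵇ to v (c + 1ℤ)) ≡ (to (v · σ d) c <ᵇ to (v · σ d) (c + 1ℤ))
    same ¬up ¬down =
      <ᵇ-cong-⇔ {p} {q} (λ p<q → σ-monotone c p<q ¬up)
        (λ σp<σq → ≮⇒≢⇒> (λ q<p → ℤₚ.<-asym σp<σq (σ-monotone c q<p ¬down)) (p≢q ∘ sym)) ,
      <ᵇ-cong-⇔ {to v c} {to v (c + 1ℤ)} (λ lt → σ-monotone d lt (λ (e , eq) → ¬up (up e eq)))
        (λ σlt → ≮⇒≢⇒> (λ gt → ℤₚ.<-asym σlt (σ-monotone d gt (λ (e , eq) → ¬down (down e eq)))) (vc≢ ∘ sym))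
      where
      neg : ∀ {x y} m → x ≡ y + (- m) * + n → x ≋ y
      neg m eq = - m , eq
      move : ∀ m → c + 1ℤ + (- m) * + n ≡ c + (- m) * + n + 1ℤ
      move m = +-swap c 1ℤ ((- m) * + n)
      up : to v c ≋ d → to v (c + 1ℤ) ≡ to v c + 1ℤ → p ≋ c × q ≡ p + 1ℤ
      up (m , vc≡) vc+1≡ = neg m p≡ , trans q≡ (trans (move m) (cong (_+ 1ℤ) (sym p≡)))
        where
        p≡ : p ≡ c + (- m) * + n
        p≡ = from-via v c {d} (m , vc≡)
        q≡ : q ≡ c + 1ℤ + (- m) * + n
        q≡ = from-via v (c + 1ℤ) {d + 1ℤ} (m , trans vc+1≡ (trans (cong (_+ 1ℤ) vc≡) (sym (d+1 m))))
      down : to v (c + 1ℤ) ≋ d → to v c ≡ to v (c + 1ℤ) + 1ℤ → q ≋ c × p ≡ q + 1ℤ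
      down (m , vc+1≡) vc≡ = neg m q≡ , trans p≡ (trans (move m) (cong (_+ 1ℤ) (sym q≡)))
        where
        p≡ : p ≡ c + 1ℤ + (- m) * + n
        p≡ = from-via v (c + 1ℤ) {d} (m , vc+1≡)
        q≡ : q ≡ c + (- m) * + n
        q≡ = from-via v c {d + 1ℤ} (m , trans vc≡ (trans (cong (_+ 1ℤ) vc+1≡) (sym (d+1 m))))
    cases : ((p <ᵇ q) ≡ (to (σ c) p <ᵇ to (σ c) q) ×
             (to v c <ᵇ to v (c + 1ℤ)) ≡ (to (v · σ d) c <ᵇ to (v · σ d) (c + 1ℤ))) ⊎ _
    cases with (p ≋? c) ×-dec (q ℤₚ.≟ p + 1ℤ) | (q ≋? c) ×-dec (p ℤₚ.≟ q + 1ℤ)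
    ... | yes (p≋c@(m , p≡) , q≡) | _ = inj₂
      ( φ-resp (σ c · v) (v · σ d) (conjugate v c d p≋c (inj₁ (vp≡ , trans (cong (to v) (sym q≡)) vq≡)))
      , inj₁ ( <⇒<ᵇ (subst (p <_) (sym q≡) (a<a+1 p))
             , ≮⇒<ᵇ (ℤₚ.<-asym (subst (λ x → to (σ c) x < to (σ c) p) (sym q≡) (σ-swaps {c} p≋c)))
             , <⇒<ᵇ (subst₂ _<_ (sym vc≡) (sym vc+1≡) (a<a+1 _))
             , ≮⇒<ᵇ (ℤₚ.<-asym (subst₂ (λ x y → to (σ d) y < to (σ d) x) (sym vc≡) (sym vc+1≡)
                        (σ-swaps {d} (- m , refl))))))
      where
      vc≡ : to v c ≡ d + (- m) * + n
      vc≡ = trans (proj₁ (along m p≡)) (cong (_+ (- m) * + n) vp≡)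
      vc+1≡ : to v (c + 1ℤ) ≡ d + (- m) * + n + 1ℤ
      vc+1≡ = trans (proj₂ (along m p≡)) (trans (cong (_+ (- m) * + n) (trans (cong (to v) (sym q≡)) vq≡)) (d+1 (- m)))
    ... | no _ | yes (q≋c@(m , q≡) , p≡) = inj₂
      ( φ-resp (σ c · v) (v · σ d) (conjugate v c d q≋c (inj₂ (vq≡ , trans (cong (to v) (sym p≡)) vp≡)))
      , inj₂ ( ≮⇒<ᵇ (ℤₚ.<-asym (subst (q <_) (sym p≡) (a<a+1 q)))
             , <⇒<ᵇ (subst (λ x → to (σ c) x < to (σ c) q) (sym p≡) (σ-swaps {c} q≋c))
             , ≮⇒<ᵇ (ℤₚ.<-asym (subst₂ _<_ (sym vc+1≡) (sym vc≡) (a<a+1 _)))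
             , <⇒<ᵇ (subst₂ (λ x y → to (σ d) y < to (σ d) x) (sym vc+1≡) (sym vc≡)
                        (σ-swaps {d} (- m , refl)))))
      where
      vc≡ : to v c ≡ d + (- m) * + n + 1ℤ
      vc≡ = trans (proj₁ (along m q≡)) (trans (cong (_+ (- m) * + n) vq≡) (d+1 (- m)))
      vc+1≡ : to v (c + 1ℤ) ≡ d + (- m) * + n
      vc+1≡ = trans (proj₂ (along m q≡)) (cong (_+ (- m) * + n) (trans (cong (to v) (sym p≡)) vp≡))
    ... | no ¬up | no ¬down = inj₁ (same ¬up ¬down)

  σ-shift : ∀ c a → to (σ (c + + k)) (a + + k) ≡ to (σ c) a + + k
  σ-shift c a with σ-cases c a
  ... | inj₁ (p , eq) = trans (σ-at (≋-+ (+ k) p)) (trans (+-swap a (+ k) 1ℤ) (cong (_+ + k) (sym eq)))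
  ... | inj₂ (inj₁ (p , eq)) = trans (σ-next (subst (a + + k ≋_) (+-swap c 1ℤ (+ k)) (≋-+ (+ k) p)))
                                     (trans (+-swap a (+ k) -1ℤ) (cong (_+ + k) (sym eq)))
  ... | inj₂ (inj₂ (¬p , ¬q , eq)) = trans
    (σ-fixed (¬p ∘ ≋-cancel (+ k)) (λ q → ¬q (≋-cancel (+ k) (subst (a + + k ≋_) (+-swap c (+ k) 1ℤ) q))))
    (cong (_+ + k) (sym eq))

  N-∷ʳ : ∀ c w v → N v (w ∷ʳ (c + + k)) ≡ λ′ c (λ u → N u w) v
  N-∷ʳ c [] v = cong₂ ℕ._+_
    (cong (λ b → when b 1) (does-⇔ (mk⇔ left⇒right right⇒left) (v · σ (c + + k) ≐? shift) (σ c · v ≐? shift)))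
    same
    where
    left⇒right : v · σ (c + + k) ≐ shift → σ c · v ≐ shift
    left⇒right eq a = begin
      to v (to (σ c) a)                                     ≡⟨ σσ (c + + k) _ ⟨
      to (σ (c + + k)) (to (σ (c + + k)) (to v (to (σ c) a)))  ≡⟨ cong (to (σ (c + + k))) (eq (to (σ c) a)) ⟩
      to (σ (c + + k)) (to (σ c) a + + k)                   ≡⟨ σ-shift c (to (σ c) a) ⟩
      to (σ c) (to (σ c) a) + + k                           ≡⟨ cong (_+ + k) (σσ c a) ⟩
      a + + k                                               ∎
    right⇒left : σ c · v ≐ shift → v · σ (c + + k) ≐ shift
    right⇒left eq a = begin
      to (σ (c + + k)) (to v a)                       ≡⟨ cong (λ x → to (σ (c + + k)) (to v x)) (σσ c a) ⟨
      to (σ (c + + k)) (to v (to (σ c) (to (σ c) a)))  ≡⟨ cong (to (σ (c + + k))) (eq (to (σ c) a)) ⟩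
      to (σ (c + + k)) (to (σ c) a + + k)             ≡⟨ σ-shift c (to (σ c) a) ⟩
      to (σ c) (to (σ c) a) + + k                     ≡⟨ cong (_+ + k) (σσ c a) ⟩
      a + + k                                         ∎
    -- The elbow terms vanish together unless v is the shift, which is increasing, so that both
    -- brackets equal one.
    same : when (from v (c + + k) <ᵇ from v (c + + k + 1ℤ)) (when (does (v ≐? shift)) 1) ≡
           when (to v c <ᵇ to v (c + 1ℤ)) (when (does (v ≐? shift)) 1)
    same with v ≐? shift
    ... | no _  = trans (when-0 _) (sym (when-0 _))
      where
      when-0 : ∀ b → when b 0 ≡ 0
      when-0 true  = refl
      when-0 false = refl
    ... | yes v≐ = cong (λ b → when b 1) (trans (<⇒<ᵇ from<) (sym (<⇒<ᵇ to<)))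
      where
      fromv : ∀ x → from v (x + + k) ≡ x
      fromv x = trans (cong (from v) (sym (v≐ x))) (from-to v x)
      from< : from v (c + + k) < from v (c + + k + 1ℤ)
      from< = subst₂ _<_ (sym (fromv c)) (trans (sym (fromv (c + 1ℤ))) (cong (from v) (+-swap c 1ℤ (+ k)))) (a<a+1 c)
      to< : to v c < to v (c + 1ℤ)
      to< = subst₂ _<_ (sym (v≐ c)) (sym (trans (v≐ (c + 1ℤ)) (+-swap c 1ℤ (+ k)))) (a<a+1 (c + + k))
  N-∷ʳ c (d ∷ w) v = trans (ρ-cong d (N-∷ʳ c w) v)
    (sym (λρ-commute c d (λ u → N u w) (N-respectful w) v))

  -- Words up to braid moves

  infix 4 _∼_
  -- The relations of the braid monoid, without the quadratic one, which would change `N`. For n = 2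
  -- the two generators satisfy no braid relation, whence the bound in `braid`.
  data _∼_ : List ℤ → List ℤ → Set where
    ∼-refl  : ∀ {w} → w ∼ w
    ∼-sym   : ∀ {w w′} → w ∼ w′ → w′ ∼ w
    ∼-trans : ∀ {w w′ w″} → w ∼ w′ → w′ ∼ w″ → w ∼ w″
    ∼-cons  : ∀ d {w w′} → w ∼ w′ → d ∷ w ∼ d ∷ w′
    cyclic  : ∀ {d e} w → d ≋ e → d ∷ w ∼ e ∷ w
    far     : ∀ {d e} w → ¬ d ≋ e → ¬ d ≋ e + 1ℤ → ¬ e ≋ d + 1ℤ → d ∷ e ∷ w ∼ e ∷ d ∷ w
    braid   : ∀ d w → 2 ℕ.< n → d ∷ d + 1ℤ ∷ d ∷ w ∼ d + 1ℤ ∷ d ∷ d + 1ℤ ∷ w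

  σ-commute : ∀ {d e} → ¬ d ≋ e → ¬ d ≋ e + 1ℤ → ¬ e ≋ d + 1ℤ → ∀ a →
              to (σ d) (to (σ e) a) ≡ to (σ e) (to (σ d) a)
  σ-commute {d} {e} d≋̸e d≋̸e+1 e≋̸d+1 a with σ-cases d a
  ... | inj₁ (p , _) = agree-≋ (σ e · σ d) (σ d · σ e) p (trans (cong (to (σ d)) fixes-d)
    (trans (σ-at ≋-refl) (sym (trans (cong (to (σ e)) (σ-at ≋-refl)) fixes-d+1))))
    where
    fixes-d : to (σ e) d ≡ d
    fixes-d = σ-fixed d≋̸e d≋̸e+1
    fixes-d+1 : to (σ e) (d + 1ℤ) ≡ d + 1ℤ
    fixes-d+1 = σ-fixed (e≋̸d+1 ∘ ≋-sym) (d≋̸e ∘ ≋-cancel 1ℤ)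
  ... | inj₂ (inj₁ (p , _)) = agree-≋ (σ e · σ d) (σ d · σ e) p (trans (cong (to (σ d)) fixes-d+1)
    (trans back (sym (trans (cong (to (σ e)) back) fixes-d))))
    where
    back : to (σ d) (d + 1ℤ) ≡ d
    back = trans (σ-next ≋-refl) (+1-1 d)
    fixes-d : to (σ e) d ≡ d
    fixes-d = σ-fixed d≋̸e d≋̸e+1
    fixes-d+1 : to (σ e) (d + 1ℤ) ≡ d + 1ℤ
    fixes-d+1 = σ-fixed (e≋̸d+1 ∘ ≋-sym) (d≋̸e ∘ ≋-cancel 1ℤ)
  ... | inj₂ (inj₂ (¬p , ¬q , fixed)) = trans (σ-fixed ¬p′ ¬q′) (cong (to (σ e)) (sym fixed))
    where
    back : ∀ {b} → to (σ e) a ≋ b → a ≋ to (σ e) b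
    back r = subst (_≋ _) (σσ e a) (to-≋ (σ e) r)
    ¬p′ : ¬ to (σ e) a ≋ d
    ¬p′ r = ¬p (subst (a ≋_) (σ-fixed d≋̸e d≋̸e+1) (back r))
    ¬q′ : ¬ to (σ e) a ≋ d + 1ℤ
    ¬q′ r = ¬q (subst (a ≋_) (σ-fixed (e≋̸d+1 ∘ ≋-sym) (d≋̸e ∘ ≋-cancel 1ℤ)) (back r))

  ρ-far : ∀ {d e} φ → Respectful φ → ¬ d ≋ e → ¬ d ≋ e + 1ℤ → ¬ e ≋ d + 1ℤ →
          ∀ v → ρ d (ρ e φ) v ≡ ρ e (ρ d φ) v
  ρ-far {d} {e} φ φ-resp d≋̸e d≋̸e+1 e≋̸d+1 v = begin
    (φ (v · σ d · σ e) ℕ.+ when (from (v · σ d) e <ᵇ from (v · σ d) (e + 1ℤ)) (φ (v · σ d))) ℕ.+ y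
      ≡⟨ cong (ℕ._+ y) (cong₂ ℕ._+_
           (φ-resp (v · σ d · σ e) (v · σ e · σ d) (λ a → σ-commute (d≋̸e ∘ ≋-sym) e≋̸d+1 d≋̸e+1 (to v a)))
           (cong (λ b → when b (φ (v · σ d))) (cong₂ _<ᵇ_
             (trans (from-·σ v d e) (cong (from v) (σ-fixed (d≋̸e ∘ ≋-sym) e≋̸d+1)))
             (trans (from-·σ v d (e + 1ℤ)) (cong (from v) (σ-fixed (d≋̸e+1 ∘ ≋-sym) (d≋̸e ∘ ≋-sym ∘ ≋-cancel 1ℤ))))))) ⟩
    x ℕ.+ when q (φ (v · σ d)) ℕ.+ when p (φ (v · σ e) ℕ.+ when q (φ v))
      ≡⟨ interchange x p q (φ (v · σ d)) (φ (v · σ e)) (φ v) ⟩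
    x ℕ.+ when p (φ (v · σ e)) ℕ.+ when q (φ (v · σ d) ℕ.+ when p (φ v))
      ≡⟨ cong (λ b → x ℕ.+ when b (φ (v · σ e)) ℕ.+ when q (φ (v · σ d) ℕ.+ when p (φ v))) (cong₂ _<ᵇ_
             (trans (from-·σ v e d) (cong (from v) (σ-fixed d≋̸e d≋̸e+1)))
             (trans (from-·σ v e (d + 1ℤ)) (cong (from v) (σ-fixed (e≋̸d+1 ∘ ≋-sym) (d≋̸e ∘ ≋-cancel 1ℤ))))) ⟨
    ρ e (ρ d φ) v ∎
    where
    p q : Bool
    p = from v d <ᵇ from v (d + 1ℤ)
    q = from v e <ᵇ from v (e + 1ℤ)
    x y : ℕ
    x = φ (v · σ e · σ d)
    y = when p (φ (v · σ e) ℕ.+ when q (φ v))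
    interchange : ∀ x p q y z w → x ℕ.+ when q y ℕ.+ when p (z ℕ.+ when q w) ≡
                                  x ℕ.+ when p z ℕ.+ when q (y ℕ.+ when p w)
    interchange x p q y z w = +-when-swap x q q p p y z w (inj₁ (refl , refl))

  -- Right multiplication by `σ d` and `σ (d + 1)` permutes these three values when 2 < n, so all
  -- ascents met in a braid relation are comparisons among them.
  record Window (d : ℤ) (v : AffinePerm n) (a b c : ℤ) : Set where
    constructor window
    field
      at₀ : from v d ≡ a
      at₁ : from v (d + 1ℤ) ≡ b
      at₂ : from v (d + 1ℤ + 1ℤ) ≡ c

  module Braid (d : ℤ) (2<n : 2 ℕ.< n) where
    e f : ℤ
    e = d + 1ℤ
    f = e + 1ℤ

    d≋̸f : ¬ d ≋ f
    d≋̸f = ≋-below (ℤₚ.<-trans (a<a+1 d) (a<a+1 e)) (subst (_< d + + n) (eq d) (ℤₚ.+-monoʳ-< d (+<+ 2<n)))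
      where
      eq : ∀ d → d + + 2 ≡ d + 1ℤ + 1ℤ
      eq = solve-∀

    f≋̸d : ¬ f ≋ d
    f≋̸d = d≋̸f ∘ ≋-sym

    σd-d : to (σ d) d ≡ e
    σd-d = σ-at ≋-refl
    σd-e : to (σ d) e ≡ d
    σd-e = trans (σ-next ≋-refl) (+1-1 d)
    σd-f : to (σ d) f ≡ f
    σd-f = σ-fixed f≋̸d (≋-suc e ∘ ≋-sym)
    σe-d : to (σ e) d ≡ d
    σe-d = σ-fixed (≋-suc d) d≋̸f
    σe-e : to (σ e) e ≡ f
    σe-e = σ-at ≋-refl
    σe-f : to (σ e) f ≡ e
    σe-f = trans (σ-next ≋-refl) (+1-1 e)

    move-d : ∀ {v a b c} → Window d v a b c → Window d (v · σ d) b a c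
    move-d {v} (window p q r) = window
      (trans (from-·σ v d d) (trans (cong (from v) σd-d) q))
      (trans (from-·σ v d e) (trans (cong (from v) σd-e) p))
      (trans (from-·σ v d f) (trans (cong (from v) σd-f) r))

    move-e : ∀ {v a b c} → Window d v a b c → Window d (v · σ e) a c b
    move-e {v} (window p q r) = window
      (trans (from-·σ v e d) (trans (cong (from v) σe-d) p))
      (trans (from-·σ v e e) (trans (cong (from v) σe-e) r))
      (trans (from-·σ v e f) (trans (cong (from v) σe-f) q))

    module _ (φ : AffinePerm n → ℕ) where
      ρ-d : ∀ {v a b c} → Window d v a b c → ρ d φ v ≡ φ (v · σ d) ℕ.+ when (a <ᵇ b) (φ v)
      ρ-d (window refl refl refl) = refl

      ρ-e : ∀ {v a b c} → Window d v a b c → ρ e φ v ≡ φ (v · σ e) ℕ.+ when (b <ᵇ c) (φ v)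
      ρ-e (window refl refl refl) = refl

      ρ-de : ∀ {v a b c} → Window d v a b c → ρ d (ρ e φ) v ≡
             φ (v · σ d · σ e) ℕ.+ when (a <ᵇ c) (φ (v · σ d)) ℕ.+
             when (a <ᵇ b) (φ (v · σ e) ℕ.+ when (b <ᵇ c) (φ v))
      ρ-de {v} {a} {b} {c} W@(window refl refl refl) =
        cong (λ x → x ℕ.+ when (a <ᵇ b) (φ (v · σ e) ℕ.+ when (b <ᵇ c) (φ v))) (ρ-e (move-d W))

      ρ-ed : ∀ {v a b c} → Window d v a b c → ρ e (ρ d φ) v ≡
             φ (v · σ e · σ d) ℕ.+ when (a <ᵇ c) (φ (v · σ e)) ℕ.+
             when (b <ᵇ c) (φ (v · σ d) ℕ.+ when (a <ᵇ b) (φ v))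
      ρ-ed {v} {a} {b} {c} W@(window refl refl refl) =
        cong (λ x → x ℕ.+ when (b <ᵇ c) (φ (v · σ d) ℕ.+ when (a <ᵇ b) (φ v))) (ρ-d (move-e W))

    σσσ : ∀ a → to (σ d) (to (σ e) (to (σ d) a)) ≡ to (σ e) (to (σ d) (to (σ e) a))
    σσσ a = by-cases (a ≋? d) (a ≋? e) (a ≋? f)
      where
      ded ede : AffinePerm n
      ded = σ d · σ e · σ d
      ede = σ e · σ d · σ e
      chain : ∀ x y z {p q r t} → to x p ≡ q → to y q ≡ r → to z r ≡ t → to (x · y · z) p ≡ t
      chain x y z refl refl refl = refl
      by-cases : Dec (a ≋ d) → Dec (a ≋ e) → Dec (a ≋ f) → to ded a ≡ to ede a
      by-cases (yes p) _ _ = agree-≋ ded ede p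
        (trans (chain (σ d) (σ e) (σ d) σd-d σe-e σd-f) (sym (chain (σ e) (σ d) (σ e) σe-d σd-d σe-e)))
      by-cases (no _) (yes p) _ = agree-≋ ded ede p
        (trans (chain (σ d) (σ e) (σ d) σd-e σe-d σd-d) (sym (chain (σ e) (σ d) (σ e) σe-e σd-f σe-f)))
      by-cases (no _) (no _) (yes p) = agree-≋ ded ede p
        (trans (chain (σ d) (σ e) (σ d) σd-f σe-f σd-e) (sym (chain (σ e) (σ d) (σ e) σe-f σd-e σe-d)))
      by-cases (no ¬d) (no ¬e) (no ¬f) =
        trans (chain (σ d) (σ e) (σ d) (σ-fixed ¬d ¬e) (σ-fixed ¬e ¬f) (σ-fixed ¬d ¬e))
          (sym (chain (σ e) (σ d) (σ e) (σ-fixed ¬e ¬f) (σ-fixed ¬d ¬e) (σ-fixed ¬e ¬f)))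

    -- p, q and r say whether a < b, b < c and a < c.
    rank-two : ∀ p q r (x₀ x₁ x₂ x₃ x₄ x₅ : ℕ) → ¬ (p ≡ q × r ≡ not p) →
      x₀ ℕ.+ when q x₁ ℕ.+ when r (x₅ ℕ.+ when (not p) x₃) ℕ.+
        when p (x₂ ℕ.+ when r x₄ ℕ.+ when q (x₃ ℕ.+ when p x₅)) ≡
      x₀ ℕ.+ when p x₂ ℕ.+ when r (x₅ ℕ.+ when (not q) x₄) ℕ.+
        when q (x₁ ℕ.+ when r x₃ ℕ.+ when p (x₄ ℕ.+ when q x₅))
    rank-two true  true  true  x₀ x₁ x₂ x₃ x₄ x₅ _ = eq x₀ x₁ x₂ x₃ x₄ x₅
      where
      eq : ∀ x₀ x₁ x₂ x₃ x₄ x₅ → x₀ ℕ.+ x₁ ℕ.+ (x₅ ℕ.+ 0) ℕ.+ (x₂ ℕ.+ x₄ ℕ.+ (x₃ ℕ.+ x₅)) ≡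
                                 x₀ ℕ.+ x₂ ℕ.+ (x₅ ℕ.+ 0) ℕ.+ (x₁ ℕ.+ x₃ ℕ.+ (x₄ ℕ.+ x₅))
      eq = ℕ-Solver.solve-∀
    rank-two true  true  false x₀ x₁ x₂ x₃ x₄ x₅ c = contradiction (refl , refl) c
    rank-two true  false true  x₀ x₁ x₂ x₃ x₄ x₅ _ = eq x₀ x₂ x₄ x₅
      where
      eq : ∀ x₀ x₂ x₄ x₅ → x₀ ℕ.+ 0 ℕ.+ (x₅ ℕ.+ 0) ℕ.+ (x₂ ℕ.+ x₄ ℕ.+ 0) ≡ x₀ ℕ.+ x₂ ℕ.+ (x₅ ℕ.+ x₄) ℕ.+ 0
      eq = ℕ-Solver.solve-∀
    rank-two true  false false x₀ x₁ x₂ x₃ x₄ x₅ _ = eq x₀ x₂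
      where
      eq : ∀ x₀ x₂ → x₀ ℕ.+ 0 ℕ.+ 0 ℕ.+ (x₂ ℕ.+ 0 ℕ.+ 0) ≡ x₀ ℕ.+ x₂ ℕ.+ 0 ℕ.+ 0
      eq = ℕ-Solver.solve-∀
    rank-two false true  true  x₀ x₁ x₂ x₃ x₄ x₅ _ = eq x₀ x₁ x₃ x₅
      where
      eq : ∀ x₀ x₁ x₃ x₅ → x₀ ℕ.+ x₁ ℕ.+ (x₅ ℕ.+ x₃) ℕ.+ 0 ≡ x₀ ℕ.+ 0 ℕ.+ (x₅ ℕ.+ 0) ℕ.+ (x₁ ℕ.+ x₃ ℕ.+ 0)
      eq = ℕ-Solver.solve-∀
    rank-two false true  false x₀ x₁ x₂ x₃ x₄ x₅ _ = eq x₀ x₁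
      where
      eq : ∀ x₀ x₁ → x₀ ℕ.+ x₁ ℕ.+ 0 ℕ.+ 0 ≡ x₀ ℕ.+ 0 ℕ.+ 0 ℕ.+ (x₁ ℕ.+ 0 ℕ.+ 0)
      eq = ℕ-Solver.solve-∀
    rank-two false false true  x₀ x₁ x₂ x₃ x₄ x₅ c = contradiction (refl , refl) c
    rank-two false false false x₀ x₁ x₂ x₃ x₄ x₅ _ = refl

    -- Excludes the two patterns that no linear order realises; they are the ones on which the
    -- identity of `rank-two` breaks down.
    transitive : ∀ {a b c} → a ≢ b → b ≢ c → a ≢ c → ¬ ((a <ᵇ b) ≡ (b <ᵇ c) × (a <ᵇ c) ≡ not (a <ᵇ b))
    transitive {a} {b} {c} a≢b b≢c a≢c with a ℤₚ.<? b | b ℤₚ.<? c | a ℤₚ.<? c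
    ... | yes p | yes q | yes r = λ ()
    ... | yes p | yes q | no ¬r = λ _ → ¬r (ℤₚ.<-trans p q)
    ... | yes p | no ¬q | _     = λ ()
    ... | no ¬p | yes q | _     = λ ()
    ... | no ¬p | no ¬q | yes r = λ _ → ℤₚ.<-asym r (ℤₚ.<-trans (≮⇒≢⇒> ¬q b≢c) (≮⇒≢⇒> ¬p a≢b))
    ... | no ¬p | no ¬q | no ¬r = λ ()

    -- Both sides expand into the six values of `φ` on the coset of v under the parabolic subgroup
    -- of rank two. The coefficients depend only on the relative order of `a`, `b`, `c`.
    ρ-braid : ∀ φ → Respectful φ → ∀ v → ρ d (ρ e (ρ d φ)) v ≡ ρ e (ρ d (ρ e φ)) v
    ρ-braid φ φ-resp v = begin
      ρ e (ρ d φ) (v · σ d) ℕ.+ when (a <ᵇ b) (ρ e (ρ d φ) v)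
        ≡⟨ cong₂ (λ x y → x ℕ.+ when (a <ᵇ b) y) (ρ-ed φ (move-d W)) (ρ-ed φ W) ⟩
      φ (v · σ d · σ e · σ d) ℕ.+ when (b <ᵇ c) (φ (v · σ d · σ e)) ℕ.+
        when (a <ᵇ c) (φ (v · σ d · σ d) ℕ.+ when (b <ᵇ a) (φ (v · σ d))) ℕ.+
        when (a <ᵇ b) (φ (v · σ e · σ d) ℕ.+ when (a <ᵇ c) (φ (v · σ e)) ℕ.+
                       when (b <ᵇ c) (φ (v · σ d) ℕ.+ when (a <ᵇ b) (φ v)))
        ≡⟨ cong (λ z → z ℕ.+ when (a <ᵇ b) (x₂ ℕ.+ when (a <ᵇ c) x₄ ℕ.+ when (b <ᵇ c) (x₃ ℕ.+ when (a <ᵇ b) x₅)))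
             (cong₂ (λ x y → x ℕ.+ when (b <ᵇ c) (φ (v · σ d · σ e)) ℕ.+ when (a <ᵇ c) y)
             (φ-resp (v · σ d · σ e · σ d) (v · σ e · σ d · σ e) (λ x → σσσ (to v x)))
             (cong₂ (λ x y → x ℕ.+ when y (φ (v · σ d)))
               (φ-resp (v · σ d · σ d) v (λ x → σσ d (to v x))) (<ᵇ-flip (distinct d e (a<a+1 d))))) ⟩
      x₀ ℕ.+ when (b <ᵇ c) x₁ ℕ.+ when (a <ᵇ c) (x₅ ℕ.+ when (not (a <ᵇ b)) x₃) ℕ.+
        when (a <ᵇ b) (x₂ ℕ.+ when (a <ᵇ c) x₄ ℕ.+ when (b <ᵇ c) (x₃ ℕ.+ when (a <ᵇ b) x₅))
        ≡⟨ rank-two (a <ᵇ b) (b <ᵇ c) (a <ᵇ c) x₀ x₁ x₂ x₃ x₄ x₅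
             (transitive (distinct d e (a<a+1 d)) (distinct e f (a<a+1 e))
               (distinct d f (ℤₚ.<-trans (a<a+1 d) (a<a+1 e)))) ⟩
      x₀ ℕ.+ when (a <ᵇ b) x₂ ℕ.+ when (a <ᵇ c) (x₅ ℕ.+ when (not (b <ᵇ c)) x₄) ℕ.+
        when (b <ᵇ c) (x₁ ℕ.+ when (a <ᵇ c) x₃ ℕ.+ when (a <ᵇ b) (x₄ ℕ.+ when (b <ᵇ c) x₅))
        ≡⟨ cong (λ y → x₀ ℕ.+ when (a <ᵇ b) x₂ ℕ.+ when (a <ᵇ c) y ℕ.+
             when (b <ᵇ c) (x₁ ℕ.+ when (a <ᵇ c) x₃ ℕ.+ when (a <ᵇ b) (x₄ ℕ.+ when (b <ᵇ c) x₅)))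
             (cong₂ (λ x y → x ℕ.+ when y (φ (v · σ e)))
               (φ-resp (v · σ e · σ e) v (λ x → σσ e (to v x))) (<ᵇ-flip (distinct e f (a<a+1 e)))) ⟨
      φ (v · σ e · σ d · σ e) ℕ.+ when (a <ᵇ b) (φ (v · σ e · σ d)) ℕ.+
        when (a <ᵇ c) (φ (v · σ e · σ e) ℕ.+ when (c <ᵇ b) (φ (v · σ e))) ℕ.+
        when (b <ᵇ c) (φ (v · σ d · σ e) ℕ.+ when (a <ᵇ c) (φ (v · σ d)) ℕ.+
                       when (a <ᵇ b) (φ (v · σ e) ℕ.+ when (b <ᵇ c) (φ v)))
        ≡⟨ cong₂ (λ x y → x ℕ.+ when (b <ᵇ c) y) (ρ-de φ (move-e W)) (ρ-de φ W) ⟨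
      ρ e (ρ d (ρ e φ)) v ∎
      where
      a b c : ℤ
      a = from v d
      b = from v e
      c = from v f
      W : Window d v a b c
      W = window refl refl refl
      x₀ x₁ x₂ x₃ x₄ x₅ : ℕ
      x₀ = φ (v · σ e · σ d · σ e)
      x₁ = φ (v · σ d · σ e)
      x₂ = φ (v · σ e · σ d)
      x₃ = φ (v · σ d)
      x₄ = φ (v · σ e)
      x₅ = φ v
      distinct : ∀ x y → x < y → from v x ≢ from v y
      distinct x y x<y eq = ℤₚ.<-irrefl (to-injective (v ⁻¹) eq) x<y

  N-∼ : ∀ {w w′} → w ∼ w′ → ∀ v → N v w ≡ N v w′
  N-∼ ∼-refl          v = refl
  N-∼ (∼-sym p)       v = sym (N-∼ p v)
  N-∼ (∼-trans p q)   v = trans (N-∼ p v) (N-∼ q v)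
  N-∼ (∼-cons d p)    v = ρ-cong d (N-∼ p) v
  N-∼ (cyclic {d} {e} w d≋e@(q , refl)) v = cong₂ ℕ._+_ (cong (λ x → N (v · x) w) (σ-cong d≋e))
    (cong (λ b → when b (N v w)) (<ᵇ-cong-⇔
      (λ lt → subst₂ _<_ (eq₁ (from v e) q (+ n)) (eq₁ (from v (e + 1ℤ)) q (+ n))
                (ℤₚ.+-monoˡ-< (- (q * + n)) (subst₂ _<_ (from-shift v e q) fe+1 lt)))
      (λ lt → subst₂ _<_ (sym (from-shift v e q)) (sym fe+1) (ℤₚ.+-monoˡ-< (q * + n) lt))))
    where
    eq₁ : ∀ x q m → x + q * m + - (q * m) ≡ x
    eq₁ = solve-∀
    fe+1 : from v (e + q * + n + 1ℤ) ≡ from v (e + 1ℤ) + q * + n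
    fe+1 = trans (cong (from v) (+-swap e (q * + n) 1ℤ)) (from-shift v (e + 1ℤ) q)
  N-∼ (far {d} {e} w p q r) v = ρ-far (λ u → N u w) (N-respectful w) p q r v
  N-∼ (braid d w 2<n)       v = Braid.ρ-braid d 2<n (λ u → N u w) (N-respectful w) v

  -- Pushing a letter through a word

  ∼-++ : ∀ u {w w′} → w ∼ w′ → u ++ w ∼ u ++ w′
  ∼-++ []      p = p
  ∼-++ (d ∷ u) p = ∼-cons d (∼-++ u p)

  ∼-reflexive : ∀ {w w′} → w ≡ w′ → w ∼ w′
  ∼-reflexive refl = ∼-refl

  -- An automorphism of the cyclic Dynkin diagram. It exchanges the two letters of a braid relation,
  -- which is therefore read backwards.
  ∼-neg : ∀ {w w′} → w ∼ w′ → map -_ w ∼ map -_ w′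
  ∼-neg ∼-refl         = ∼-refl
  ∼-neg (∼-sym p)      = ∼-sym (∼-neg p)
  ∼-neg (∼-trans p q)  = ∼-trans (∼-neg p) (∼-neg q)
  ∼-neg (∼-cons d p)   = ∼-cons (- d) (∼-neg p)
  ∼-neg (cyclic w p)   = cyclic (map -_ w) (≋-neg p)
  ∼-neg (far {d} {e} w p q r) = far (map -_ w) (p ∘ unneg)
    (λ eq → r (≋-sym (unneg (subst (_≋ - e) (sym (neg-suc d)) (flip-side eq)))))
    (λ eq → q (≋-sym (unneg (subst (_≋ - d) (sym (neg-suc e)) (flip-side eq)))))
    where
    unneg : ∀ {a b} → - a ≋ - b → a ≋ b
    unneg {a} {b} p = subst₂ _≋_ (ℤₚ.neg-involutive a) (ℤₚ.neg-involutive b) (≋-neg p)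
    neg-suc : ∀ a → - (a + 1ℤ) ≡ - a - 1ℤ
    neg-suc = solve-∀
    flip-side : ∀ {a b} → a ≋ b + 1ℤ → a - 1ℤ ≋ b
    flip-side {a} p = ≋-cancel 1ℤ (subst (_≋ _) (sym (-1+1 a)) p)
  ∼-neg (braid d w 2<n) = subst (λ x → x ∷ d′ ∷ x ∷ map -_ w ∼ d′ ∷ x ∷ d′ ∷ map -_ w) (eq d)
    (∼-sym (braid d′ (map -_ w) 2<n))
    where
    d′ : ℤ
    d′ = - (d + 1ℤ)
    eq : ∀ d → - (d + 1ℤ) + 1ℤ ≡ - d
    eq = solve-∀

  Far : ℤ → ℤ → Set
  Far p j = ¬ j ≋ p × ¬ j ≋ p + 1ℤ × ¬ p ≋ j + 1ℤ

  ups-past : ∀ {p} c m w → (∀ i → i ℕ.< m → Far p (c + + i)) → ups c m ++ p ∷ w ∼ p ∷ ups c m ++ w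
  ups-past c zero    w far-p = ∼-refl
  ups-past {p} c (suc m) w far-p = ∼-trans
    (∼-cons c (ups-past (c + 1ℤ) m w (λ i i<m → subst (Far p) (sym (+-suc-assoc c i)) (far-p (suc i) (ℕ.s≤s i<m)))))
    (swap (subst (Far p) (ℤₚ.+-identityʳ c) (far-p 0 ℕ.z<s)))
    where
    swap : Far p c → c ∷ p ∷ ups (c + 1ℤ) m ++ w ∼ p ∷ c ∷ ups (c + 1ℤ) m ++ w
    swap (q , r , s) = far _ q r s

  -- The images of descents under `complement` and `reverse`: both replace lowered heights by raised
  -- values.
  data Ascent (start : ℤ → ℤ) : List ℤ → (ℤ → ℤ) → Set where
    stop : ∀ {H} → (∀ j → H j ≡ start j) → Ascent start [] H
    flip : ∀ {w G H} d → Ascent start w G → G d ≡ G (d - 1ℤ) → G (d + 1ℤ) ≡ G d + 1ℤ →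
           Lowered d H G → Ascent start (d ∷ w) H

  raised : ∀ {d G H} → Lowered d H G → ∀ j → H j ≡ raise d G j
  raised {d} {G} {H} L j with j ≋? d
  ... | yes p = trans (sym (-1+1 (H j))) (cong (_+ 1ℤ) (sym (at L p)))
  ... | no ¬p = sym (off L ¬p)

  ascent-profile : ∀ {κ start w H} → Profile κ start → Ascent start w H → Profile κ H
  ascent-profile S (stop H≗S)           = profile-≗ H≗S S
  ascent-profile S (flip d A flat up L) = profile-≗ (raised L) (raise-profile (ascent-profile S A) flat up)

  module _ {κ S} (Sᵖ : Profile κ S) (2≤κ : + 2 ≤ κ) {a x : ℤ}
           (Sa-1 : S (a - 1ℤ) ≡ x) (Sa : S a ≡ x + 1ℤ) (Sa+1 : S (a + 1ℤ) ≡ x + 1ℤ + 1ℤ) where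

    -- The path enters column x + 1 at position d - 1 and column x + 2 at position d + m: the two tracked
    -- R steps have m U steps in between.
    record State (H : ℤ → ℤ) (d : ℤ) (m : ℕ) : Set where
      field
        before : H (d - 1ℤ) ≡ x
        first  : H d ≡ x + 1ℤ
        last   : H (d + + m) ≡ x + 1ℤ
        after  : H (d + + suc m) ≡ x + 1ℤ + 1ℤ

    open State

    module _ {H} (Hᵖ : Profile κ H) {d m} (st : State H d m) where
      -- As κ ≥ 2, the translate of the first tracked step by one period comes after the second
      -- tracked step. Hence the positions d to d + m + 1 are distinct modulo n.
      width : suc m ℕ.< n
      width = ℤₚ.drop‿+<+ (<-resp-difference (reflects-< Hᵖ (subst₂ _<_ (sym (last st))
        (sym (trans (slope Hᵖ (d - 1ℤ)) (cong (_+ κ) (before st)))) (ℤₚ.+-monoʳ-< x (ℤₚ.<-≤-trans (+<+ (ℕ.s≤s (ℕ.s≤s ℕ.z≤n))) 2≤κ))))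
        (eq d (+ n) (+ m)))
        where
        eq : ∀ d n m → d - 1ℤ + n - (d + m) ≡ n - (1ℤ + m)
        eq = solve-∀

      plateau : ∀ i → i ℕ.≤ m → H (d + + i) ≡ x + 1ℤ
      plateau i i≤m = ℤₚ.≤-antisym
        (subst (H (d + + i) ≤_) (last st) (monotone Hᵖ (ℤₚ.+-monoʳ-≤ d (+≤+ i≤m))))
        (subst (_≤ H (d + + i)) (first st) (monotone Hᵖ (subst (_≤ d + + i) (ℤₚ.+-identityʳ d) (ℤₚ.+-monoʳ-≤ d (+≤+ ℕ.z≤n)))))

    ≋̸-offset : ∀ d i → 0 ℕ.< i → i ℕ.< n → ¬ d ≋ d + + i
    ≋̸-offset d i 0<i i<n = ≋-below (subst (_< d + + i) (ℤₚ.+-identityʳ d) (ℤₚ.+-monoʳ-< d (+<+ 0<i)))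
      (ℤₚ.+-monoʳ-< d (+<+ i<n))

    ≋̸-offsets : ∀ d {i j} → i ℕ.< j → j ℕ.< n → ¬ d + + i ≋ d + + j
    ≋̸-offsets d {i} {j} i<j j<n = ≋-below (ℤₚ.+-monoʳ-< d (+<+ i<j))
      (subst (d + + j <_) (sym (ℤₚ.+-assoc d (+ i) (+ n))) (ℤₚ.+-monoʳ-< d (+<+ (ℕₚ.<-≤-trans j<n (ℕₚ.m≤n+m n i)))))

    -- The levels x and x + 1 are left at determined vertices, and on the starting path the two
    -- tracked steps are adjacent.
    base : ∀ {H} → (∀ j → H j ≡ S j) → ∀ d m → State H d m → d ≡ a × m ≡ 0
    base {H} H≗S d m st = d≡a , m≡0 m refl
      where
      Hᵖ : Profile κ H
      Hᵖ = profile-≗ H≗S Sᵖ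
      Ha-1 : H (a - 1ℤ) ≡ x
      Ha-1 = trans (H≗S _) Sa-1
      Ha : H a ≡ x + 1ℤ
      Ha = trans (H≗S _) Sa
      predecessor : ∀ {u v} → u - 1ℤ < v → u ≤ v
      predecessor {u} {v} lt = subst (_≤ v) (-1+1 u) (<⇒+1≤ lt)
      d≡a : d ≡ a
      d≡a = ℤₚ.≤-antisym
        (predecessor (reflects-< Hᵖ (subst₂ _<_ (sym (before st)) (sym Ha) (a<a+1 x))))
        (predecessor (reflects-< Hᵖ (subst₂ _<_ (sym Ha-1) (sym (first st)) (a<a+1 x))))
      m≡0 : ∀ m′ → m ≡ m′ → m ≡ 0
      m≡0 zero     eq   = eq
      m≡0 (suc m′) refl = contradiction (trans (sym (plateau Hᵖ st 1 (ℕ.s≤s ℕ.z≤n)))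
        (trans (cong (λ y → H (y + 1ℤ)) d≡a) (trans (H≗S _) Sa+1))) a≢a+1

    -- In the group this says t w = w a, where t transposes the positions d and d + m + 1 of the two
    -- tracked steps. As t is the conjugate of the generator at d by the run d + 1, ..., d + m,
    -- multiplying by the run removes the inverse and leaves an identity of positive words.
    track : ∀ {w H} → Ascent S w H → ∀ d m → State H d m →
            ups d (suc m) ++ w ∼ ups (d + 1ℤ) m ++ (w ∷ʳ a)
    track (stop H≗S) d m st with base H≗S d m st
    ... | refl , refl = ∼-refl
    track {p ∷ w} {H} (flip {G = G} p A flat up L) d m st = by-cases (d ≋? p) (d + + suc m ≋? p)
      where
      Gᵖ : Profile κ G
      Gᵖ = ascent-profile Sᵖ A

      Hᵖ : Profile κ H
      Hᵖ = profile-≗ (raised L) (raise-profile Gᵖ flat up)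

      H-at : ∀ {j} → j ≋ p → H j ≡ G j + 1ℤ
      H-at {j} j≋p = trans (sym (-1+1 (H j))) (cong (_+ 1ℤ) (sym (at L j≋p)))

      G-flat : ∀ {j} → j ≋ p → G j ≡ G (j - 1ℤ)
      G-flat j≋p = flat-≋ Gᵖ (≋-sym j≋p) flat

      G-up : ∀ {j} → j ≋ p → G (j + 1ℤ) ≡ G j + 1ℤ
      G-up j≋p = next-up-≋ Gᵖ (≋-sym j≋p) up

      pred-off : ∀ {j} → j ≋ p → ¬ j - 1ℤ ≋ p
      pred-off j≋p q = pred≋̸ (≋-trans q (≋-sym j≋p))

      suc-off : ∀ {j} → j ≋ p → ¬ j + 1ℤ ≋ p
      suc-off j≋p q = suc≋̸ (≋-trans q (≋-sym j≋p))

      climbs : ∀ {j} → j ≋ p → H j ≡ H (j - 1ℤ) + 1ℤ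
      climbs j≋p = trans (H-at j≋p) (cong (_+ 1ℤ) (trans (G-flat j≋p) (off L (pred-off j≋p))))

      level : ∀ {j} → j ≋ p → H (j + 1ℤ) ≡ H j
      level j≋p = trans (sym (off L (suc-off j≋p))) (trans (G-up j≋p) (sym (H-at j≋p)))

      d-1≋̸p : ¬ d - 1ℤ ≋ p
      d-1≋̸p q = a≢a+1 (trans (sym (before st)) (trans (sym (level q)) (trans (cong H (-1+1 d)) (first st))))

      drop-1 : ∀ {y z} → y ≡ z + 1ℤ → ∀ {u} → u ≡ y - 1ℤ → u ≡ z
      drop-1 {z = z} refl eq = trans eq (+1-1 z)

      below : ∀ {j z} → j ≋ p → H j ≡ z + 1ℤ → G j ≡ z
      below j≋p eq = drop-1 eq (at L j≋p)

      -- Before the flip the first tracked step was at d + 1. The new letter d commutes with the run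
      -- down to d + 1; a braid move then brings d + 1 and d to the front of a run that begins at d
      -- + 1, to which the smaller state applies.
      first-moved : d ≋ p → ∀ m′ → m ≡ m′ → ups d (suc m) ++ p ∷ w ∼ ups (d + 1ℤ) m ++ p ∷ (w ∷ʳ a)
      first-moved d≋p zero refl = contradiction
        (trans (sym (trans (level d≋p) (first st))) (after st)) a≢a+1
      first-moved d≋p (suc m′) refl = ∼-trans
        (∼-++ (ups d (suc m)) (cyclic w (≋-sym d≋p))) (∼-trans
        (∼-cons d (∼-cons (d + 1ℤ) (ups-past (d + 1ℤ + 1ℤ) m′ w far-d))) (∼-trans
        (braid d _ 2<n) (∼-trans
        (∼-cons (d + 1ℤ) (∼-cons d (track A (d + 1ℤ) m′ st′))) (∼-trans
        (∼-cons (d + 1ℤ) (∼-sym (ups-past (d + 1ℤ + 1ℤ) m′ (w ∷ʳ a) far-d)))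
        (∼-++ (ups (d + 1ℤ) m) (cyclic (w ∷ʳ a) d≋p))))))
        where
        wide : suc (suc m′) ℕ.< n
        wide = width Hᵖ st
        2<n : 2 ℕ.< n
        2<n = ℕₚ.≤-<-trans (ℕ.s≤s (ℕ.s≤s ℕ.z≤n)) wide
        move : ∀ i → d + + suc (suc i) ≡ d + 1ℤ + 1ℤ + + i
        move i = eq d (+ i)
          where
          eq : ∀ d i → d + (1ℤ + (1ℤ + i)) ≡ d + 1ℤ + 1ℤ + i
          eq = solve-∀
        far-d : ∀ i → i ℕ.< m′ → Far d (d + 1ℤ + 1ℤ + + i)
        far-d i i<m′ =
          (λ q → ≋̸-offset d (2 ℕ.+ i) ℕ.z<s 2+i<n (≋-sym (subst (_≋ d) (sym (move i)) q))) ,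
          (λ q → ≋̸-offsets d {1} {2 ℕ.+ i} (ℕ.s≤s (ℕ.s≤s ℕ.z≤n)) 2+i<n (≋-sym (subst (_≋ d + 1ℤ) (sym (move i)) q))) ,
          (λ q → ≋̸-offset d (3 ℕ.+ i) ℕ.z<s 3+i<n (subst (d ≋_) (trans (cong (_+ 1ℤ) (sym (move i))) (+-suc d (2 ℕ.+ i))) q))
          where
          3+i<n : 3 ℕ.+ i ℕ.< n
          3+i<n = ℕₚ.≤-<-trans (ℕ.s≤s (ℕ.s≤s i<m′)) wide
          2+i<n : 2 ℕ.+ i ℕ.< n
          2+i<n = ℕₚ.<-trans (ℕₚ.n<1+n _) 3+i<n
        Gd : G d ≡ x
        Gd = below d≋p (first st)
        apart : ∀ i → 0 ℕ.< i → i ℕ.< n → ¬ d + + i ≋ p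
        apart i 0<i i<n q = ≋̸-offset d i 0<i i<n (≋-trans d≋p (≋-sym q))
        st′ : State G (d + 1ℤ) m′
        st′ = record
          { before = trans (cong G (+1-1 d)) Gd
          ; first  = trans (G-up d≋p) (cong (_+ 1ℤ) Gd)
          ; last   = trans (cong G (+-suc-assoc d m′))
                       (trans (off L (apart (suc m′) ℕ.z<s (ℕₚ.<-trans (ℕₚ.n<1+n _) wide))) (last st))
          ; after  = trans (cong G (+-suc-assoc d (suc m′))) (trans (off L (apart (suc (suc m′)) ℕ.z<s wide)) (after st))
          }

      -- Before the flip the second tracked step was one position further. The letter continues the
      -- run d, ..., d + m and is absorbed into it.
      second-moved : ¬ d ≋ p → d + + suc m ≋ p → ups d (suc m) ++ p ∷ w ∼ ups (d + 1ℤ) m ++ p ∷ (w ∷ʳ a)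
      second-moved d≋̸p e≋p = ∼-trans
        (∼-++ (ups d (suc m)) (cyclic w (≋-sym e≋p))) (∼-trans
        (∼-reflexive (sym (ups-∷ d (suc m) w refl))) (∼-trans
        (track A d (suc m) st′) (∼-trans
        (∼-reflexive (ups-∷ (d + 1ℤ) m (w ∷ʳ a) (+-suc-assoc d m)))
        (∼-++ (ups (d + 1ℤ) m) (cyclic (w ∷ʳ a) e≋p)))))
        where
        Ge : G (d + + suc m) ≡ x + 1ℤ
        Ge = below e≋p (after st)
        st′ : State G d (suc m)
        st′ = record
          { before = trans (off L d-1≋̸p) (before st)
          ; first  = trans (off L d≋̸p) (first st)
          ; last   = Ge
          ; after  = trans (cong G (sym (+-suc d (suc m)))) (trans (G-up e≋p) (cong (_+ 1ℤ) Ge))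
          }

      -- After its flip the path rises into p and is level behind p. This excludes the vertex d - 1
      -- and the plateau after d; with the two hypotheses, p commutes with every letter of the run.
      neither-moved : ¬ d ≋ p → ¬ d + + suc m ≋ p → ups d (suc m) ++ p ∷ w ∼ ups (d + 1ℤ) m ++ p ∷ (w ∷ʳ a)
      neither-moved d≋̸p e≋̸p = ∼-trans
        (ups-past d (suc m) w far-p) (∼-trans
        (∼-cons p (track A d m st′))
        (∼-sym (ups-past (d + 1ℤ) m (w ∷ʳ a)
          (λ i i<m → subst (Far p) (sym (+-suc-assoc d i)) (far-p (suc i) (ℕ.s≤s i<m))))))
        where
        between : ∀ i → i ℕ.≤ m → ¬ d + + i ≋ p
        between zero    _   q = d≋̸p (subst (_≋ p) (ℤₚ.+-identityʳ d) q)
        between (suc i) i<m q = a≢a+1 (trans (sym (plateau Hᵖ st (suc i) i<m))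
          (trans (climbs q) (cong (_+ 1ℤ) (trans (cong H back) (plateau Hᵖ st i (ℕₚ.<⇒≤ i<m))))))
          where
          back : d + + suc i - 1ℤ ≡ d + + i
          back = trans (cong (_- 1ℤ) (sym (+-suc d i))) (+1-1 (d + + i))
        upto : ∀ i → i ℕ.≤ suc m → ¬ d + + i ≋ p
        upto i i≤ with ℕₚ.m≤n⇒m<n∨m≡n i≤
        ... | inj₁ (ℕ.s≤s i≤m) = between i i≤m
        ... | inj₂ refl        = e≋̸p
        far-p : ∀ i → i ℕ.< suc m → Far p (d + + i)
        far-p i (ℕ.s≤s i≤m) = between i i≤m , previous i i≤m ,
          (λ q → upto (suc i) (ℕ.s≤s i≤m) (≋-sym (subst (p ≋_) (+-suc d i) q)))
          where
          previous : ∀ i → i ℕ.≤ m → ¬ d + + i ≋ p + 1ℤ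
          previous zero    _   q = d-1≋̸p (≋-cancel 1ℤ (subst (_≋ p + 1ℤ) (trans (ℤₚ.+-identityʳ d) (sym (-1+1 d))) q))
          previous (suc i) i<m q = between i (ℕₚ.<⇒≤ i<m) (≋-cancel 1ℤ (subst (_≋ p + 1ℤ) (sym (+-suc d i)) q))
        st′ : State G d m
        st′ = record
          { before = trans (off L d-1≋̸p) (before st)
          ; first  = trans (off L d≋̸p) (first st)
          ; last   = trans (off L (between m ℕₚ.≤-refl)) (last st)
          ; after  = trans (off L e≋̸p) (after st)
          }

      by-cases : Dec (d ≋ p) → Dec (d + + suc m ≋ p) → ups d (suc m) ++ p ∷ w ∼ ups (d + 1ℤ) m ++ p ∷ (w ∷ʳ a)
      by-cases (yes d≋p) _         = first-moved d≋p m refl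
      by-cases (no d≋̸p) (yes e≋p) = second-moved d≋̸p e≋p
      by-cases (no d≋̸p) (no e≋̸p)  = neither-moved d≋̸p e≋̸p

  slope≥2 : ∀ {κ H} → Profile κ H → ∀ d → H d ≡ H (d - 1ℤ) + 1ℤ → H (d + 1ℤ) ≡ H d + 1ℤ → + 2 ≤ κ
  slope≥2 {κ} {H} Hᵖ d up up′ = ≤-resp-difference (monotone Hᵖ {d + 1ℤ} {d - 1ℤ + + n}
      (≤-resp-difference (<⇒+1≤ 1<n) (eq₁ d (+ n))))
    (trans (cong₂ _-_ (slope Hᵖ (d - 1ℤ)) (trans up′ (cong (_+ 1ℤ) up))) (eq₂ (H (d - 1ℤ)) κ))
    where
    eq₁ : ∀ d n → n - (1ℤ + 1ℤ) ≡ d - 1ℤ + n - (d + 1ℤ)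
    eq₁ = solve-∀
    eq₂ : ∀ h κ → h + κ - (h + 1ℤ + 1ℤ) ≡ κ - + 2
    eq₂ = solve-∀

  -- A pair of adjacent columns passes through the strip unchanged, and so does a letter which swaps its steps.
  conveyor : ∀ {κ S w H} → Profile κ S → Ascent S w H → ∀ {a d} →
             S a ≡ S (a - 1ℤ) + 1ℤ → S (a + 1ℤ) ≡ S a + 1ℤ →
             H d ≡ H (d - 1ℤ) + 1ℤ → H (d + 1ℤ) ≡ H d + 1ℤ → H d ≡ S a → d ∷ w ∼ w ∷ʳ a
  conveyor {S = S} {H = H} Sᵖ A {a} {d} Sa Sa+1 Hd Hd+1 Hd≡Sa =
    track Sᵖ (slope≥2 Sᵖ a Sa Sa+1) {a} {S (a - 1ℤ)} refl Sa (trans Sa+1 (cong (_+ 1ℤ) Sa)) A d 0 (record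
      { before = +-cancelʳ 1ℤ (trans (sym Hd) Hd≡)
      ; first  = Hd≡
      ; last   = trans (cong H (ℤₚ.+-identityʳ d)) Hd≡
      ; after  = trans Hd+1 (cong (_+ 1ℤ) Hd≡)
      })
    where
    Hd≡ : H d ≡ S (a - 1ℤ) + 1ℤ
    Hd≡ = trans Hd≡Sa Sa

  -- A flip leaves x + y alone, so the lowered height becomes a raised abscissa at the same position
  -- and the word is unchanged.
  complement-ascent : ∀ {top w h} → Descent top w h → Ascent (λ j → j - top j) w (λ j → j - h j)
  complement-ascent (stop h≗top) = stop (λ j → cong (λ x → j - x) (h≗top j))
  complement-ascent (flip {g = g} {h} d D up flat L) = flip d (complement-ascent D)
    (trans (cong (λ x → d - x) up) (eq₁ d (g (d - 1ℤ))))
    (trans (cong (λ x → d + 1ℤ - x) flat) (+-swap d 1ℤ (- (g d))))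
    (record { at  = λ {j} p → trans (eq₃ j (g j)) (cong (λ x → j - x - 1ℤ) (sym (at L p)))
            ; off = λ {j} ¬p → cong (λ x → j - x) (sym (off L ¬p)) })
    where
    eq₁ : ∀ d x → d - (x + 1ℤ) ≡ d - 1ℤ - x
    eq₁ = solve-∀
    eq₃ : ∀ j x → j - x ≡ j - (x - 1ℤ) - 1ℤ
    eq₃ = solve-∀

  -- The half turn negates x + y and with it every letter.
  reverse-ascent : ∀ {top w h} → Descent top w h → Ascent (λ j → - top (- j)) (map -_ w) (λ j → - h (- j))
  reverse-ascent (stop h≗top) = stop (λ j → cong -_ (h≗top (- j)))
  reverse-ascent (flip {g = g} {h} d D up flat L) = flip (- d) (reverse-ascent D)
    (cong -_ (trans (cong g (ℤₚ.neg-involutive d)) (trans (sym flat) (cong g (eq₁ d)))))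
    (trans (cong (λ x → - g x) (eq₂ d)) (trans (eq₃ (g (d - 1ℤ)))
      (cong (λ x → - x + 1ℤ) (trans (sym up) (cong g (sym (ℤₚ.neg-involutive d)))))))
    (record { at  = λ {j} p → trans (eq₄ (g (- j))) (cong (λ x → - x - 1ℤ) (sym (at L (swap p))))
            ; off = λ {j} ¬p → cong -_ (sym (off L (λ q → ¬p (subst (_≋ - d) (ℤₚ.neg-involutive j) (≋-neg q))))) })
    where
    eq₁ : ∀ d → d + 1ℤ ≡ - (- d - 1ℤ)
    eq₁ = solve-∀
    eq₂ : ∀ d → - (- d + 1ℤ) ≡ d - 1ℤ
    eq₂ = solve-∀
    eq₃ : ∀ x → - x ≡ - (x + 1ℤ) + 1ℤ
    eq₃ = solve-∀
    eq₄ : ∀ x → - x ≡ - (x - 1ℤ) - 1ℤ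
    eq₄ = solve-∀
    swap : ∀ {j} → j ≋ - d → - j ≋ d
    swap {j} p = subst (- j ≋_) (ℤₚ.neg-involutive d) (≋-neg p)

  -- Columns are the levels of the complemented profiles; the last hypothesis says that the same two
  -- columns are met at both boundaries.
  conveyor-RR : ∀ {κ top w h} → Profile κ top → Descent top w h → ∀ {a d} →
                top a ≡ top (a - 1ℤ) → top (a + 1ℤ) ≡ top a → h d ≡ h (d - 1ℤ) → h (d + 1ℤ) ≡ h d →
                d - h d ≡ a - top a → d ∷ w ∼ w ∷ʳ a
  conveyor-RR {top = top} {h = h} T D {a} {d} Ta Ta+1 Hd Hd+1 eq =
    conveyor (complement T) (complement-ascent D)
      (trans (cong (λ x → a - x) Ta) (eq₁ a (top (a - 1ℤ)))) (trans (cong (λ x → a + 1ℤ - x) Ta+1) (+-swap a 1ℤ (- (top a))))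
      (trans (cong (λ x → d - x) Hd) (eq₁ d (h (d - 1ℤ)))) (trans (cong (λ x → d + 1ℤ - x) Hd+1) (+-swap d 1ℤ (- (h d)))) eq
    where
    eq₁ : ∀ d x → d - x ≡ d - 1ℤ - x + 1ℤ
    eq₁ = solve-∀

  -- Along rows a descent lowers the tracked profile, whereas `conveyor` needs a raised one. The
  -- half turn repairs this, and negating the resulting words once more restores the letters.
  conveyor-UU : ∀ {κ top w h} → Profile κ top → Descent top w h → ∀ {a d} →
                top a ≡ top (a - 1ℤ) + 1ℤ → top (a + 1ℤ) ≡ top a + 1ℤ → h d ≡ h (d - 1ℤ) + 1ℤ → h (d + 1ℤ) ≡ h d + 1ℤ →
                h d ≡ top a → d ∷ w ∼ w ∷ʳ a
  conveyor-UU {top = top} {w} {h} T D {a} {d} Ta Ta+1 Hd Hd+1 eq = subst₂ _∼_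
    (cong₂ _∷_ (ℤₚ.neg-involutive d) (neg-neg w))
    (trans (Listₚ.map-++ -_ (map -_ w) (- a ∷ [])) (cong₂ (λ u b → u ∷ʳ b) (neg-neg w) (ℤₚ.neg-involutive a)))
    (∼-neg (conveyor (reverse T) (reverse-ascent D)
      (up top a Ta+1) (up′ top a Ta) (up h d Hd+1) (up′ h d Hd)
      (cong -_ (trans (cong h (ℤₚ.neg-involutive d)) (trans eq (cong top (sym (ℤₚ.neg-involutive a))))))))
    where
    neg-neg : ∀ w → map -_ (map -_ w) ≡ w
    neg-neg w = trans (sym (Listₚ.map-∘ w)) (trans (Listₚ.map-cong ℤₚ.neg-involutive w) (Listₚ.map-id w))
    eq₁ : ∀ d → d + 1ℤ ≡ - (- d - 1ℤ)
    eq₁ = solve-∀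
    eq₂ : ∀ d → - (- d + 1ℤ) ≡ d - 1ℤ
    eq₂ = solve-∀
    eq₃ : ∀ x → - x ≡ - (x + 1ℤ) + 1ℤ
    eq₃ = solve-∀
    up : ∀ (f : ℤ → ℤ) d → f (d + 1ℤ) ≡ f d + 1ℤ → - f (- (- d)) ≡ - f (- (- d - 1ℤ)) + 1ℤ
    up f d e = trans (cong (λ x → - f x) (ℤₚ.neg-involutive d)) (trans (eq₃ (f d))
      (cong (λ x → - x + 1ℤ) (trans (sym e) (cong f (eq₁ d)))))
    up′ : ∀ (f : ℤ → ℤ) d → f d ≡ f (d - 1ℤ) + 1ℤ → - f (- (- d + 1ℤ)) ≡ - f (- (- d)) + 1ℤ
    up′ f d e = trans (cong (λ x → - f x) (eq₂ d)) (trans (eq₃ (f (d - 1ℤ)))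
      (cong (λ x → - x + 1ℤ) (trans (sym e) (cong f (sym (ℤₚ.neg-involutive d))))))

  -- Strips

  module _ (P : LatticePath k n) where
    -- The northern boundary is the path moved by (0,k); its vertex at position j comes from the one
    -- at j - k.
    height abscissa ceiling : ℤ → ℤ
    height   j = proj₂ (vertex P j)
    abscissa j = proj₁ (vertex P j)
    ceiling  j = height (j - + k) + + k

    vertex-step : ∀ j → vertex P j ≡ forward (step P j) (vertex P (j - 1ℤ))
    vertex-step (+ zero)  = sym (forward-backward (step P 0ℤ) _)
    vertex-step (+ suc m) = refl
    vertex-step -[1+ m ]  = sym (trans (cong (λ x → forward (step P -[1+ m ]) (vertex P -[1+ suc x ])) (ℕₚ.+-identityʳ m))
                                       (forward-backward (step P -[1+ m ]) _))

    height-R : ∀ j → step P j ≡ R → height j ≡ height (j - 1ℤ)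
    height-R j eq = trans (cong proj₂ (vertex-step j)) (cong (λ x → proj₂ (forward x (vertex P (j - 1ℤ)))) eq)

    height-U : ∀ j → step P j ≡ U → height j ≡ height (j - 1ℤ) + 1ℤ
    height-U j eq = trans (cong proj₂ (vertex-step j)) (cong (λ x → proj₂ (forward x (vertex P (j - 1ℤ)))) eq)

    step-R : ∀ j → height j ≡ height (j - 1ℤ) → step P j ≡ R
    step-R j eq with step P j in s
    ... | R = refl
    ... | U = contradiction (trans (sym eq) (height-U j s)) a≢a+1

    height-rise : ∀ j → height j ≡ height (j - 1ℤ) + + rise (step P j)
    height-rise j with step P j in s
    ... | R = trans (height-R j s) (sym (ℤₚ.+-identityʳ _))
    ... | U = height-U j s

    step-+n : ∀ j → step P (j + + n) ≡ step P j
    step-+n j = cong (lookup (steps P)) (residue-cong (≋-period j))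

    height-prefix : ∀ m → m ℕ.≤ n → height (+ m) ≡ + risesBefore m (steps P)
    height-prefix zero    _   = refl
    height-prefix (suc m) m<n = begin
      height (+ suc m)                                                 ≡⟨ height-rise (+ suc m) ⟩
      height (+ m) + + rise (step P (+ suc m))                         ≡⟨ cong₂ (λ x y → x + + rise y) (height-prefix m (ℕₚ.<⇒≤ m<n)) step≡ ⟩
      + (risesBefore m (steps P) ℕ.+ rise (lookup (steps P) i))        ≡⟨ cong (λ x → + (risesBefore x (steps P) ℕ.+ rise (lookup (steps P) i))) toℕ-i ⟨
      + (risesBefore (toℕ i) (steps P) ℕ.+ rise (lookup (steps P) i))  ≡⟨ cong +_ (risesBefore-suc (steps P) i) ⟨
      + risesBefore (suc (toℕ i)) (steps P)                            ≡⟨ cong (λ x → + risesBefore (suc x) (steps P)) toℕ-i ⟩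
      + risesBefore (suc m) (steps P)                                  ∎
      where
      i : Fin n
      i = fromℕ< m<n
      toℕ-i : toℕ i ≡ m
      toℕ-i = Finₚ.toℕ-fromℕ< m<n
      step≡ : step P (+ suc m) ≡ lookup (steps P) i
      step≡ = cong (lookup (steps P)) (trans (cong (λ x → residue (+ suc x)) (sym toℕ-i)) (residue-label i))

    -- The rise over n steps does not depend on where it starts, and from vertex 0 it is the number
    -- of U steps.
    height-profile : Profile (+ k) height
    height-profile = record { step-cases = cases ; slope = slope′ }
      where
      cases : ∀ j → height j ≡ height (j - 1ℤ) ⊎ height j ≡ height (j - 1ℤ) + 1ℤ
      cases j with step P j in s
      ... | R = inj₁ (height-R j s)
      ... | U = inj₂ (height-U j s)
      difference : ℤ → ℤ
      difference j = height (j + + n) - height j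
      difference-+1 : ∀ j → difference (j + 1ℤ) ≡ difference j
      difference-+1 j = begin
        height (j + 1ℤ + + n) - height (j + 1ℤ)
          ≡⟨ cong₂ _-_ (height-rise (j + 1ℤ + + n)) (height-rise (j + 1ℤ)) ⟩
        (height (j + 1ℤ + + n - 1ℤ) + + rise (step P (j + 1ℤ + + n))) - (height (j + 1ℤ - 1ℤ) + + rise (step P (j + 1ℤ)))
          ≡⟨ cong₂ (λ x y → (height x + + rise (step P (j + 1ℤ + + n))) - (height y + + rise (step P (j + 1ℤ))))
                   (eq₁ j (+ n)) (+1-1 j) ⟩
        (height (j + + n) + + rise (step P (j + 1ℤ + + n))) - (height j + + rise (step P (j + 1ℤ)))
          ≡⟨ cong (λ x → (height (j + + n) + + rise x) - (height j + + rise (step P (j + 1ℤ)))) (step-+n (j + 1ℤ)) ⟩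
        (height (j + + n) + + rise (step P (j + 1ℤ))) - (height j + + rise (step P (j + 1ℤ)))
          ≡⟨ eq₂ (height (j + + n)) (height j) (+ rise (step P (j + 1ℤ))) ⟩
        difference j ∎
        where
        eq₁ : ∀ j m → j + 1ℤ + m - 1ℤ ≡ j + m
        eq₁ = solve-∀
        eq₂ : ∀ x y z → (x + z) - (y + z) ≡ x - y
        eq₂ = solve-∀
      slope′ : ∀ j → height (j + + n) ≡ height j + + k
      slope′ j = begin
        height (j + + n)               ≡⟨ eq (height (j + + n)) (height j) ⟩
        height j + difference j        ≡⟨ cong (λ x → height j + x) (constant difference difference-+1 j) ⟩
        height j + (height (+ n) - 0ℤ) ≡⟨ cong (λ x → height j + (x - 0ℤ)) (height-prefix n ℕₚ.≤-refl) ⟩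
        height j + (+ risesBefore n (steps P) - 0ℤ)
          ≡⟨ cong (λ x → height j + (+ x - 0ℤ)) (trans (risesBefore-all (steps P)) (LatticePath.ups P)) ⟩
        height j + (+ k - 0ℤ)          ≡⟨ cong (λ x → height j + x) (ℤₚ.+-identityʳ (+ k)) ⟩
        height j + + k                 ∎
        where
        eq : ∀ x y → x ≡ y + (x - y)
        eq = solve-∀

    ceiling-profile : Profile (+ k) ceiling
    ceiling-profile = record
      { step-cases = λ j → subst (λ x → ceiling j ≡ height x + + k ⊎ ceiling j ≡ height x + + k + 1ℤ) (+-swap j (- (+ k)) -1ℤ)
          ([ (λ eq → inj₁ (cong (_+ + k) eq)) , (λ eq → inj₂ (trans (cong (_+ + k) eq) (+-swap (height (j - + k - 1ℤ)) 1ℤ (+ k)))) ]′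
           (step-cases height-profile (j - + k)))
      ; slope      = λ j → trans (cong (λ x → height x + + k) (+-swap j (+ n) (- (+ k)))) (cong (_+ + k) (slope height-profile (j - + k)))
      }

    abscissa≡ : ∀ j → abscissa j ≡ j - height j
    abscissa≡ j = begin
      abscissa j                                 ≡⟨ eq₀ (abscissa j) (height j) j ⟩
      excess j + (j - height j)                  ≡⟨ cong (_+ (j - height j)) (constant excess excess-+1 j) ⟩
      excess 0ℤ + (j - height j)                 ≡⟨ ℤₚ.+-identityˡ (j - height j) ⟩
      j - height j                               ∎
      where
      excess : ℤ → ℤ
      excess j = abscissa j + height j - j
      eq₀ : ∀ x y j → x ≡ x + y - j + (j - y)
      eq₀ = solve-∀
      eq₁ : ∀ x y j → x + 1ℤ + y - (j + 1ℤ) ≡ x + y - j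
      eq₁ = solve-∀
      eq₂ : ∀ x y j → x + (y + 1ℤ) - (j + 1ℤ) ≡ x + y - j
      eq₂ = solve-∀
      advance : ∀ s p j → proj₁ (forward s p) + proj₂ (forward s p) - (j + 1ℤ) ≡ proj₁ p + proj₂ p - j
      advance R (x , y) j = eq₁ x y j
      advance U (x , y) j = eq₂ x y j
      excess-+1 : ∀ j → excess (j + 1ℤ) ≡ excess j
      excess-+1 j = trans (cong (λ p → proj₁ p + proj₂ p - (j + 1ℤ)) (vertex-step (j + 1ℤ)))
        (trans (advance (step P (j + 1ℤ)) (vertex P (j + 1ℤ - 1ℤ)) j)
          (cong (λ z → abscissa z + height z - j) (+1-1 j)))

    vertex≡ : ∀ j → vertex P j ≡ place height j
    vertex≡ j = cong (_, height j) (abscissa≡ j)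

    southEdge≡ : ∀ j → southEdge P j ≡ edgeAt height j
    southEdge≡ j with step P j in s
    ... | R = trans (cong horizontal (vertex≡ (j - 1ℤ))) (sym (edgeAt-R height j (height-R j s)))
    ... | U = trans (cong vertical (vertex≡ (j - 1ℤ))) (sym (edgeAt-U height j (height-U j s)))

    ceiling-+k : ∀ j → ceiling (j + + k) ≡ height j + + k
    ceiling-+k j = cong (λ x → height x + + k) (+--cancel j (+ k))

    ceiling-+k-1 : ∀ j → ceiling (j + + k - 1ℤ) ≡ height (j - 1ℤ) + + k
    ceiling-+k-1 j = trans (cong ceiling (+-swap j (+ k) -1ℤ)) (ceiling-+k (j - 1ℤ))

    northCorner≡ : ∀ i → vertex P (i - 1ℤ) ⊕ (0ℤ , + k) ≡ place ceiling (i + + k - 1ℤ)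
    northCorner≡ i = cong₂ _,_ (trans (cong (_+ 0ℤ) (abscissa≡ (i - 1ℤ))) (trans (eq i (height (i - 1ℤ)) (+ k))
        (cong (λ x → i + + k - 1ℤ - x) (sym (ceiling-+k-1 i))))) (sym (ceiling-+k-1 i))
      where
      eq : ∀ i h k → i - 1ℤ - h + 0ℤ ≡ i + k - 1ℤ - (h + k)
      eq = solve-∀

    northEdge≡ : ∀ i → northEdge P i ≡ edgeAt ceiling (i + + k)
    northEdge≡ i with step P i in s
    ... | R = trans (cong horizontal (northCorner≡ i)) (sym (edgeAt-R ceiling (i + + k)
                (trans (ceiling-+k i) (trans (cong (_+ + k) (height-R i s)) (sym (ceiling-+k-1 i))))))
    ... | U = trans (cong vertical (northCorner≡ i)) (sym (edgeAt-U ceiling (i + + k)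
                (trans (ceiling-+k i) (trans (cong (_+ + k) (height-U i s)) (trans (+-swap (height (i - 1ℤ)) 1ℤ (+ k))
                  (cong (_+ 1ℤ) (sym (ceiling-+k-1 i))))))))

    -- The k steps that end at vertex j raise the path by at most k, as the abscissa never
    -- decreases.
    height≤ceiling : ∀ j → height j ≤ ceiling j
    height≤ceiling j = ≤-resp-difference (monotone (complement height-profile) {j - + k} {j}
      (≤-resp-difference (+≤+ (ℕ.z≤n {k})) (eq₁ j (+ k)))) (eq₂ j (+ k) (height j) (height (j - + k)))
      where
      eq₁ : ∀ j k → k - 0ℤ ≡ j - (j - k)
      eq₁ = solve-∀
      eq₂ : ∀ j k h g → j - h - (j - k - g) ≡ g + k - h
      eq₂ = solve-∀

    -- `InStrip` compares along the column of the box, `Inside` along its antidiagonal, on which the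
    -- flips act.
    record Inside (b : Box) : Set where
      constructor inside
      field
        above : height (middle b) ≤ proj₂ b
        below : proj₂ b < ceiling (middle b)

    private
      xmono : ∀ {i j} → i ≤ j → i - height i ≤ j - height j
      xmono = monotone (complement height-profile)

    InStrip⇒Inside : ∀ {b} → InStrip P b → Inside b
    InStrip⇒Inside {x , y} b∈ with InStrip.south b∈ | InStrip.north b∈
    ... | j , h , eq , h≤y | i , g , eq′ , y<g = inside (lower j h eq h≤y) (upper i g eq′ y<g)
      where
      lower : ∀ j h → southEdge P j ≡ horizontal (x , h) → h ≤ y → height (x + y + 1ℤ) ≤ y
      lower j h eq h≤y with step P j in s
      ... | R = ≤-resp-difference (xmono j≤) (begin
          x + y + 1ℤ - height (x + y + 1ℤ) - (j - height j)
            ≡⟨ cong (λ z → x + y + 1ℤ - height (x + y + 1ℤ) - (j - z)) (height-R j s) ⟩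
          x + y + 1ℤ - height (x + y + 1ℤ) - (j - height (j - 1ℤ))
            ≡⟨ eq₁ x y j (height (x + y + 1ℤ)) (height (j - 1ℤ)) ⟩
          y - height (x + y + 1ℤ) + (x - (j - 1ℤ - height (j - 1ℤ)))
            ≡⟨ cong (λ z → y - height (x + y + 1ℤ) + (x - z)) x≡ ⟩
          y - height (x + y + 1ℤ) + (x - x)
            ≡⟨ eq₂ x (y - height (x + y + 1ℤ)) ⟩
          y - height (x + y + 1ℤ) ∎)
        where
        v≡ : vertex P (j - 1ℤ) ≡ (x , h)
        v≡ = horizontal-injective eq
        x≡ : j - 1ℤ - height (j - 1ℤ) ≡ x
        x≡ = trans (sym (abscissa≡ (j - 1ℤ))) (cong proj₁ v≡)
        eq₁ : ∀ x y j H h → x + y + 1ℤ - H - (j - h) ≡ y - H + (x - (j - 1ℤ - h))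
        eq₁ = solve-∀
        eq₂ : ∀ x z → z + (x - x) ≡ z
        eq₂ = solve-∀
        eq₃ : ∀ x y j h → y - h ≡ x + y + 1ℤ - j + (j - 1ℤ - h - x)
        eq₃ = solve-∀
        j≤ : j ≤ x + y + 1ℤ
        j≤ = ≤-resp-difference h≤y (trans (eq₃ x y j h) (trans
          (cong (λ z → x + y + 1ℤ - j + (z - x)) (trans (cong (λ z → j - 1ℤ - z) (sym (cong proj₂ v≡))) x≡)) (eq₂ x _)))
      upper : ∀ i g → northEdge P i ≡ horizontal (x , g) → y + 1ℤ ≤ g → y < ceiling (x + y + 1ℤ)
      upper i g eq y<g with step P i in s
      ... | R = +1≤⇒< (≤-resp-difference (xmono ≤i) (trans
            (cong (_- (x + y + 1ℤ - + k - height (x + y + 1ℤ - + k))) x≡) (eq₁ x y (+ k) (height (x + y + 1ℤ - + k)))))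
        where
        v≡ : vertex P (i - 1ℤ) ⊕ (0ℤ , + k) ≡ (x , g)
        v≡ = horizontal-injective eq
        x≡ : i - 1ℤ - height (i - 1ℤ) ≡ x
        x≡ = trans (sym (abscissa≡ (i - 1ℤ))) (trans (sym (ℤₚ.+-identityʳ _)) (cong proj₁ v≡))
        eq₁ : ∀ x y k h → x - (x + y + 1ℤ - k - h) ≡ h + k - (y + 1ℤ)
        eq₁ = solve-∀
        eq₂ : ∀ i h k y → h + k - (y + 1ℤ) ≡ i - 1ℤ - (i - 1ℤ - h + y + 1ℤ - k)
        eq₂ = solve-∀
        ≤i : x + y + 1ℤ - + k ≤ i - 1ℤ
        ≤i = ≤-resp-difference y<g (trans (cong (_- (y + 1ℤ)) (sym (cong proj₂ v≡)))
          (trans (eq₂ i (height (i - 1ℤ)) (+ k) y) (cong (λ z → i - 1ℤ - (z + y + 1ℤ - + k)) x≡)))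

    Inside⇒InStrip : ∀ {b} → Inside b → InStrip P b
    Inside⇒InStrip {x , y} (inside above below)
      -- The R step of P in column x serves for both boundaries, as the northern edge of the column
      -- is its translate by (0,k). The bounds of the window are the southern and the northern
      -- inequality.
      with level-crossing (λ j → j - height j) (next-cases (complement height-profile)) x k (x + y + 1ℤ - + k)
             (≤-resp-difference (<⇒+1≤ below) (eq₁ x y (+ k) (height (x + y + 1ℤ - + k))))
             (subst (λ z → x < z - height z) (sym (eq₀ x y (+ k)))
               (+1≤⇒< (≤-resp-difference above (eq₂ x y (height (x + y + 1ℤ))))))
      where
      eq₀ : ∀ x y k → x + y + 1ℤ - k + k ≡ x + y + 1ℤ
      eq₀ = solve-∀
      eq₁ : ∀ x y k h → h + k - (y + 1ℤ) ≡ x - (x + y + 1ℤ - k - h)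
      eq₁ = solve-∀
      eq₂ : ∀ x y h → y - h ≡ x + y + 1ℤ - h - (x + 1ℤ)
      eq₂ = solve-∀
    ... | j , Xj , Xj+1 , ≤j , j≤ = record
      { south = j + 1ℤ , height j , trans (cong (λ s → edge s (vertex P (j + 1ℤ - 1ℤ))) R-step) (cong horizontal corner≡)
              , ≤-resp-difference j≤ (trans (cong (λ z → x + y + 1ℤ - + k + + k - (z + 1ℤ)) j≡) (eq₁ x y (+ k) (height j)))
      ; north = j + 1ℤ , height j + + k
              , trans (cong (λ s → edge s (vertex P (j + 1ℤ - 1ℤ) ⊕ (0ℤ , + k))) R-step)
                      (cong horizontal (trans (cong (_⊕ (0ℤ , + k)) corner≡) (cong (_, height j + + k) (ℤₚ.+-identityʳ x))))
              , ≤-resp-difference ≤j (trans (cong (λ z → z - (x + y + 1ℤ - + k)) j≡) (eq₂ x y (+ k) (height j)))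
      }
      where
      j≡ : j ≡ x + height j
      j≡ = trans (eq j (height j)) (cong (_+ height j) Xj)
        where
        eq : ∀ j h → j ≡ j - h + h
        eq = solve-∀
      eq₁ : ∀ x y k h → x + y + 1ℤ - k + k - (x + h + 1ℤ) ≡ y - h
      eq₁ = solve-∀
      eq₂ : ∀ x y k h → x + h - (x + y + 1ℤ - k) ≡ h + k - (y + 1ℤ)
      eq₂ = solve-∀
      flat : height (j + 1ℤ) ≡ height j
      flat = trans (eq j (height (j + 1ℤ))) (trans (cong (λ z → j + 1ℤ - z) (trans Xj+1 (cong (_+ 1ℤ) (sym Xj)))) (eq′ j (height j)))
        where
        eq : ∀ j h → h ≡ j + 1ℤ - (j + 1ℤ - h)
        eq = solve-∀
        eq′ : ∀ j h → j + 1ℤ - (j - h + 1ℤ) ≡ h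
        eq′ = solve-∀
      R-step : step P (j + 1ℤ) ≡ R
      R-step = step-R (j + 1ℤ) (trans flat (cong height (sym (+1-1 j))))
      corner≡ : vertex P (j + 1ℤ - 1ℤ) ≡ (x , height j)
      corner≡ = trans (cong (vertex P) (+1-1 j)) (trans (vertex≡ j) (cong (_, height j) Xj))

  step-swap : ∀ i (P : LatticePath k n) j → step (swapSteps i P) j ≡ step P (to (σ (label i)) j)
  step-swap i P j with σ-cases (label i) j
  ... | inj₁ (j≋i , σj≡) = begin
    lookup (v [ i ]≔ lookup v i+1 [ i+1 ]≔ lookup v i) (residue j)  ≡⟨ cong (lookup (v [ i ]≔ lookup v i+1 [ i+1 ]≔ lookup v i)) residue≡i ⟩
    lookup (v [ i ]≔ lookup v i+1 [ i+1 ]≔ lookup v i) i            ≡⟨ Vecₚ.lookup∘update′ i≢i+1 (v [ i ]≔ lookup v i+1) (lookup v i) ⟩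
    lookup (v [ i ]≔ lookup v i+1) i                                ≡⟨ Vecₚ.lookup∘update i v (lookup v i+1) ⟩
    lookup v i+1                                                    ≡⟨ cong (lookup v) (residue-cong (≋-+ 1ℤ j≋i)) ⟨
    step P (j + 1ℤ)                                                 ≡⟨ cong (step P) σj≡ ⟨
    step P (to (σ (label i)) j)                                     ∎
    where
    v : Vec Step n
    v = steps P
    i+1 : Fin n
    i+1 = residue (label i + 1ℤ)
    residue≡i : residue j ≡ i
    residue≡i = trans (residue-cong j≋i) (residue-label i)
    i≢i+1 : i ≢ i+1
    i≢i+1 eq = ≋-suc (label i) (≋-trans (≋-reflexive (cong label eq)) (≋-sym (label-residue (label i + 1ℤ))))
  ... | inj₂ (inj₁ (j≋i+1 , σj≡)) = begin
    lookup (v [ i ]≔ lookup v i+1 [ i+1 ]≔ lookup v i) (residue j)  ≡⟨ cong (lookup (v [ i ]≔ lookup v i+1 [ i+1 ]≔ lookup v i)) (residue-cong j≋i+1) ⟩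
    lookup (v [ i ]≔ lookup v i+1 [ i+1 ]≔ lookup v i) i+1          ≡⟨ Vecₚ.lookup∘update i+1 (v [ i ]≔ lookup v i+1) (lookup v i) ⟩
    lookup v i                                                      ≡⟨ cong (lookup v) residue≡i ⟨
    step P (j - 1ℤ)                                                 ≡⟨ cong (step P) σj≡ ⟨
    step P (to (σ (label i)) j)                                     ∎
    where
    v : Vec Step n
    v = steps P
    i+1 : Fin n
    i+1 = residue (label i + 1ℤ)
    residue≡i : residue (j - 1ℤ) ≡ i
    residue≡i = trans (residue-cong {j - 1ℤ} {label i} (≋-cancel 1ℤ (subst (_≋ label i + 1ℤ) (sym (-1+1 j)) j≋i+1))) (residue-label i)
  ... | inj₂ (inj₂ (j≋̸i , j≋̸i+1 , σj≡)) = begin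
    lookup (v [ i ]≔ lookup v i+1 [ i+1 ]≔ lookup v i) (residue j)  ≡⟨ Vecₚ.lookup∘update′ (≢i+1 ∘ back) (v [ i ]≔ lookup v i+1) (lookup v i) ⟩
    lookup (v [ i ]≔ lookup v i+1) (residue j)                      ≡⟨ Vecₚ.lookup∘update′ ≢i v (lookup v i+1) ⟩
    step P j                                                        ≡⟨ cong (step P) σj≡ ⟨
    step P (to (σ (label i)) j)                                     ∎
    where
    v : Vec Step n
    v = steps P
    i+1 : Fin n
    i+1 = residue (label i + 1ℤ)
    ≢i : residue j ≢ i
    ≢i eq = j≋̸i (≋-trans (label-residue j) (≋-reflexive (cong label eq)))
    back : residue j ≡ i+1 → label (residue {n} j) ≡ label i+1
    back = cong label
    ≢i+1 : label (residue {n} j) ≢ label i+1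
    ≢i+1 eq = j≋̸i+1 (≋-trans (label-residue j) (≋-trans (≋-reflexive eq) (≋-sym (label-residue (label i + 1ℤ)))))

  translate : ∀ {f g : ℤ → ℤ} → (∀ j → g j - f j ≡ g (j - 1ℤ) - f (j - 1ℤ)) → ∃ λ c → ∀ j → g j ≡ f j + c
  translate {f} {g} same = g 0ℤ - f 0ℤ , λ j → trans (eq (g j) (f j)) (cong (λ x → f j + x)
    (constant (λ j → g j - f j) (λ q → trans (same (q + 1ℤ)) (cong (λ x → g x - f x) (+1-1 q))) j))
    where
    eq : ∀ x y → x ≡ y + (x - y)
    eq = solve-∀

  same-steps : ∀ (P Q : LatticePath k n) → (∀ j → step Q j ≡ step P j) → ∃ λ c → ∀ j → height Q j ≡ height P j + c
  same-steps P Q eq = translate (λ j → trans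
    (cong₂ _-_ (height-rise Q j) (height-rise P j))
    (trans (cong (λ s → height Q (j - 1ℤ) + + rise s - (height P (j - 1ℤ) + + rise (step P j))) (eq j))
           (cancel (height Q (j - 1ℤ)) (height P (j - 1ℤ)) (+ rise (step P j)))))
    where
    cancel : ∀ x y z → x + z - (y + z) ≡ x - y
    cancel = solve-∀

  -- Vertex 0 is pinned to the origin. If the swap moves that vertex, which happens for d congruent
  -- to 0, all other vertices are displaced instead; the constant c accounts for this.
  swapped-steps : ∀ (P Q : LatticePath k n) d → (∀ j → step Q j ≡ step P (to (σ d) j)) →
    step P d ≡ R → step P (d + 1ℤ) ≡ U → ∃ λ c → ∀ j → height Q j ≡ raise d (height P) j + c
  swapped-steps P Q d eq Pd Pd+1 = translate same
    where
    step-≋ : ∀ {a b} → a ≋ b → step P a ≡ step P b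
    step-≋ p = cong (lookup (steps P)) (residue-cong p)
    same : ∀ j → height Q j - raise d (height P) j ≡ height Q (j - 1ℤ) - raise d (height P) (j - 1ℤ)
    same j with σ-cases d j
    ... | inj₁ (p , σj) = begin
      height Q j - raise d (height P) j
        ≡⟨ cong₂ _-_ (height-U Q j (trans (eq j) (trans (cong (step P) σj) (trans (step-≋ (≋-+ 1ℤ p)) Pd+1)))) (raise-at (height P) p) ⟩
      height Q (j - 1ℤ) + 1ℤ - (height P j + 1ℤ)
        ≡⟨ cong (λ x → height Q (j - 1ℤ) + 1ℤ - (x + 1ℤ)) (height-R P j (trans (step-≋ p) Pd)) ⟩
      height Q (j - 1ℤ) + 1ℤ - (height P (j - 1ℤ) + 1ℤ)
        ≡⟨ cancel (height Q (j - 1ℤ)) (height P (j - 1ℤ)) 1ℤ ⟩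
      height Q (j - 1ℤ) - height P (j - 1ℤ)
        ≡⟨ cong (λ x → height Q (j - 1ℤ) - x) (raise-off (height P) (λ q → pred≋̸ (≋-trans q (≋-sym p)))) ⟨
      height Q (j - 1ℤ) - raise d (height P) (j - 1ℤ) ∎
      where
      cancel : ∀ x y z → x + z - (y + z) ≡ x - y
      cancel = solve-∀
    ... | inj₂ (inj₁ (p , σj)) = begin
      height Q j - raise d (height P) j
        ≡⟨ cong₂ _-_ (height-R Q j (trans (eq j) (trans (cong (step P) σj) (trans (step-≋ j-1≋d) Pd))))
                     (raise-off (height P) (λ q → not-both q p)) ⟩
      height Q (j - 1ℤ) - height P j
        ≡⟨ cong (λ x → height Q (j - 1ℤ) - x) (height-U P j (trans (step-≋ p) Pd+1)) ⟩
      height Q (j - 1ℤ) - (height P (j - 1ℤ) + 1ℤ)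
        ≡⟨ cong (λ x → height Q (j - 1ℤ) - x) (raise-at (height P) j-1≋d) ⟨
      height Q (j - 1ℤ) - raise d (height P) (j - 1ℤ) ∎
      where
      j-1≋d : j - 1ℤ ≋ d
      j-1≋d = ≋-cancel 1ℤ (subst (_≋ d + 1ℤ) (sym (-1+1 j)) p)
    ... | inj₂ (inj₂ (¬p , ¬q , σj)) = begin
      height Q j - raise d (height P) j
        ≡⟨ cong₂ _-_ (height-rise Q j) (trans (raise-off (height P) ¬p) (height-rise P j)) ⟩
      height Q (j - 1ℤ) + + rise (step Q j) - (height P (j - 1ℤ) + + rise (step P j))
        ≡⟨ cong (λ s → height Q (j - 1ℤ) + + rise s - (height P (j - 1ℤ) + + rise (step P j))) (trans (eq j) (cong (step P) σj)) ⟩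
      height Q (j - 1ℤ) + + rise (step P j) - (height P (j - 1ℤ) + + rise (step P j))
        ≡⟨ cancel (height Q (j - 1ℤ)) (height P (j - 1ℤ)) (+ rise (step P j)) ⟩
      height Q (j - 1ℤ) - height P (j - 1ℤ)
        ≡⟨ cong (λ x → height Q (j - 1ℤ) - x) (raise-off (height P)
             (λ r → ¬q (subst (_≋ d + 1ℤ) (-1+1 j) (≋-+ 1ℤ r)))) ⟨
      height Q (j - 1ℤ) - raise d (height P) (j - 1ℤ) ∎
      where
      cancel : ∀ x y z → x + z - (y + z) ≡ x - y
      cancel = solve-∀

  -- Strands

  -- The vertex at position c is the upper left corner of this box; if UR meets there, flipping to
  -- RU cuts off the box.
  cornerBox : (ℤ → ℤ) → ℤ → Box
  cornerBox h c = c - h c , h c - 1ℤ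

  middle-cornerBox : ∀ h c → middle (cornerBox h c) ≡ c
  middle-cornerBox h c = eq c (h c)
    where
    eq : ∀ c h → c - h + (h - 1ℤ) + 1ℤ ≡ c
    eq = solve-∀

  cornerBox-injective : ∀ h {c c′} → cornerBox h c ≡ cornerBox h c′ → c ≡ c′
  cornerBox-injective h {c} {c′} eq = trans (sym (middle-cornerBox h c)) (trans (cong middle eq) (middle-cornerBox h c′))

  cornerBox-middle : ∀ {h} b → proj₂ b ≡ h (middle b) - 1ℤ → b ≡ cornerBox h (middle b)
  cornerBox-middle {h} (x , y) eq = cong₂ _,_ (trans (eq′ x y)
    (trans (cong (λ z → x + y + 1ℤ - (z + 1ℤ)) eq) (cong (λ z → x + y + 1ℤ - z) (-1+1 (h (x + y + 1ℤ)))))) eq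
    where
    eq′ : ∀ x y → x ≡ x + y + 1ℤ - (y + 1ℤ)
    eq′ = solve-∀

  -- Distinguished subexpressions

  act : Tile → ℤ → AffinePerm n → AffinePerm n
  act crossing d v = v · σ d
  act elbow    d v = v

  Tiling : List ℤ → Set
  Tiling w = All (λ _ → Tile) w

  -- Maps the label of a strand to its position on the path reached so far. Northern edge i lies at
  -- position i + k, so the start is `shift`.
  evaluate : ∀ {w} → Tiling w → AffinePerm n
  evaluate []               = shift
  evaluate (_∷_ {x = d} t ts) = act t d (evaluate ts)

  -- Two strands have crossed an even number of times if and only if they are in their original order.
  Distinguished : ∀ {w} → Tiling w → Set
  Distinguished []                 = ⊤
  Distinguished (_∷_ {x = d} t ts) =
    Distinguished ts × (t ≡ elbow → from (evaluate ts) d < from (evaluate ts) (d + 1ℤ))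

  tilesOf : ∀ {top w h} → (Box → Tile) → Descent top w h → Tiling w
  tilesOf T (stop _)                 = []
  tilesOf T (flip {g = g} d D _ _ _) = T (cornerBox g d) ∷ tilesOf T D

  Above : (ℤ → ℤ) → Box → Set
  Above h b = h (middle b) ≤ proj₂ b

  cornerBox-not-above : ∀ h c → ¬ Above h (cornerBox h c)
  cornerBox-not-above h c above =
    ℤₚ.<⇒≱ (a-1<a (h c)) (subst (λ j → h j ≤ h c - 1ℤ) (middle-cornerBox h c) above)

  -- A flip enlarges the region above the path by corner boxes only, which is what makes the flips
  -- exhaust the strip.
  above-lowered : ∀ {d g h b} → Lowered d g h → Above h b → Above g b ⊎ middle b ≋ d × b ≡ cornerBox g (middle b)
  above-lowered {d} {g} {h} {b@(x , y)} L above with middle b ≋? d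
  ... | no ¬p = inj₁ (subst (_≤ y) (off L ¬p) above)
  ... | yes p with y ℤₚ.≟ g (middle b) - 1ℤ
  ... | yes y≡ = inj₂ (p , cornerBox-middle {g} b y≡)
  ... | no y≢  = inj₁ (subst (_≤ y) (-1+1 (g (middle b)))
                   (<⇒+1≤ (ℤₚ.≤∧≢⇒< (subst (_≤ y) (at L p) above) (y≢ ∘ sym))))

  module _ {g : ℤ → ℤ} {c : ℤ} (up : g c ≡ g (c - 1ℤ) + 1ℤ) (flat : g (c + 1ℤ) ≡ g c) where
    private
      pred≡ : g (c - 1ℤ) ≡ g c - 1ℤ
      pred≡ = trans (sym (+1-1 _)) (cong (_- 1ℤ) (sym up))

      place-pred : place g (c - 1ℤ) ≡ cornerBox g c
      place-pred = cong₂ _,_ (trans (cong (λ z → c - 1ℤ - z) pred≡) (eq c (g c))) pred≡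
        where
        eq : ∀ c x → c - 1ℤ - (x - 1ℤ) ≡ c - x
        eq = solve-∀

    left-corner : edgeAt g c ≡ left (cornerBox g c)
    left-corner = trans (edgeAt-U g c up) (cong vertical place-pred)

    top-corner : edgeAt g (c + 1ℤ) ≡ top (cornerBox g c)
    top-corner = trans (edgeAt-R g (c + 1ℤ) (trans flat (cong g (sym (+1-1 c)))))
      (cong horizontal (trans (cong (place g) (+1-1 c)) (cong (c - g c ,_) (sym (-1+1 (g c))))))

    module _ {h : ℤ → ℤ} (hc-1 : h (c - 1ℤ) ≡ g (c - 1ℤ)) (hc : h c ≡ g c - 1ℤ) (hc+1 : h (c + 1ℤ) ≡ g (c + 1ℤ)) where
      bottom-corner : edgeAt h c ≡ bottom (cornerBox g c)
      bottom-corner = trans (edgeAt-R h c (trans hc (trans (sym pred≡) (sym hc-1))))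
        (cong horizontal (trans (cong (λ z → c - 1ℤ - z , z) hc-1) place-pred))

      right-corner : edgeAt h (c + 1ℤ) ≡ right (cornerBox g c)
      right-corner = trans (edgeAt-U h (c + 1ℤ) (trans hc+1 (trans flat (trans (sym (-1+1 (g c)))
          (cong (_+ 1ℤ) (trans (sym hc) (cong h (sym (+1-1 c)))))))))
        (cong vertical (trans (cong (place h) (+1-1 c)) (cong₂ _,_ (trans (cong (λ z → c - z) hc) (eq c (g c))) hc)))
        where
        eq : ∀ c x → c - (x - 1ℤ) ≡ c - x + 1ℤ
        eq = solve-∀

  position : Edge → ℤ
  position (vertical (x , y))   = x + y
  position (horizontal (x , y)) = x + y

  position-edgeAt : ∀ h j → position (edgeAt h j) ≡ j - 1ℤ
  position-edgeAt h j with h j ℤₚ.≟ h (j - 1ℤ)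
  ... | yes _ = -+-cancel (j - 1ℤ) (h (j - 1ℤ))
  ... | no _ = -+-cancel (j - 1ℤ) (h (j - 1ℤ))

  edgeAt-injective : ∀ h {i j} → edgeAt h i ≡ edgeAt h j → i ≡ j
  edgeAt-injective h {i} {j} eq = trans (sym (-1+1 i)) (trans (cong (_+ 1ℤ)
    (trans (sym (position-edgeAt h i)) (trans (cong position eq) (position-edgeAt h j)))) (-1+1 j))

  edgeAt-cong : ∀ {g h j} → g j ≡ h j → g (j - 1ℤ) ≡ h (j - 1ℤ) → edgeAt g j ≡ edgeAt h j
  edgeAt-cong {g} {h} {j} eq eq′ with g j ℤₚ.≟ g (j - 1ℤ) | h j ℤₚ.≟ h (j - 1ℤ)
  ... | yes _ | yes _ = cong (λ z → horizontal (j - 1ℤ - z , z)) eq′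
  ... | no _  | no _  = cong (λ z → vertical (j - 1ℤ - z , z)) eq′
  ... | yes p | no ¬q = contradiction (trans (sym eq) (trans p eq′)) ¬q
  ... | no ¬p | yes q = contradiction (trans eq (trans q (sym eq′))) ¬p

  behind : Edge → Box
  behind (vertical (x , y))   = x - 1ℤ , y
  behind (horizontal (x , y)) = x , y

  behind-exit : ∀ t e → behind (exit t e) ≡ ahead e
  behind-exit crossing (vertical (x , y))   = cong (_, y) (+1-1 x)
  behind-exit crossing (horizontal (x , y)) = refl
  behind-exit elbow    (vertical (x , y))   = refl
  behind-exit elbow    (horizontal (x , y)) = cong (_, y - 1ℤ) (+1-1 x)

  horizontal-ahead : ∀ {p q} → ahead (horizontal p) ≡ ahead (horizontal q) → horizontal p ≡ horizontal q
  horizontal-ahead {x , y} {x′ , y′} eq = cong₂ (λ u v → horizontal (u , v)) (cong proj₁ eq)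
    (trans (sym (-1+1 y)) (trans (cong (λ p → proj₂ p + 1ℤ) eq) (-1+1 y′)))

  exit-injective : ∀ t {e e′} → exit t e ≡ exit t e′ → ahead e ≡ ahead e′ → e ≡ e′
  exit-injective crossing {vertical _}   {vertical _}   _ eq = cong vertical eq
  exit-injective crossing {horizontal _} {horizontal _} _ eq = horizontal-ahead eq
  exit-injective elbow    {vertical _}   {vertical _}   _ eq = cong vertical eq
  exit-injective elbow    {horizontal _} {horizontal _} _ eq = horizontal-ahead eq

  hit : ℤ → ℤ → Maybe ℤ
  hit d a with σ-cases d a
  ... | inj₁ _        = just a
  ... | inj₂ (inj₁ _) = just (a - 1ℤ)
  ... | inj₂ (inj₂ _) = nothing

  -- The vertex of the box, among those of the flip at d, which is entered by a strand at position a.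
  data Hit (d a : ℤ) : Maybe ℤ → Set where
    viaLeft  : a ≋ d → to (σ d) a ≡ a + 1ℤ → Hit d a (just a)
    viaTop : ∀ c → c ≋ d → a ≡ c + 1ℤ → to (σ d) a ≡ c → Hit d a (just c)
    misses   : ¬ a ≋ d → ¬ a ≋ d + 1ℤ → to (σ d) a ≡ a → Hit d a nothing

  hit-view : ∀ d a → Hit d a (hit d a)
  hit-view d a with σ-cases d a
  ... | inj₁ (p , eq)              = viaLeft p eq
  ... | inj₂ (inj₁ (p , eq))       = viaTop (a - 1ℤ) (≋-cancel 1ℤ (subst (_≋ d + 1ℤ) (sym (-1+1 a)) p)) (sym (-1+1 a)) eq
  ... | inj₂ (inj₂ (p , q , eq))   = misses p q eq

  hit-at : ∀ {d a} → a ≋ d → hit d a ≡ just a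
  hit-at {d} {a} p with hit d a | hit-view d a
  ... | _ | viaLeft _ _         = refl
  ... | _ | viaTop c q refl _ = contradiction (≋-+ 1ℤ q) (not-both p)
  ... | _ | misses ¬p _ _       = contradiction p ¬p

  hit-next : ∀ {d a} → a ≋ d → hit d (a + 1ℤ) ≡ just a
  hit-next {d} {a} p with hit d (a + 1ℤ) | hit-view d (a + 1ℤ)
  ... | _ | viaLeft q _         = contradiction (≋-+ 1ℤ p) (not-both q)
  ... | _ | viaTop c q eq _   = cong just (sym (+-cancelʳ 1ℤ eq))
  ... | _ | misses _ ¬q _       = contradiction (≋-+ 1ℤ p) ¬q

  visit : (ℤ → ℤ) → Maybe ℤ → List Box → List Box
  visit g c xs = maybe′ (λ c → cornerBox g c ∷ xs) xs c

  boxesOf : ∀ {top w h} → (Box → Tile) → Descent top w h → ℤ → List Box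
  boxesOf T (stop _) i = []
  boxesOf {w = _ ∷ w} T (flip {g = g} d D _ _ _) i =
    visit g (hit d (to (evaluate (tilesOf T D)) i)) (boxesOf T D i)

  boxes-above : ∀ {top w h} T (D : Descent top w h) i → All (Above h) (boxesOf T D i)
  boxes-above T (stop _) i = []
  boxes-above {w = _ ∷ w} {h} T (flip {g = g} d D _ _ L) i = add (hit-view d (to (evaluate (tilesOf T D)) i))
    where
    old : All (Above h) (boxesOf T D i)
    old = All.map (λ {b} → ℤₚ.≤-trans (lowered-≤ L (middle b))) (boxes-above T D i)
    new : ∀ {c} → c ≋ d → Above h (cornerBox g c)
    new {c} p = subst (λ j → h j ≤ g c - 1ℤ) (sym (middle-cornerBox g c)) (ℤₚ.≤-reflexive (at L p))
    add : ∀ {a c} → Hit d a c → All (Above h) (visit g c (boxesOf T D i))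
    add (viaLeft p _)      = new p ∷ old
    add (viaTop _ p _ _) = new p ∷ old
    add (misses _ _ _)     = old

  module Strands {P : LatticePath k n} (F : Filling P) where
    T : Box → Tile
    T = tile F

    open Shared T

    bottomLine ceilingLine : ℤ → ℤ
    bottomLine = height P
    ceilingLine = ceiling P

    -- Bundled so that the final edge can be rewritten while the list of boxes is kept.
    record Along (i : ℤ) (e : Edge) (xs : List Box) : Set where
      constructor along
      field
        strand : Strand F i e
        boxes  : traversed F strand ≡ xs

    along-cong : ∀ {i e e′ xs} → e ≡ e′ → Along i e xs → Along i e′ xs
    along-cong refl α = α

    right-crossing : ∀ {i b xs} → InStrip P b → T b ≡ crossing → Along i (left b) xs → Along i (right b) (b ∷ xs)
    right-crossing {b = b} b∈ t (along σ refl) =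
      subst (λ e → Along _ e (b ∷ traversed F σ)) (cong (λ t → exit t (left b)) t) (along (_▹_ {e = left b} σ b∈) refl)

    bottom-elbow : ∀ {i b xs} → InStrip P b → T b ≡ elbow → Along i (left b) xs → Along i (bottom b) (b ∷ xs)
    bottom-elbow {b = b} b∈ t (along σ refl) =
      subst (λ e → Along _ e (b ∷ traversed F σ)) (cong (λ t → exit t (left b)) t) (along (_▹_ {e = left b} σ b∈) refl)

    ahead-top : ∀ b → ahead (top b) ≡ b
    ahead-top (x , y) = cong (x ,_) (+1-1 y)

    through-top : ∀ {i b xs} → InStrip P b → Along i (top b) xs → Along i (exit (T b) (horizontal (proj₁ b , proj₂ b + 1ℤ))) (b ∷ xs)
    through-top {b = b} b∈ (along σ refl) = subst (λ c → Along _ (exit (T c) (top b)) (c ∷ traversed F σ)) (ahead-top b)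
      (along (_▹_ {e = top b} σ (subst (InStrip P) (sym (ahead-top b)) b∈)) refl)

    bottom-crossing : ∀ {i b xs} → InStrip P b → T b ≡ crossing → Along i (top b) xs → Along i (bottom b) (b ∷ xs)
    bottom-crossing {b = b} b∈ t α = along-cong
      (trans (cong (λ t → exit t (top b)) t) (cong horizontal (ahead-top b))) (through-top b∈ α)

    right-elbow : ∀ {i b xs} → InStrip P b → T b ≡ elbow → Along i (top b) xs → Along i (right b) (b ∷ xs)
    right-elbow {b = b} b∈ t α = along-cong
      (trans (cong (λ t → exit t (top b)) t) (cong right (ahead-top b))) (through-top b∈ α)

    behind-north : ∀ i → ¬ InStrip P (behind (northEdge P i))
    behind-north i b∈ = outside (i + + k) (InStrip⇒Inside P (subst (λ e → InStrip P (behind e)) (northEdge≡ P i) b∈))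
      where
      outside : ∀ j → ¬ Inside P (behind (edgeAt ceilingLine j))
      outside j with ceilingLine j ℤₚ.≟ ceilingLine (j - 1ℤ)
      ... | yes p = λ ins → ℤₚ.<-irrefl (sym p) (subst (λ z → ceilingLine (j - 1ℤ) < ceilingLine z)
                      (eq j (ceilingLine (j - 1ℤ))) (Inside.below ins))
        where
        eq : ∀ j c → j - 1ℤ - c + c + 1ℤ ≡ j
        eq = solve-∀
      ... | no _ = λ ins → ℤₚ.<-irrefl refl (subst (λ z → ceilingLine (j - 1ℤ) < ceilingLine z)
                      (eq j (ceilingLine (j - 1ℤ))) (Inside.below ins))
        where
        eq : ∀ j c → j - 1ℤ - c - 1ℤ + c + 1ℤ ≡ j - 1ℤ
        eq = solve-∀

    -- Strands can be traced backwards: the tile behind an edge determines the edge of entry, and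
    -- the trace can stop only at the north, since no box of the strip lies behind a northern edge.
    strand-unique : ∀ {i j e e′} (σ : Strand F i e) (τ : Strand F j e′) → e ≡ e′ → i ≡ j × traversed F σ ≡ traversed F τ
    strand-unique {i} {j} enter enter eq =
      +-cancelʳ (+ k) (edgeAt-injective ceilingLine (trans (sym (northEdge≡ P i)) (trans eq (northEdge≡ P j)))) , refl
    strand-unique {i} enter (_▹_ {e} τ e∈) eq = contradiction
      (subst (InStrip P) (trans (sym (behind-exit (T (ahead e)) e)) (cong behind (sym eq))) e∈) (behind-north i)
    strand-unique {j = j} (_▹_ {e} σ e∈) enter eq = contradiction
      (subst (InStrip P) (trans (sym (behind-exit (T (ahead e)) e)) (cong behind eq)) e∈) (behind-north j)
    strand-unique (_▹_ {e} σ _) (_▹_ {e′} τ _) eq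
      with trans (sym (behind-exit (T (ahead e)) e)) (trans (cong behind eq) (behind-exit (T (ahead e′)) e′))
    ... | same with strand-unique σ τ (exit-injective (T (ahead e))
                      (trans eq (cong (λ b → exit (T b) e′) (sym same))) same)
    ... | i≡j , boxes≡ = i≡j , cong₂ _∷_ same boxes≡

    cornerBox-+n : ∀ {g} → Profile (+ k) g → ∀ c → cornerBox g (c + + n) ≡ cornerBox g c ⊕ period P
    cornerBox-+n {g} G c = cong₂ _,_ (trans (cong (λ z → c + + n - z) (slope G c)) (eq₁ c (+ n) (g c) (+ k)))
                                     (trans (cong (_- 1ℤ) (slope G c)) (+-swap (g c) (+ k) -1ℤ))
      where
      eq₁ : ∀ c n g k → c + n - (g + k) ≡ c - g + (n - k)
      eq₁ = solve-∀

    module Flip {w g h} {d : ℤ} (D : Descent ceilingLine w g) (up : g d ≡ g (d - 1ℤ) + 1ℤ) (flat : g (d + 1ℤ) ≡ g d)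
                (L : Lowered d g h) (bottom≤ : ∀ j → bottomLine j ≤ h j) where
      gᵖ : Profile (+ k) g
      gᵖ = descent-profile (ceiling-profile P) D

      v : AffinePerm n
      v = evaluate (tilesOf T D)

      corner-inStrip : ∀ {c} → c ≋ d → InStrip P (cornerBox g c)
      corner-inStrip {c} p = Inside⇒InStrip P (inside
        (subst (λ j → bottomLine j ≤ g c - 1ℤ) (sym (middle-cornerBox g c)) (subst (bottomLine c ≤_) (at L p) (bottom≤ c)))
        (subst (λ j → g c - 1ℤ < ceilingLine j) (sym (middle-cornerBox g c)) (ℤₚ.<-≤-trans (a-1<a (g c)) (descent-≤ D c))))

      -- One letter stands for a periodic family of boxes; this gives the family a single tile.
      corner-tile : ∀ {c} → c ≋ d → T (cornerBox g c) ≡ T (cornerBox g d)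
      corner-tile (q , refl) = trans (constant (λ q → T (cornerBox g (d + q * + n))) next q)
                                     (cong (λ j → T (cornerBox g j)) (eq d (+ n)))
        where
        eq : ∀ d n → d + 0ℤ * n ≡ d
        eq = solve-∀
        eq′ : ∀ d q n → d + (q + 1ℤ) * n ≡ d + q * n + n
        eq′ = solve-∀
        next : ∀ q → T (cornerBox g (d + (q + 1ℤ) * + n)) ≡ T (cornerBox g (d + q * + n))
        next q = trans (cong (λ j → T (cornerBox g j)) (eq′ d q (+ n))) (trans (cong T (cornerBox-+n gᵖ (d + q * + n)))
          (Filling.periodic F _ (corner-inStrip (q , refl))))

      up-at : ∀ {c} → c ≋ d → g c ≡ g (c - 1ℤ) + 1ℤ
      up-at p = up-≋ gᵖ (≋-sym p) up

      flat-at : ∀ {c} → c ≋ d → g (c + 1ℤ) ≡ g c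
      flat-at p = next-flat-≋ gᵖ (≋-sym p) flat

      left≡ : ∀ {c} → c ≋ d → edgeAt g c ≡ left (cornerBox g c)
      left≡ p = left-corner {g} (up-at p) (flat-at p)

      top≡ : ∀ {c} → c ≋ d → edgeAt g (c + 1ℤ) ≡ top (cornerBox g c)
      top≡ p = top-corner {g} (up-at p) (flat-at p)

      off-pred : ∀ {c} → c ≋ d → h (c - 1ℤ) ≡ g (c - 1ℤ)
      off-pred p = off L (λ q → pred≋̸ (≋-trans q (≋-sym p)))

      off-suc : ∀ {c} → c ≋ d → h (c + 1ℤ) ≡ g (c + 1ℤ)
      off-suc p = off L (λ q → suc≋̸ (≋-trans q (≋-sym p)))

      bottom≡ : ∀ {c} → c ≋ d → bottom (cornerBox g c) ≡ edgeAt h c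
      bottom≡ p = sym (bottom-corner {g} (up-at p) (flat-at p) {h} (off-pred p) (at L p) (off-suc p))

      right≡ : ∀ {c} → c ≋ d → right (cornerBox g c) ≡ edgeAt h (c + 1ℤ)
      right≡ p = sym (right-corner {g} (up-at p) (flat-at p) {h} (off-pred p) (at L p) (off-suc p))

      -- One flip in terms of positions: the left and the bottom edge of a corner box both have
      -- position c, the top and the right edge both c + 1. An elbow thus preserves positions and a
      -- crossing exchanges them.
      advance : ∀ {t} → T (cornerBox g d) ≡ t → ∀ {i a c xs} → Hit d a c → to v i ≡ a → Along i (edgeAt g a) xs →
                Along i (edgeAt h (to (act t d v) i)) (visit g c xs)
      advance {crossing} t {i} {a} (viaLeft p eq) va α = along-cong
        (trans (right≡ p) (cong (edgeAt h) (sym (trans (cong (to (σ d)) va) eq))))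
        (right-crossing (corner-inStrip p) (trans (corner-tile p) t) (along-cong (left≡ p) α))
      advance {elbow} t {i} {a} (viaLeft p eq) va α = along-cong
        (trans (bottom≡ p) (cong (edgeAt h) (sym va)))
        (bottom-elbow (corner-inStrip p) (trans (corner-tile p) t) (along-cong (left≡ p) α))
      advance {crossing} t {i} (viaTop c p refl eq) va α = along-cong
        (trans (bottom≡ p) (cong (edgeAt h) (sym (trans (cong (to (σ d)) va) eq))))
        (bottom-crossing (corner-inStrip p) (trans (corner-tile p) t) (along-cong (top≡ p) α))
      advance {elbow} t {i} (viaTop c p refl eq) va α = along-cong
        (trans (right≡ p) (cong (edgeAt h) (sym va)))
        (right-elbow (corner-inStrip p) (trans (corner-tile p) t) (along-cong (top≡ p) α))
      advance {t} _ {i} {a} (misses ¬p ¬q eq) va α = along-cong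
        (trans (edgeAt-cong {g} {h} (sym (off L ¬p)) (sym (off L ¬p′))) (cong (edgeAt h) (sym (act-miss t)))) α
        where
        ¬p′ : ¬ a - 1ℤ ≋ d
        ¬p′ r = ¬q (subst (_≋ d + 1ℤ) (-1+1 a) (≋-+ 1ℤ r))
        act-miss : ∀ t → to (act t d v) i ≡ a
        act-miss crossing = trans (cong (to (σ d)) va) eq
        act-miss elbow    = va

    canonical : ∀ {w h} (D : Descent ceilingLine w h) → (∀ j → bottomLine j ≤ h j) → ∀ i →
                Along i (edgeAt h (to (evaluate (tilesOf T D)) i)) (boxesOf T D i)
    canonical (stop h≗top) bottom≤ i = subst (λ e → Along i e [])
      (trans (northEdge≡ P i) (edgeAt-cong (sym (h≗top _)) (sym (h≗top _)))) (along enter refl)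
    canonical {d ∷ w} (flip d D up flat L) bottom≤ i =
      Flip.advance D up flat L bottom≤ refl (hit-view d _) refl
        (canonical D (λ j → ℤₚ.≤-trans (bottom≤ j) (lowered-≤ L j)) i)

    canonical-crossings : ∀ {w h} (D : Descent ceilingLine w h) → (∀ j → bottomLine j ≤ h j) →
      let v = evaluate (tilesOf T D) in
      ∀ {i j e e′} (σ : Strand F i e) (τ : Strand F j e′) a b → e ≡ edgeAt h a → e′ ≡ edgeAt h b →
      i ≡ from v a × j ≡ from v b × crossings F σ τ ≡ shared (boxesOf T D i) (boxesOf T D j)
    canonical-crossings {w} {h} D bottom≤ {i} {j} σ τ a b e≡ e′≡ with identify σ a e≡ | identify τ b e′≡
      where
      v : AffinePerm n
      v = evaluate (tilesOf T D)
      identify : ∀ {i e} (σ : Strand F i e) a → e ≡ edgeAt h a → i ≡ from v a × traversed F σ ≡ boxesOf T D i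
      identify σ a e≡ with canonical D bottom≤ (from v a)
      ... | along ς ς≡ with strand-unique σ ς (trans e≡ (cong (edgeAt h) (sym (to-from v a))))
      ... | refl , boxes≡ = refl , trans boxes≡ ς≡
    ... | refl , σ≡ | refl , τ≡ = refl , refl , cong₂ shared σ≡ τ≡

    -- Common boxes and relative order change together, namely at a crossing entered by both
    -- strands. The boxes of a new flip are not above `g`, hence on neither list so far, and nothing
    -- is counted twice.
    parity-shared : ∀ {w h} (D : Descent ceilingLine w h) → (∀ j → bottomLine j ≤ h j) →
      let v = evaluate (tilesOf T D) in
      ∀ {i j} → i ≢ j → parity (shared (boxesOf T D i) (boxesOf T D j)) ≡ (i <ᵇ j) xor (to v i <ᵇ to v j)
    parity-shared (stop _) _ {i} {j} _ = sym (trans (cong ((i <ᵇ j) xor_)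
        (<ᵇ-cong-⇔ {c = i} {j} (λ lt → subst₂ _<_ (+--cancel i (+ k)) (+--cancel j (+ k)) (ℤₚ.+-monoˡ-< (- + k) lt)) (ℤₚ.+-monoˡ-< (+ k))))
      (Boolₚ.xor-same (i <ᵇ j)))
    parity-shared {d ∷ w} {h} (flip {g = g} d D up flat L) bottom≤ {i} {j} i≢j =
      by-tile (T (cornerBox g d)) refl (hit-view d (to v i)) (hit-view d (to v j)) refl refl
      where
      open Flip D up flat L bottom≤ using (v; corner-tile)
      xs ys : List Box
      xs = boxesOf T D i
      ys = boxesOf T D j

      IH : parity (shared xs ys) ≡ (i <ᵇ j) xor (to v i <ᵇ to v j)
      IH = parity-shared D (λ j → ℤₚ.≤-trans (bottom≤ j) (lowered-≤ L j)) i≢j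

      vi≢vj : to v i ≢ to v j
      vi≢vj = i≢j ∘ to-injective v

      fresh : ∀ c i → cornerBox g c ∉ boxesOf T D i
      fresh c i b∈ = cornerBox-not-above g c (All.lookup (boxes-above T D i) b∈)

      fresh-∷ : ∀ {c c′} j → c ≢ c′ → cornerBox g c ∉ cornerBox g c′ ∷ boxesOf T D j
      fresh-∷ j c≢c′ (here eq)   = c≢c′ (cornerBox-injective g eq)
      fresh-∷ {c} j c≢c′ (there b∈) = fresh c j b∈

      shared-apart : ∀ c c′ → (∀ {x} → c ≡ just x → c′ ≢ just x) → shared (visit g c xs) (visit g c′ ys) ≡ shared xs ys
      shared-apart nothing  nothing   _     = refl
      shared-apart nothing  (just c′) _     = shared-∉ʳ xs ys (fresh c′ i)
      shared-apart (just c) nothing   _     = shared-∉ˡ xs ys (fresh c j)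
      shared-apart (just c) (just c′) apart = trans
        (shared-∉ˡ xs (cornerBox g c′ ∷ ys) (fresh-∷ j (λ c≡c′ → apart refl (cong just (sym c≡c′)))))
        (shared-∉ʳ xs ys (fresh c′ i))

      swap-apart : ∀ {a b} → a ≢ b → (∀ {x} → hit d a ≡ just x → hit d b ≢ just x) →
                   (to (σ d) a <ᵇ to (σ d) b) ≡ (a <ᵇ b)
      swap-apart {a} {b} a≢b apart = <ᵇ-cong-⇔
        (λ σlt → ≮⇒≢⇒> (λ b<a → ℤₚ.<-asym σlt (σ-monotone d b<a
          (λ { (p , refl) → apart (hit-next p) (hit-at p) }))) (a≢b ∘ sym))
        (λ a<b → σ-monotone d a<b (λ { (p , refl) → apart (hit-at p) (hit-next p) }))

      meet : ∀ {a b x} → Hit d a (just x) → Hit d b (just x) → a ≢ b →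
             x ≋ d × (to (σ d) a <ᵇ to (σ d) b) ≡ not (a <ᵇ b)
      meet (viaLeft p eq)            (viaLeft _ _)            a≢b = contradiction refl a≢b
      meet {a} {b} (viaLeft p eq)    (viaTop _ _ refl eq′)  a≢b = p , (begin
        (to (σ d) a <ᵇ to (σ d) (a + 1ℤ))   ≡⟨ cong₂ _<ᵇ_ eq eq′ ⟩
        (a + 1ℤ <ᵇ a)                       ≡⟨ <ᵇ-flip {a} {a + 1ℤ} a≢b ⟩
        not (a <ᵇ a + 1ℤ)                   ∎)
      meet {a} {b} (viaTop _ p refl eq) (viaLeft _ eq′)     a≢b = p , (begin
        (to (σ d) (b + 1ℤ) <ᵇ to (σ d) b)   ≡⟨ cong₂ _<ᵇ_ eq eq′ ⟩
        (b <ᵇ b + 1ℤ)                       ≡⟨ <ᵇ-flip {b + 1ℤ} {b} a≢b ⟩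
        not (b + 1ℤ <ᵇ b)                   ∎)
      meet (viaTop _ _ refl _)     (viaTop _ _ refl _)    a≢b = contradiction refl a≢b

      xor-not : ∀ x y → x xor not y ≡ not (x xor y)
      xor-not true  y = refl
      xor-not false y = refl

      apart-case : ∀ {t c c′} → hit d (to v i) ≡ c → hit d (to v j) ≡ c′ → (∀ {x} → c ≡ just x → c′ ≢ just x) →
        parity (shared (visit g c xs) (visit g c′ ys)) ≡ (i <ᵇ j) xor (to (act t d v) i <ᵇ to (act t d v) j)
      apart-case {elbow} {c} {c′} _ _ apart = trans (cong parity (shared-apart c c′ apart)) IH
      apart-case {crossing} {c} {c′} refl refl apart = trans (cong parity (shared-apart c c′ apart))
        (trans IH (cong ((i <ᵇ j) xor_) (sym (swap-apart vi≢vj apart))))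

      by-tile : ∀ t → T (cornerBox g d) ≡ t → ∀ {c c′} → Hit d (to v i) c → Hit d (to v j) c′ →
        hit d (to v i) ≡ c → hit d (to v j) ≡ c′ →
        parity (shared (visit g c xs) (visit g c′ ys)) ≡ (i <ᵇ j) xor (to (act t d v) i <ᵇ to (act t d v) j)
      by-tile t t≡ {nothing} {c′} _ _ e e′ = apart-case {t} e e′ (λ ())
      by-tile t t≡ {just c} {nothing} _ _ e e′ = apart-case {t} e e′ (λ _ ())
      by-tile t t≡ {just c} {just c′} H H′ e e′ with c ℤₚ.≟ c′
      ... | no c≢c′ = apart-case {t} e e′ (λ { refl refl → c≢c′ refl })
      by-tile crossing t≡ {just c} {just .c} H H′ e e′ | yes refl with meet H H′ vi≢vj
      ... | c≋d , swapped = begin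
        parity (shared (cornerBox g c ∷ xs) (cornerBox g c ∷ ys))   ≡⟨ cong parity (shared-crossing xs ys (trans (corner-tile c≋d) t≡) (fresh c i)) ⟩
        not (parity (shared xs ys))                                ≡⟨ cong not IH ⟩
        not ((i <ᵇ j) xor (to v i <ᵇ to v j))                      ≡⟨ xor-not (i <ᵇ j) _ ⟨
        (i <ᵇ j) xor not (to v i <ᵇ to v j)                        ≡⟨ cong ((i <ᵇ j) xor_) swapped ⟨
        (i <ᵇ j) xor (to (v · σ d) i <ᵇ to (v · σ d) j)            ∎
      by-tile elbow t≡ {just c} {just .c} H H′ e e′ | yes refl =
        trans (cong parity (shared-elbow xs ys (trans (corner-tile (proj₁ (meet H H′ vi≢vj))) t≡) (fresh c i))) IH

    private
      parity-corner : ∀ {w h} (D : Descent ceilingLine w h) (bottom≤ : ∀ j → bottomLine j ≤ h j) c →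
        let v = evaluate (tilesOf T D) in
        parity (shared (boxesOf T D (from v c)) (boxesOf T D (from v (c + 1ℤ)))) ≡ not (from v c <ᵇ from v (c + 1ℤ))
      parity-corner {w} D bottom≤ c = trans
        (parity-shared D bottom≤ (λ eq → a≢a+1 (to-injective (v ⁻¹) eq)))
        (trans (cong ((from v c <ᵇ from v (c + 1ℤ)) xor_)
          (trans (cong₂ _<ᵇ_ (to-from v c) (to-from v (c + 1ℤ))) (<⇒<ᵇ (a<a+1 c))))
          (Boolₚ.xor-comm _ true))
        where
        v : AffinePerm n
        v = evaluate (tilesOf T D)

      <ᵇ⇒< : ∀ {a b} → not (a <ᵇ b) ≡ false → a < b
      <ᵇ⇒< {a} {b} eq with a ℤₚ.<? b
      ... | yes p = p

    -- The strands entering the corner box at d are those at the positions d and d + 1; an even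
    -- number of crossings says that their labels increase in the same order.
    elbowsEven⇒distinguished : ElbowsEven F → ∀ {w h} (D : Descent ceilingLine w h) → (∀ j → bottomLine j ≤ h j) →
                               Distinguished (tilesOf T D)
    elbowsEven⇒distinguished even (stop _) _ = tt
    elbowsEven⇒distinguished even {d ∷ w} (flip {g = g} d D up flat L) bottom≤ =
      elbowsEven⇒distinguished even D bottom≤′ , ascent
      where
      open Flip D up flat L bottom≤
      bottom≤′ : ∀ j → bottomLine j ≤ g j
      bottom≤′ j = ℤₚ.≤-trans (bottom≤ j) (lowered-≤ L j)
      ascent : T (cornerBox g d) ≡ elbow → from v d < from v (d + 1ℤ)
      ascent t with canonical D bottom≤′ (from v d) | canonical D bottom≤′ (from v (d + 1ℤ))
      ... | α | β with along-cong (trans (cong (edgeAt g) (to-from v d)) (left≡ ≋-refl)) α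
                     | along-cong (trans (cong (edgeAt g) (to-from v (d + 1ℤ))) (top≡ ≋-refl)) β
      ... | along σ σ≡ | along τ τ≡ = <ᵇ⇒< (trans (sym (parity-corner D bottom≤′ d))
        (parity-∣ _ (subst₂ (λ xs ys → 2 ℕDiv.∣ shared xs ys) σ≡ τ≡
          (even (cornerBox g d) (corner-inStrip ≋-refl) t σ τ))))

    -- Going back from the southern end, each box of the strip is met as a corner box of some flip.
    -- Periodicity carries the ascent at the letter d to the actual vertex of the box.
    distinguished⇒elbowsEven : ∀ {w} (D : Descent ceilingLine w bottomLine) → Distinguished (tilesOf T D) → ElbowsEven F
    distinguished⇒elbowsEven D dist b b∈ t σ τ with InStrip⇒Inside P b∈
    ... | inside above below = descend D (λ j → ℤₚ.≤-refl) dist above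
      where
      descend : ∀ {w h} (D : Descent ceilingLine w h) → (∀ j → bottomLine j ≤ h j) → Distinguished (tilesOf T D) →
                Above h b → 2 ℕDiv.∣ crossings F σ τ
      descend (stop h≗top) _ _ above = contradiction below (ℤₚ.≤⇒≯ (subst (_≤ proj₂ b) (h≗top (middle b)) above))
      descend {d ∷ w} (flip {g = g} d D up flat L) bottom≤ (dist , asc) above with above-lowered L above
      ... | inj₁ above′ = descend D (λ j → ℤₚ.≤-trans (bottom≤ j) (lowered-≤ L j)) dist above′
      ... | inj₂ (c≋d , b≡) = conclude
        where
        open Flip D up flat L bottom≤
        c : ℤ
        c = middle b
        bottom≤′ : ∀ j → bottomLine j ≤ g j
        bottom≤′ j = ℤₚ.≤-trans (bottom≤ j) (lowered-≤ L j)
        ascent : from v c < from v (c + 1ℤ)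
        ascent = ascent-≋ {d} (v ⁻¹) c≋d (asc (trans (sym (corner-tile c≋d)) (trans (cong T (sym b≡)) t)))
        conclude : 2 ℕDiv.∣ crossings F σ τ
        conclude with canonical-crossings D bottom≤′ σ τ c (c + 1ℤ) (trans (cong left b≡) (sym (left≡ c≋d)))
                                                                  (trans (cong top b≡) (sym (top≡ c≋d)))
        ... | refl , refl , eq = subst (2 ℕDiv.∣_) (sym eq) (∣-parity _
          (trans (parity-corner D bottom≤′ c) (cong not (<⇒<ᵇ ascent))))

    module _ {w} (D : Descent ceilingLine w bottomLine) (f : AffinePerm n) where
      private
        v : AffinePerm n
        v = evaluate (tilesOf T D)

      evaluate⇒strandPermutation : v ≐ f → IsStrandPermutation F f
      evaluate⇒strandPermutation v≐f i = subst (Strand F i) (trans (cong (edgeAt bottomLine) (v≐f i)) (sym (southEdge≡ P (to f i))))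
        (Along.strand (canonical D (λ _ → ℤₚ.≤-refl) i))

      -- The strand of label i and the canonical strand arriving at the same southern edge coincide,
      -- hence so do their labels.
      strandPermutation⇒evaluate : IsStrandPermutation F f → v ≐ f
      strandPermutation⇒evaluate perm i = trans (cong (to v) i≡) (to-from v (to f i))
        where
        α = canonical D (λ _ → ℤₚ.≤-refl) (from v (to f i))
        i≡ : i ≡ from v (to f i)
        i≡ = proj₁ (strand-unique (perm i) (Along.strand α)
          (trans (southEdge≡ P (to f i)) (cong (edgeAt bottomLine) (sym (to-from v (to f i))))))

  -- Enumeration of the affine Deograms

  private
    undo : ∀ {v u d} → v · σ d ≐ u → v ≐ u · σ d
    undo {v} {u} {d} eq a = trans (sym (σσ d (to v a))) (cong (to (σ d)) (eq a))

    ascends : ∀ {v u d} → v ≐ u → from v d < from v (d + 1ℤ) → (from u d <ᵇ from u (d + 1ℤ)) ≡ true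
    ascends {v} {u} {d} v≐u lt = <⇒<ᵇ (subst₂ _<_ (from-cong {v} {u} v≐u d) (from-cong {v} {u} v≐u (d + 1ℤ)) lt)

  -- The bijection behind the recurrence: a crossing as last tile leads to the first summand, an
  -- elbow to the second, which is present because the tiling is distinguished.
  rank : ∀ {w} v (ts : Tiling w) → Distinguished ts → evaluate ts ≐ v → Fin (N v w)
  rank v [] _ eq with v ≐? shift
  ... | yes _ = Fin.zero
  ... | no ¬p = contradiction (λ a → sym (eq a)) ¬p
  rank {d ∷ w} v (crossing ∷ ts) (dist , _) eq =
    rank (v · σ d) ts dist (undo {evaluate ts} {v} {d} eq) ↑ˡ when (from v d <ᵇ from v (d + 1ℤ)) (N v w)
  rank {d ∷ w} v (elbow ∷ ts) (dist , asc) eq =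
    embedʳ (N (v · σ d) w) (from v d <ᵇ from v (d + 1ℤ)) (N v w) (ascends {evaluate ts} {v} eq (asc refl)) (rank v ts dist eq)

  rank-irrelevant : ∀ {w} v (ts : Tiling w) p p′ q q′ → rank v ts p q ≡ rank v ts p′ q′
  rank-irrelevant v [] p p′ q q′ = when-unique (does (v ≐? shift)) _ _
  rank-irrelevant {d ∷ w} v (crossing ∷ ts) p p′ q q′ =
    cong (_↑ˡ when (from v d <ᵇ from v (d + 1ℤ)) (N v w)) (rank-irrelevant (v · σ d) ts _ _ _ _)
  rank-irrelevant {d ∷ w} v (elbow ∷ ts) p p′ q q′ =
    cong (embedʳ (N (v · σ d) w) (from v d <ᵇ from v (d + 1ℤ)) (N v w) (ascends {evaluate ts} {v} q (proj₂ p refl))) (rank-irrelevant v ts _ _ _ _)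

  rank-cong : ∀ {w} v {ts ts′ : Tiling w} → ts ≡ ts′ → ∀ p p′ q q′ → rank v ts p q ≡ rank v ts′ p′ q′
  rank-cong v {ts} refl = rank-irrelevant v ts

  rank-injective : ∀ {w} v (ts ts′ : Tiling w) {p p′ q q′} → rank v ts p q ≡ rank v ts′ p′ q′ → ts ≡ ts′
  rank-injective v [] [] _ = refl
  rank-injective {d ∷ w} v (crossing ∷ ts) (crossing ∷ ts′) eq =
    cong (crossing ∷_) (rank-injective (v · σ d) ts ts′ (Finₚ.↑ˡ-injective _ _ _ eq))
  rank-injective {d ∷ w} v (elbow ∷ ts) (elbow ∷ ts′) {p} {q = q} eq =
    cong (elbow ∷_) (rank-injective v ts ts′
      (embedʳ-injective (N (v · σ d) w) (from v d <ᵇ from v (d + 1ℤ)) (N v w) (ascends {evaluate ts} {v} q (proj₂ p refl)) eq))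
  rank-injective {d ∷ w} v (crossing ∷ ts) (elbow ∷ ts′) {p′ = p} {q′ = q} eq = contradiction eq
    (embed-disjoint (N (v · σ d) w) (from v d <ᵇ from v (d + 1ℤ)) (N v w) (ascends {evaluate ts′} {v} q (proj₂ p refl)))
  rank-injective {d ∷ w} v (elbow ∷ ts) (crossing ∷ ts′) {p} {q = q} eq = contradiction (sym eq)
    (embed-disjoint (N (v · σ d) w) (from v d <ᵇ from v (d + 1ℤ)) (N v w) (ascends {evaluate ts} {v} q (proj₂ p refl)))

  rank-surjective : ∀ w v (x : Fin (N v w)) → ∃ λ (ts : Tiling w) → ∃₂ λ p q → rank v ts p q ≡ x
  rank-surjective [] v x = [] , tt , equal x , when-unique _ _ x
    where
    equal : Fin (N v []) → shift ≐ v
    equal x with v ≐? shift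
    equal x  | yes p = λ a → sym (p a)
    equal () | no _
  rank-surjective (d ∷ w) v x
    with embed-cover (N (v · σ d) w) (from v d <ᵇ from v (d + 1ℤ)) (N v w) x
  ... | inj₁ (y , refl) with rank-surjective w (v · σ d) y
  ... | ts , p , q , refl = crossing ∷ ts , (p , λ ()) , redo
      , cong (_↑ˡ when (from v d <ᵇ from v (d + 1ℤ)) (N v w)) (rank-irrelevant (v · σ d) ts _ _ _ _)
    where
    redo : evaluate ts · σ d ≐ v
    redo a = trans (cong (to (σ d)) (q a)) (σσ d (to v a))
  rank-surjective (d ∷ w) v x | inj₂ (asc , y , refl) with rank-surjective w v y
  ... | ts , p , q , refl = elbow ∷ ts , (p , λ _ → ascent) , q
      , cong (embedʳ (N (v · σ d) w) (from v d <ᵇ from v (d + 1ℤ)) (N v w) asc) (rank-irrelevant v ts _ _ _ _)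
    where
    ascent : from (evaluate ts) d < from (evaluate ts) (d + 1ℤ)
    ascent with from v d ℤₚ.<? from v (d + 1ℤ)
    ... | yes lt = subst₂ _<_ (sym (from-cong {evaluate ts} {v} q d)) (sym (from-cong {evaluate ts} {v} q (d + 1ℤ))) lt

  OnCorner : (ℤ → ℤ) → ℤ → Box → Set
  OnCorner g d b = middle b ≋ d × proj₂ b ≡ g (middle b) - 1ℤ

  onCorner? : ∀ g d b → Dec (OnCorner g d b)
  onCorner? g d b = (middle b ≋? d) ×-dec (proj₂ b ℤₚ.≟ g (middle b) - 1ℤ)

  fill : ∀ {top w h} → Descent top w h → Tiling w → Box → Tile
  -- A box that no flip cuts off. For a word of the strip it lies outside, where fillings are not
  -- compared, so the tile is arbitrary.
  fill (stop _) [] b = crossing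
  fill (flip {g = g} d D _ _ _) (t ∷ ts) b with onCorner? g d b
  ... | yes _ = t
  ... | no  _ = fill D ts b

  fill-corner : ∀ {top w g h d} (D : Descent top w g) up flat (L : Lowered d g h) t (ts : Tiling w) →
                fill (flip d D up flat L) (t ∷ ts) (cornerBox g d) ≡ t
  fill-corner {g = g} {d = d} D up flat L t ts with onCorner? g d (cornerBox g d)
  ... | yes _ = refl
  ... | no ¬p = contradiction (≋-reflexive (middle-cornerBox g d) , cong (λ j → g j - 1ℤ) (sym (middle-cornerBox g d))) ¬p

  fill-above : ∀ {top w g h d} (D : Descent top w g) up flat (L : Lowered d g h) t (ts : Tiling w) {b} → Above g b →
               fill (flip d D up flat L) (t ∷ ts) b ≡ fill D ts b
  fill-above {g = g} {d = d} D up flat L t ts {b} above with onCorner? g d b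
  ... | yes (_ , y≡) = contradiction (subst (g (middle b) ≤_) y≡ above) (ℤₚ.<⇒≱ (a-1<a (g (middle b))))
  ... | no _         = refl

  tilesOf-cong : ∀ {top w h T T′} (D : Descent top w h) → (∀ b → Above h b → T b ≡ T′ b) → tilesOf T D ≡ tilesOf T′ D
  tilesOf-cong (stop _) _ = refl
  tilesOf-cong {h = h} (flip {g = g} d D _ _ L) same = cong₂ _∷_
    (same (cornerBox g d) (subst (λ j → h j ≤ g d - 1ℤ) (sym (middle-cornerBox g d)) (ℤₚ.≤-reflexive (at L ≋-refl))))
    (tilesOf-cong D (λ b above → same b (ℤₚ.≤-trans (lowered-≤ L (middle b)) above)))

  tilesOf-fill : ∀ {top w h} (D : Descent top w h) (ts : Tiling w) → tilesOf (fill D ts) D ≡ ts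
  tilesOf-fill (stop _) [] = refl
  tilesOf-fill (flip d D up flat L) (t ∷ ts) = cong₂ _∷_ (fill-corner D up flat L t ts)
    (trans (tilesOf-cong D (λ b → fill-above D up flat L t ts)) (tilesOf-fill D ts))

  module _ (P : LatticePath k n) where
    module _ {g} (G : Profile (+ k) g) (d : ℤ) (b : Box) where
      private
        middle≡ : middle (b ⊕ period P) ≡ middle b + + n
        middle≡ = eq (proj₁ b) (proj₂ b) (+ n) (+ k)
          where
          eq : ∀ x y n k → x + (n - k) + (y + k) + 1ℤ ≡ x + y + 1ℤ + n
          eq = solve-∀

        level≡ : g (middle (b ⊕ period P)) - 1ℤ ≡ g (middle b) - 1ℤ + + k
        level≡ = trans (cong (λ j → g j - 1ℤ) middle≡)
          (trans (cong (_- 1ℤ) (slope G (middle b))) (+-swap (g (middle b)) (+ k) -1ℤ))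

        middle≋ : middle (b ⊕ period P) ≋ middle b
        middle≋ = subst (_≋ middle b) (sym middle≡) (≋-period (middle b))

      onCorner-period : OnCorner g d b → OnCorner g d (b ⊕ period P)
      onCorner-period (p , q) = ≋-trans middle≋ p , trans (cong (_+ + k) q) (sym level≡)

      onCorner-period⁻¹ : OnCorner g d (b ⊕ period P) → OnCorner g d b
      onCorner-period⁻¹ (p , q) = ≋-trans (≋-sym middle≋) p , +-cancelʳ (+ k) (trans q level≡)

    fill-periodic : ∀ {top w h} → Profile (+ k) top → (D : Descent top w h) (ts : Tiling w) → ∀ b →
                    fill D ts (b ⊕ period P) ≡ fill D ts b
    fill-periodic Tᵖ (stop _) [] b = refl
    fill-periodic Tᵖ (flip {g = g} d D up flat L) (t ∷ ts) b with onCorner? g d (b ⊕ period P) | onCorner? g d b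
    ... | yes _ | yes _ = refl
    ... | no _  | no _  = fill-periodic Tᵖ D ts b
    ... | yes p | no ¬p = contradiction (onCorner-period⁻¹ (descent-profile Tᵖ D) d b p) ¬p
    ... | no ¬p | yes p = contradiction (onCorner-period (descent-profile Tᵖ D) d b p) ¬p

    tilesOf-≈ : ∀ {F G : Filling P} → F ≈ G → ∀ {w h} (D : Descent (ceiling P) w h) → (∀ j → height P j ≤ h j) →
                tilesOf (tile F) D ≡ tilesOf (tile G) D
    tilesOf-≈ F≈G (stop _) _ = refl
    tilesOf-≈ {F} {G} F≈G (flip {g = g} d D up flat L) bottom≤ = cong₂ _∷_
      (F≈G (cornerBox g d) (Strands.Flip.corner-inStrip F D up flat L bottom≤ ≋-refl))
      (tilesOf-≈ {F} {G} F≈G D (λ j → ℤₚ.≤-trans (bottom≤ j) (lowered-≤ L j)))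

    tilesOf-injective : ∀ {F G : Filling P} {w} (D : Descent (ceiling P) w (height P)) →
                        tilesOf (tile F) D ≡ tilesOf (tile G) D → F ≈ G
    tilesOf-injective {F} {G} D eq b b∈ with InStrip⇒Inside P b∈
    ... | inside above below = descend D (λ _ → ℤₚ.≤-refl) eq above
      where
      descend : ∀ {w h} (D : Descent (ceiling P) w h) → (∀ j → height P j ≤ h j) →
                tilesOf (tile F) D ≡ tilesOf (tile G) D → Above h b → tile F b ≡ tile G b
      descend (stop h≗top) _ _ above = contradiction below (ℤₚ.≤⇒≯ (subst (_≤ proj₂ b) (h≗top (middle b)) above))
      descend (flip {g = g} d D up flat L) bottom≤ eq above with above-lowered L above
      ... | inj₁ above′ = descend D (λ j → ℤₚ.≤-trans (bottom≤ j) (lowered-≤ L j)) (cong All.tail eq) above′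
      ... | inj₂ (c≋d , b≡) = begin
        tile F b                              ≡⟨ cong (tile F) b≡ ⟩
        tile F (cornerBox g (middle b))       ≡⟨ Strands.Flip.corner-tile F D up flat L bottom≤ c≋d ⟩
        tile F (cornerBox g d)                ≡⟨ cong All.head eq ⟩
        tile G (cornerBox g d)                ≡⟨ Strands.Flip.corner-tile G D up flat L bottom≤ c≋d ⟨
        tile G (cornerBox g (middle b))       ≡⟨ cong (tile G) b≡ ⟨
        tile G b                              ∎

    IsWord : List ℤ → Set
    IsWord w = Descent (ceiling P) w (height P)

    -- Two fillings agree on the strip exactly when their tiles agree along the flips, so the setoid
    -- equality becomes equality of ranks.
    enumeration : ∀ {w} → IsWord w → (f : AffinePerm n) → Inverse (Deo f P) (setoid (Fin (N f w)))
    enumeration {w} D f = Bijection⇒Inverse record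
      { to        = toFin
      ; cong      = λ {E} {E′} E≈E′ → rank-cong f (tilesOf-≈ {filling E} {filling E′} E≈E′ D (λ _ → ℤₚ.≤-refl)) _ _ _ _
      ; bijective = (λ {E} {E′} eq → tilesOf-injective {filling E} {filling E′} D (rank-injective f _ _ eq)) , surjective
      }
      where
      open Deogram
      reading : Deogram f P → Tiling w
      reading E = tilesOf (tile (filling E)) D
      toFin : Deogram f P → Fin (N f w)
      toFin E = rank f (reading E)
        (Strands.elbowsEven⇒distinguished (filling E) (elbowsEven E) D (λ _ → ℤₚ.≤-refl))
        (Strands.strandPermutation⇒evaluate (filling E) D f (strandPermutation E))
      surjective : ∀ x → ∃ λ E → ∀ {E′ : Deogram f P} → filling E′ ≈ filling E → toFin E′ ≡ x
      surjective x with rank-surjective w f x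
      ... | ts , dist , ev , rank≡ = E , λ {E′} E′≈E →
        trans (rank-cong f (trans (tilesOf-≈ {filling E′} {F} E′≈E D (λ _ → ℤₚ.≤-refl)) tiles≡) _ dist _ ev) rank≡
        where
        F : Filling P
        F = record { tile = fill D ts ; periodic = λ b _ → fill-periodic (ceiling-profile P) D ts b }
        tiles≡ : tilesOf (tile F) D ≡ ts
        tiles≡ = tilesOf-fill D ts
        E : Deogram f P
        E = record
          { filling           = F
          ; strandPermutation = Strands.evaluate⇒strandPermutation F D f
              (subst (λ us → evaluate us ≐ f) (sym tiles≡) ev)
          ; elbowsEven        = Strands.distinguished⇒elbowsEven F D (subst Distinguished (sym tiles≡) dist)
          }

  module _ {P Q : LatticePath k n} {w w′} (D : IsWord P w) (E : IsWord Q w′) where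
    bijection-≡ : ∀ {f g} → N f w ≡ N g w′ → Bijection (Deo f P) (Deo g Q)
    bijection-≡ {f} {g} eq = Inverse⇒Bijection (Composition.inverse (enumeration P D f)
      (Symmetry.inverse (subst (λ m → Inverse (Deo g Q) (setoid (Fin m))) (sym eq) (enumeration Q E g))))

    bijection-+ : ∀ {f g₁ g₂} → N f w ≡ N g₁ w′ ℕ.+ N g₂ w′ → Bijection (Deo f P) (Deo g₁ Q ⊎ₛ Deo g₂ Q)
    bijection-+ {f} {g₁} {g₂} eq = Inverse⇒Bijection (Composition.inverse (enumeration P D f)
      (Symmetry.inverse (subst (λ m → Inverse (Deo g₁ Q ⊎ₛ Deo g₂ Q) (setoid (Fin m))) (sym eq)
        (Composition.inverse (enumeration Q E g₁ ⊎-inverse enumeration Q E g₂)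
          (Composition.inverse (Pointwise-≡↔≡ _ _) (Symmetry.inverse Finₚ.+↔⊎))))))

  -- Comparison of the recurrences

  module _ (d : ℤ) where
    Ascent-at : AffinePerm n → Set
    Ascent-at g = to g d < to g (d + 1ℤ)

    ascent-or-descent : ∀ g → Ascent-at g ⊎ to g (d + 1ℤ) < to g d
    ascent-or-descent g with ℤₚ.<-cmp (to g d) (to g (d + 1ℤ))
    ... | tri< lt _ _ = inj₁ lt
    ... | tri≈ _ eq _ = contradiction (to-injective g eq) a≢a+1
    ... | tri> _ _ gt = inj₂ gt

    ℓ-σ·-≤ : ∀ g → ℓ (σ d · g) ℕ.≤ suc (ℓ g)
    ℓ-σ·-≤ g with ascent-or-descent g
    ... | inj₁ asc  = ℕₚ.≤-reflexive (ℓ-ascent g asc)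
    ... | inj₂ desc = ℕₚ.≤-trans (ℕₚ.n≤1+n _) (ℕₚ.≤-trans (ℕₚ.≤-reflexive (sym (ℓ-descent d g desc))) (ℕₚ.n≤1+n _))

    ℓ<⇒ascent : ∀ g → ℓ g ℕ.< ℓ (σ d · g) → Ascent-at g
    ℓ<⇒ascent g lt with ascent-or-descent g
    ... | inj₁ asc  = asc
    ... | inj₂ desc = contradiction lt (ℕₚ.≤⇒≯ (ℕₚ.≤-trans (ℕₚ.n≤1+n _) (ℕₚ.≤-reflexive (sym (ℓ-descent d g desc)))))

    ℓ-·σ-≤ : ∀ g → ℓ (g · σ d) ℕ.≤ suc (ℓ g)
    ℓ-·σ-≤ g = subst₂ (λ x y → x ℕ.≤ suc y) (sym (ℓ-·σ d g)) (ℓ-⁻¹ g) (ℓ-σ·-≤ (g ⁻¹))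

    ℓ<⇒ascent⁻¹ : ∀ g → ℓ g ℕ.< ℓ (g · σ d) → Ascent-at (g ⁻¹)
    ℓ<⇒ascent⁻¹ g lt = ℓ<⇒ascent (g ⁻¹) (subst₂ ℕ._<_ (sym (ℓ-⁻¹ g)) (ℓ-·σ d g) lt)

    module _ (φ : AffinePerm n → ℕ) where
      λ-ascent : ∀ g → Ascent-at g → λ′ d φ g ≡ φ (σ d · g) ℕ.+ φ g
      λ-ascent g asc = cong (λ b → φ (σ d · g) ℕ.+ when b (φ g)) (<⇒<ᵇ asc)

      ρ-ascent : ∀ g → Ascent-at (g ⁻¹) → ρ d φ g ≡ φ (g · σ d) ℕ.+ φ g
      ρ-ascent g asc = cong (λ b → φ (g · σ d) ℕ.+ when b (φ g)) (<⇒<ᵇ asc)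

    module _ {φ : AffinePerm n → ℕ} (φ-resp : Respectful φ) where
      λ-descent : ∀ g → Ascent-at g → λ′ d φ (σ d · g) ≡ φ g
      λ-descent g asc = trans (cong₂ (λ m b → m ℕ.+ when b (φ (σ d · g)))
          (φ-resp (σ d · (σ d · g)) g (λ a → cong (to g) (σσ d a)))
          (≮⇒<ᵇ (ℤₚ.<-asym (subst₂ (λ x y → to g x < to g y)
            (sym (trans (σ-next {d} ≋-refl) (+1-1 d))) (sym (σ-at {d} ≋-refl)) asc))))
        (ℕₚ.+-identityʳ (φ g))

      ρ-descent : ∀ g → Ascent-at (g ⁻¹) → ρ d φ (g · σ d) ≡ φ g
      ρ-descent g asc = trans (cong₂ (λ m b → m ℕ.+ when b (φ (g · σ d)))
          (φ-resp (g · σ d · σ d) g (λ a → σσ d (to g a)))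
          (≮⇒<ᵇ (ℤₚ.<-asym (subst₂ _<_
            (sym (trans (from-·σ g d (d + 1ℤ)) (cong (from g) (trans (σ-next {d} ≋-refl) (+1-1 d)))))
            (sym (trans (from-·σ g d d) (cong (from g) (σ-at {d} ≋-refl)))) asc))))
        (ℕₚ.+-identityʳ (φ g))

    -- A multiplication by the generator adds at most one to the length. A gain of two therefore
    -- makes all four edges of the square f, s f, f s, s f s ascents.
    module Rising (f : AffinePerm n) (+2 : ℓ (σ d · f · σ d) ≡ ℓ f ℕ.+ 2) where
      private
        +2′ : ℓ (σ d · f · σ d) ≡ suc (suc (ℓ f))
        +2′ = trans +2 (ℕₚ.+-comm (ℓ f) 2)

        assoc : ℓ (σ d · f · σ d) ≡ ℓ (σ d · (f · σ d))
        assoc = ℓ-cong {σ d · f · σ d} {σ d · (f · σ d)} (λ _ → refl)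

        sf fs : ℕ
        sf = ℓ (σ d · f)
        fs = ℓ (f · σ d)

        sf≡ : sf ≡ suc (ℓ f)
        sf≡ = ℕₚ.≤-antisym (ℓ-σ·-≤ f) (ℕ.s≤s⁻¹ (subst (ℕ._≤ suc sf) +2′ (ℓ-·σ-≤ (σ d · f))))

        fs≡ : fs ≡ suc (ℓ f)
        fs≡ = ℕₚ.≤-antisym (ℓ-·σ-≤ f) (ℕ.s≤s⁻¹ (subst (ℕ._≤ suc fs) (trans (sym assoc) +2′) (ℓ-σ·-≤ (f · σ d))))

      f-ascent : Ascent-at f
      f-ascent = ℓ<⇒ascent f (ℕₚ.≤-reflexive (sym sf≡))

      f⁻¹-ascent : Ascent-at (f ⁻¹)
      f⁻¹-ascent = ℓ<⇒ascent⁻¹ f (ℕₚ.≤-reflexive (sym fs≡))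

      sf⁻¹-ascent : Ascent-at ((σ d · f) ⁻¹)
      sf⁻¹-ascent = ℓ<⇒ascent⁻¹ (σ d · f) (ℕₚ.≤-reflexive (trans (cong suc sf≡) (sym +2′)))

      fs-ascent : Ascent-at (f · σ d)
      fs-ascent = ℓ<⇒ascent (f · σ d) (ℕₚ.≤-reflexive (trans (cong suc fs≡) (trans (sym +2′) assoc)))

    -- In the square f, s f, f s, s f s the top is s f and the bottom is f s, with f and s f s at
    -- the same height between them.
    module Level (f : AffinePerm n) (same : ℓ f ≡ ℓ (σ d · f · σ d))
                 (f<sf : ℓ f ℕ.< ℓ (σ d · f)) (fs<f : ℓ (f · σ d) ℕ.< ℓ f) where
      f-ascent : Ascent-at f
      f-ascent = ℓ<⇒ascent f f<sf

      fs⁻¹-ascent : Ascent-at ((f · σ d) ⁻¹)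
      fs⁻¹-ascent = ℓ<⇒ascent⁻¹ (f · σ d) (subst (ℓ (f · σ d) ℕ.<_)
        (ℓ-cong {f} {f · σ d · σ d} (λ a → sym (σσ d (to f a)))) fs<f)

      fs-ascent : Ascent-at (f · σ d)
      fs-ascent = ℓ<⇒ascent (f · σ d) (subst (ℓ (f · σ d) ℕ.<_)
        (trans same (ℓ-cong {σ d · f · σ d} {σ d · (f · σ d)} (λ _ → refl))) fs<f)

      sfs⁻¹-ascent : Ascent-at ((σ d · f · σ d) ⁻¹)
      sfs⁻¹-ascent = ℓ<⇒ascent⁻¹ (σ d · f · σ d) (subst₂ ℕ._<_ same
        (ℓ-cong {σ d · f} {σ d · f · σ d · σ d} (λ a → sym (σσ d (to (σ d · f) a)))) f<sf)

    module _ (f : AffinePerm n) (w : List ℤ) where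
      private
        φ : AffinePerm n → ℕ
        φ u = N u w

        φ-resp : Respectful φ
        φ-resp = N-respectful w

      module _ (commutes : d ∷ w ∼ w ∷ʳ (d + + k)) where
        private
          ρ≡λ : ∀ v → ρ d φ v ≡ λ′ d φ v
          ρ≡λ v = trans (N-∼ commutes v) (N-∷ʳ d w v)

        -- Evaluation at s f: the left operator descends to f alone, while the right operator is at
        -- an ascent and yields two terms.
        rising-commuting : ℓ (σ d · f · σ d) ≡ ℓ f ℕ.+ 2 → N f w ≡ N (σ d · f) w ℕ.+ N (σ d · f · σ d) w
        rising-commuting +2 = begin
          φ f                                     ≡⟨ λ-descent φ-resp f (Rising.f-ascent f +2) ⟨
          λ′ d φ (σ d · f)                        ≡⟨ ρ≡λ (σ d · f) ⟨
          ρ d φ (σ d · f)                         ≡⟨ ρ-ascent φ (σ d · f) (Rising.sf⁻¹-ascent f +2) ⟩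
          φ (σ d · f · σ d) ℕ.+ φ (σ d · f)       ≡⟨ ℕₚ.+-comm (φ (σ d · f · σ d)) (φ (σ d · f)) ⟩
          φ (σ d · f) ℕ.+ φ (σ d · f · σ d)       ∎

        -- At the top s f of the square both operators descend, the left one to f and the right one
        -- to s f s.
        level-commuting : ℓ f ≡ ℓ (σ d · f · σ d) → ℓ f ℕ.< ℓ (σ d · f) → ℓ (f · σ d) ℕ.< ℓ f →
                          N f w ≡ N (σ d · f · σ d) w
        level-commuting same f<sf fs<f = begin
          φ f                                     ≡⟨ λ-descent φ-resp f (Level.f-ascent f same f<sf fs<f) ⟨
          λ′ d φ (σ d · f)                        ≡⟨ ρ≡λ (σ d · f) ⟨
          ρ d φ (σ d · f)                         ≡⟨ ρ-respectful d φ φ-resp (σ d · f) (σ d · f · σ d · σ d)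
                                                       (λ a → sym (σσ d (to (σ d · f) a))) ⟩
          ρ d φ (σ d · f · σ d · σ d)             ≡⟨ ρ-descent φ-resp (σ d · f · σ d) (Level.sfs⁻¹-ascent f same f<sf fs<f) ⟩
          φ (σ d · f · σ d)                       ∎

      private
        λ-sfs : Ascent-at (f · σ d) → N (σ d · f · σ d) (w ∷ʳ (d + + k)) ≡ φ (f · σ d)
        λ-sfs asc = trans (N-respectful (w ∷ʳ (d + + k)) (σ d · f · σ d) (σ d · (f · σ d)) (λ _ → refl))
          (trans (N-∷ʳ d w (σ d · (f · σ d))) (λ-descent φ-resp (f · σ d) asc))

      -- The southern letter of P splits f into f and f s. The northern letter of s_i P descends to
      -- these two from s f and from s f s.
      rising-RU : ℓ (σ d · f · σ d) ≡ ℓ f ℕ.+ 2 →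
                  N f (d ∷ w) ≡ N (σ d · f) (w ∷ʳ (d + + k)) ℕ.+ N (σ d · f · σ d) (w ∷ʳ (d + + k))
      rising-RU +2 = begin
        ρ d φ f                                  ≡⟨ ρ-ascent φ f (Rising.f⁻¹-ascent f +2) ⟩
        φ (f · σ d) ℕ.+ φ f                      ≡⟨ ℕₚ.+-comm (φ (f · σ d)) (φ f) ⟩
        φ f ℕ.+ φ (f · σ d)                      ≡⟨ cong₂ ℕ._+_ (trans (N-∷ʳ d w (σ d · f)) (λ-descent φ-resp f (Rising.f-ascent f +2)))
                                                                (λ-sfs (Rising.fs-ascent f +2)) ⟨
        N (σ d · f) (w ∷ʳ (d + + k)) ℕ.+ N (σ d · f · σ d) (w ∷ʳ (d + + k)) ∎

      -- The mirror image: here the northern letter of P splits f, and the southern letter of s_i P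
      -- descends from f s and from s f s.
      rising-UR : ℓ (σ d · f · σ d) ≡ ℓ f ℕ.+ 2 →
                  N f (w ∷ʳ (d + + k)) ≡ N (f · σ d) (d ∷ w) ℕ.+ N (σ d · f · σ d) (d ∷ w)
      rising-UR +2 = begin
        N f (w ∷ʳ (d + + k))                     ≡⟨ N-∷ʳ d w f ⟩
        λ′ d φ f                                 ≡⟨ λ-ascent φ f (Rising.f-ascent f +2) ⟩
        φ (σ d · f) ℕ.+ φ f                      ≡⟨ ℕₚ.+-comm (φ (σ d · f)) (φ f) ⟩
        φ f ℕ.+ φ (σ d · f)                      ≡⟨ cong₂ ℕ._+_ (ρ-descent φ-resp f (Rising.f⁻¹-ascent f +2))
                                                                (ρ-descent φ-resp (σ d · f) (Rising.sf⁻¹-ascent f +2)) ⟨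
        N (f · σ d) (d ∷ w) ℕ.+ N (σ d · f · σ d) (d ∷ w) ∎

      -- Both sides descend to the bottom f s of the square, from f on the right and from s f s on
      -- the left.
      level-RU : ℓ f ≡ ℓ (σ d · f · σ d) → ℓ f ℕ.< ℓ (σ d · f) → ℓ (f · σ d) ℕ.< ℓ f →
                 N f (d ∷ w) ≡ N (σ d · f · σ d) (w ∷ʳ (d + + k))
      level-RU same f<sf fs<f = begin
        ρ d φ f                                  ≡⟨ ρ-respectful d φ φ-resp f (f · σ d · σ d)
                                                      (λ a → sym (σσ d (to f a))) ⟩
        ρ d φ (f · σ d · σ d)                    ≡⟨ ρ-descent φ-resp (f · σ d) (Level.fs⁻¹-ascent f same f<sf fs<f) ⟩
        φ (f · σ d)                              ≡⟨ λ-sfs (Level.fs-ascent f same f<sf fs<f) ⟨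
        N (σ d · f · σ d) (w ∷ʳ (d + + k))       ∎

  -- Words of P and of s_i P

  word-exists : k ℕ.≤ n → (P : LatticePath k n) → ∃ λ w → IsWord P w
  word-exists k≤n P with k ℕₚ.≟ 0 | k ℕₚ.≟ n
  -- For k = 0 and for k = n the path has only one kind of step and no corners; the two boundaries
  -- coincide and the strip has no boxes.
  ... | yes refl | _ = [] , stop (λ j → trans (cong (height P) (sym (ℤₚ.+-identityʳ j))) (sym (ℤₚ.+-identityʳ _)))
  ... | no _ | yes refl = [] , stop (λ j → trans (cong (height P) (eq j (+ k))) (slope (height-profile P) (j - + k)))
    where
    eq : ∀ j k → j ≡ j - k + k
    eq = solve-∀
  ... | no k≢0 | no k≢n = descent-exists (+<+ (ℕₚ.n≢0⇒n>0 k≢0)) (+<+ (ℕₚ.≤∧≢⇒< k≤n k≢n))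
                            (ceiling-profile P) (height-profile P) (height≤ceiling P)

  ceiling-raised : ∀ P d j → raise d (height P) (j - + k) + + k ≡ raise (d + + k) (ceiling P) j
  ceiling-raised P d j = by-cases (j - + k ≋? d)
    where
    by-cases : Dec (j - + k ≋ d) → raise d (height P) (j - + k) + + k ≡ raise (d + + k) (ceiling P) j
    by-cases (yes p) = trans (cong (_+ + k) (raise-at (height P) p)) (trans (+-swap (height P (j - + k)) 1ℤ (+ k))
      (sym (raise-at (ceiling P) (subst (_≋ d + + k) (-+-cancel j (+ k)) (≋-+ (+ k) p)))))
    by-cases (no ¬p) = trans (cong (_+ + k) (raise-off (height P) ¬p))
      (sym (raise-off (ceiling P) (λ p → ¬p (≋-cancel (+ k) (subst (_≋ d + + k) (sym (-+-cancel j (+ k))) p)))))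

  module _ (P Q : LatticePath k n) where
    same-word : (∀ j → step Q j ≡ step P j) → ∀ {w} → IsWord P w → IsWord Q w
    same-word eq D with same-steps P Q eq
    ... | c , h≡ = descent-translate c (λ j → trans (cong (_+ + k) (h≡ (j - + k))) (+-swap (height P (j - + k)) c (+ k))) h≡ D

    -- Swapping RU to UR removes the last box of P from the south and adds its translate to the north.
    swapped-words : ∀ d → (∀ j → step Q j ≡ step P (to (σ d) j)) → step P d ≡ R → step P (d + 1ℤ) ≡ U →
                    ∃ λ w → IsWord P (d ∷ w) × IsWord Q (w ∷ʳ (d + + k))
    swapped-words d eq Pd Pd+1 with swapped-steps P Q d eq Pd Pd+1
    ... | c , h≡ = words (descent-exists 0<k k<n (ceiling-profile P) (raise-profile Hᵖ flat up)
                          (raise-≤ (ceiling-profile P) Hᵖ (height≤ceiling P) below-ceiling))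
      where
      h : ℤ → ℤ
      h = height P
      Hᵖ : Profile (+ k) h
      Hᵖ = height-profile P
      flat : h d ≡ h (d - 1ℤ)
      flat = height-R P d Pd
      up : h (d + 1ℤ) ≡ h d + 1ℤ
      up = trans (height-U P (d + 1ℤ) Pd+1) (cong (λ j → h j + 1ℤ) (+1-1 d))
      d+1≤d+n : d + 1ℤ ≤ d + + n
      d+1≤d+n = ℤₚ.+-monoʳ-≤ d (ℤₚ.<⇒≤ 1<n)
      -- A U step gives 0 < k, and an R step gives k < n below.
      0<k : 0ℤ < + k
      0<k = +1≤⇒< (≤-resp-difference (monotone Hᵖ d+1≤d+n)
        (trans (cong₂ _-_ (slope Hᵖ d) up) (eq′ (h d) (+ k))))
        where
        eq′ : ∀ h k → h + k - (h + 1ℤ) ≡ k - (0ℤ + 1ℤ)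
        eq′ = solve-∀
      k<n : + k < + n
      k<n = +1≤⇒< (≤-resp-difference (monotone (complement Hᵖ) {d} {d - 1ℤ + + n}
          (≤-resp-difference (ℤₚ.<⇒≤ 1<n) (eq₁ d (+ n))))
        (trans (cong₂ (λ x y → d - 1ℤ + + n - x - (d - y)) (slope Hᵖ (d - 1ℤ)) flat) (eq₂ d (+ n) (h (d - 1ℤ)) (+ k))))
        where
        eq₁ : ∀ d n → n - 1ℤ ≡ d - 1ℤ + n - d
        eq₁ = solve-∀
        eq₂ : ∀ d n h k → d - 1ℤ + n - (h + k) - (d - h) ≡ n - (k + 1ℤ)
        eq₂ = solve-∀
      -- The k steps ending at vertex d include the R step d, so the path rises by less than k along
      -- them.
      below-ceiling : h d < ceiling P d
      below-ceiling = +1≤⇒< (≤-resp-difference (monotone (complement Hᵖ) {d - + k} {d - 1ℤ}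
          (≤-resp-difference (<⇒+1≤ 0<k) (eq₁ d (+ k))))
        (trans (cong (λ x → d - 1ℤ - x - (d - + k - h (d - + k))) (sym flat)) (eq₂ d (h d) (h (d - + k)) (+ k))))
        where
        eq₁ : ∀ d k → k - (0ℤ + 1ℤ) ≡ d - 1ℤ - (d - k)
        eq₁ = solve-∀
        eq₂ : ∀ d h g k → d - 1ℤ - h - (d - k - g) ≡ g + k - (h + 1ℤ)
        eq₂ = solve-∀
      ceiling-flat : ceiling P (d + + k) ≡ ceiling P (d + + k - 1ℤ)
      ceiling-flat = trans (ceiling-+k P d) (trans (cong (_+ + k) flat) (sym (ceiling-+k-1 P d)))
      ceiling-up : ceiling P (d + + k + 1ℤ) ≡ ceiling P (d + + k) + 1ℤ
      ceiling-up = trans (cong (ceiling P) (+-swap d (+ k) 1ℤ)) (trans (ceiling-+k P (d + 1ℤ))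
        (trans (cong (_+ + k) up) (trans (+-swap (h d) 1ℤ (+ k)) (cong (_+ 1ℤ) (sym (ceiling-+k P d))))))
      words : (∃ λ w → Descent (ceiling P) w (raise d h)) → ∃ λ w → IsWord P (d ∷ w) × IsWord Q (w ∷ʳ (d + + k))
      words (w , D) = w
        , flip d D (raise-up flat) (raise-flat up) (raise-lowered d h)
        , descent-translate c
            (λ j → trans (cong (_+ + k) (h≡ (j - + k))) (trans (+-swap (raise d h (j - + k)) c (+ k)) (cong (_+ c) (ceiling-raised P d j))))
            h≡
            (descent-∷ʳ (d + + k) (raise-up ceiling-flat) (raise-flat ceiling-up) (raise-lowered (d + + k) (ceiling P)) D)

  module _ (P : LatticePath k n) (d : ℤ) {w} (D : IsWord P w) where
    private
      Hᵖ : Profile (+ k) (height P)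
      Hᵖ = height-profile P
      eq₁ : ∀ d k → d + k + 1ℤ ≡ d + 1ℤ + k
      eq₁ = solve-∀
      eq₂ : ∀ d h k → d - h ≡ d + k - (h + k)
      eq₂ = solve-∀
      eq₃ : ∀ h k → h + 1ℤ + k ≡ h + k + 1ℤ
      eq₃ = solve-∀

    commuting-RR : step P d ≡ R → step P (d + 1ℤ) ≡ R → d ∷ w ∼ w ∷ʳ (d + + k)
    commuting-RR Pd Pd+1 = conveyor-RR (ceiling-profile P) D
      (trans (ceiling-+k P d) (trans (cong (_+ + k) flat) (sym (ceiling-+k-1 P d))))
      (trans (cong (ceiling P) (eq₁ d (+ k))) (trans (ceiling-+k P (d + 1ℤ))
        (trans (cong (_+ + k) flat′) (sym (ceiling-+k P d)))))
      flat flat′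
      (trans (eq₂ d (height P d) (+ k)) (cong (λ x → d + + k - x) (sym (ceiling-+k P d))))
      where
      flat : height P d ≡ height P (d - 1ℤ)
      flat = height-R P d Pd
      flat′ : height P (d + 1ℤ) ≡ height P d
      flat′ = trans (height-R P (d + 1ℤ) Pd+1) (cong (height P) (+1-1 d))

    -- The rows which the ceiling enters at d + k are left at the bottom one period later, at d + n.
    commuting-UU : step P d ≡ U → step P (d + 1ℤ) ≡ U → d ∷ w ∼ w ∷ʳ (d + + k)
    commuting-UU Pd Pd+1 = ∼-trans (cyclic w (≋-sym (≋-period d))) (conveyor-UU (ceiling-profile P) D
      (trans (ceiling-+k P d) (trans (cong (_+ + k) up) (trans (eq₃ (height P (d - 1ℤ)) (+ k))
        (cong (_+ 1ℤ) (sym (ceiling-+k-1 P d))))))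
      (trans (cong (ceiling P) (eq₁ d (+ k))) (trans (ceiling-+k P (d + 1ℤ))
        (trans (cong (_+ + k) up′) (trans (eq₃ (height P d) (+ k)) (cong (_+ 1ℤ) (sym (ceiling-+k P d)))))))
      (up-≋ Hᵖ (≋-sym (≋-period d)) up)
      (next-up-≋ Hᵖ (≋-sym (≋-period d)) up′)
      (trans (slope Hᵖ d) (sym (ceiling-+k P d))))
      where
      up : height P d ≡ height P (d - 1ℤ) + 1ℤ
      up = height-U P d Pd
      up′ : height P (d + 1ℤ) ≡ height P d + 1ℤ
      up′ = trans (height-U P (d + 1ℤ) Pd+1) (cong (λ j → height P j + 1ℤ) (+1-1 d))

    commuting-word : step P d ≡ step P (d + 1ℤ) → d ∷ w ∼ w ∷ʳ (d + + k)
    commuting-word eq = by-step (step P d) refl (sym eq)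
      where
      by-step : ∀ x → step P d ≡ x → step P (d + 1ℤ) ≡ step P d → d ∷ w ∼ w ∷ʳ (d + + k)
      by-step R Pd Pd+1 = commuting-RR Pd (trans Pd+1 Pd)
      by-step U Pd Pd+1 = commuting-UU Pd (trans Pd+1 Pd)

  -- The bijections

  module _ (k≤n : k ℕ.≤ n) (f : AffinePerm n) (P : LatticePath k n) (i : Fin n) where
    private
      d : ℤ
      d = label i

      Q : LatticePath k n
      Q = swapSteps i P

      S : AffinePerm n
      S = σ d

      step-Q : ∀ j → step Q j ≡ step P (to (σ d) j)
      step-Q = step-swap i P

      σd : to (σ d) d ≡ d + 1ℤ
      σd = σ-at ≋-refl

      σd+1 : to (σ d) (d + 1ℤ) ≡ d
      σd+1 = trans (σ-next ≋-refl) (+1-1 d)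

    fixed-words : steps Q ≡ steps P → ∃ λ w → IsWord P w × IsWord Q w × d ∷ w ∼ w ∷ʳ (d + + k)
    fixed-words fixed = words (word-exists k≤n P)
      where
      unchanged : ∀ j → step Q j ≡ step P j
      unchanged j = cong (λ v → lookup v (residue j)) fixed
      equal-steps : step P d ≡ step P (d + 1ℤ)
      equal-steps = trans (sym (unchanged d)) (trans (step-Q d) (cong (step P) σd))
      words : (∃ λ w → IsWord P w) → ∃ λ w → IsWord P w × IsWord Q w × d ∷ w ∼ w ∷ʳ (d + + k)
      words (w , D) = w , D , same-word P Q unchanged D , commuting-word P d D equal-steps

    rising-bijection : ℓ (S · f · S) ≡ ℓ f ℕ.+ 2 → steps Q ≡ steps P ⊎ step P d ≡ R × step P (d + 1ℤ) ≡ U →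
                       Bijection (Deo f P) (Deo (S · f) Q ⊎ₛ Deo (S · f · S) Q)
    rising-bijection +2 = [ by-fixed ∘ fixed-words , (λ (Pd , Pd+1) → by-swapped (swapped-words P Q d step-Q Pd Pd+1)) ]′
      where
      by-fixed : (∃ λ w → IsWord P w × IsWord Q w × d ∷ w ∼ w ∷ʳ (d + + k)) → _
      by-fixed (w , D , E , commutes) = bijection-+ D E {f} {S · f} {S · f · S} (rising-commuting d f w commutes +2)
      by-swapped : (∃ λ w → IsWord P (d ∷ w) × IsWord Q (w ∷ʳ (d + + k))) → _
      by-swapped (w , D , E) = bijection-+ D E {f} {S · f} {S · f · S} (rising-RU d f w +2)

    rising-bijection-UR : ℓ (S · f · S) ≡ ℓ f ℕ.+ 2 → step P d ≡ U × step P (d + 1ℤ) ≡ R →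
                          Bijection (Deo f P) (Deo (f · S) Q ⊎ₛ Deo (S · f · S) Q)
    rising-bijection-UR +2 (Pd , Pd+1) = by-swapped
      -- Swapping is an involution, so P arises from Q by a swap, and Q is the path with steps RU.
      (swapped-words Q P d (λ j → trans (cong (step P) (sym (σσ d j))) (sym (step-Q (to (σ d) j))))
         (trans (step-Q d) (trans (cong (step P) σd) Pd+1))
         (trans (step-Q (d + 1ℤ)) (trans (cong (step P) σd+1) Pd)))
      where
      by-swapped : (∃ λ w → IsWord Q (d ∷ w) × IsWord P (w ∷ʳ (d + + k))) → _
      by-swapped (w , E , D) = bijection-+ D E {f} {f · S} {S · f · S} (rising-UR d f w +2)

    level-bijection : ℓ f ≡ ℓ (S · f · S) → ℓ f ℕ.< ℓ (S · f) → ℓ (f · S) ℕ.< ℓ f →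
                      steps Q ≡ steps P ⊎ step P d ≡ R × step P (d + 1ℤ) ≡ U →
                      Bijection (Deo f P) (Deo (S · f · S) Q)
    level-bijection same f<sf fs<f =
      [ by-fixed ∘ fixed-words , (λ (Pd , Pd+1) → by-swapped (swapped-words P Q d step-Q Pd Pd+1)) ]′
      where
      by-fixed : (∃ λ w → IsWord P w × IsWord Q w × d ∷ w ∼ w ∷ʳ (d + + k)) → _
      by-fixed (w , D , E , commutes) = bijection-≡ D E {f} {S · f · S} (level-commuting d f w commutes same f<sf fs<f)
      by-swapped : (∃ λ w → IsWord P (d ∷ w) × IsWord Q (w ∷ʳ (d + + k))) → _
      by-swapped (w , D , E) = bijection-≡ D E {f} {S · f · S} (level-RU d f w same f<sf fs<f)

theorem1p4 : ∀ {k n : ℕ} .{{_ : NonTrivial n}} → k ℕ.≤ n →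
    (f : AffinePerm n) → Bounded k f → (P : LatticePath k n) (i : Fin n) →
    ( ℓ (s i · f · s i) ≡ ℓ f ℕ.+ 2 →
    ( steps (swapSteps i P) ≡ steps P ⊎ step P (label i) ≡ R × step P (label i + 1ℤ) ≡ U →
    Bijection (Deo f P)
    (Deo (s i · f) (swapSteps i P) ⊎ₛ Deo (s i · f · s i) (swapSteps i P)) )
    ×
    ( step P (label i) ≡ U × step P (label i + 1ℤ) ≡ R →
    Bijection (Deo f P)
    (Deo (f · s i) (swapSteps i P) ⊎ₛ Deo (s i · f · s i) (swapSteps i P)) ) )
    ×
    ( ℓ f ≡ ℓ (s i · f · s i) → ℓ f ℕ.< ℓ (s i · f) → ℓ (f · s i) ℕ.< ℓ f →
    steps (swapSteps i P) ≡ steps P ⊎ step P (label i) ≡ R × step P (label i + 1ℤ) ≡ U →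
    Bijection (Deo f P) (Deo (s i · f · s i) (swapSteps i P)) )
theorem1p4 {k} {n} k≤n f _ P i = subst Claim (σ-label i)
  ((λ +2 → rising-bijection k≤n f P i +2 , rising-bijection-UR k≤n f P i +2) , level-bijection k≤n f P i)
  where
  open Periodic n
  open Rank n k
  Q : LatticePath k n
  Q = swapSteps i P
  -- The generator is a variable here, since `σ (label i)` is abstract and equals `s i` only
  -- propositionally.
  Claim : AffinePerm n → Set
  Claim x =
    ( ℓ (x · f · x) ≡ ℓ f ℕ.+ 2 →
      ( steps Q ≡ steps P ⊎ step P (label i) ≡ R × step P (label i + 1ℤ) ≡ U →
        Bijection (Deo f P) (Deo (x · f) Q ⊎ₛ Deo (x · f · x) Q) ) ×
      ( step P (label i) ≡ U × step P (label i + 1ℤ) ≡ R →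
        Bijection (Deo f P) (Deo (f · x) Q ⊎ₛ Deo (x · f · x) Q) ) ) ×
    ( ℓ f ≡ ℓ (x · f · x) → ℓ f ℕ.< ℓ (x · f) → ℓ (f · x) ℕ.< ℓ f →
      steps Q ≡ steps P ⊎ step P (label i) ≡ R × step P (label i + 1ℤ) ≡ U →
      Bijection (Deo f P) (Deo (x · f · x) Q) )
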